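{- Consider the Black Hole Search (BHS) problem in oriented tori of arbitrary size containing one black hole, with $k$ scattered constant-memory agents each carrying the same constant number $t$ of movable tokens. (1) At least three agents are necessary: if some algorithm (one finite automaton) solves BHS in all oriented tori with $k$ agents, then $k\ge 3$. (2) Any algorithm solving BHS in all oriented tori using three agents requires at least two movable tokens per agent: if some algorithm (one finite automaton) solves BHS in all oriented tori with $k=3$ agents carrying $t$ movable tokens each, then $t\ge 2$.
   Context: Network: an anonymous (nodes unlabeled), synchronous, oriented torus of size $n\times m$, $n,m\ge 3$: at each node the four incident edges are consistently marked North, East, South, West. Exactly one node is a black hole: it destroys every agent entering it, leaving no trace. Agents: $k\ge 2$ anonymous identical agents are scattered, i.e. they start at pairwise distinct nodes, none at the black hole. They follow the same deterministic algorithm, start at the same time in the same initial state, do not know $n$ or $m$, and act synchronously. Each initially carries $t$ identical tokens ($t$ constant) which can be placed at nodes. Tokens and agents at a node are visible only to agents at the same node; agents can interact only by means of tokens and when they meet at the same node. In each time unit an agent at a node may detect tokens/agents at the node, release or take tokens there, and stay or move to an adjacent node. A token is movable if any agent can pick it up and move it to any node of the network. Formally an agent is a Moore automaton $\mathcal A=(S,S_0,\Sigma,\Lambda,\delta,\phi)$ with a finite state set $S$, initial state $S_0$, transition function $\delta:S\times\Sigma\to S$ and output function $\phi:S\to\Lambda$. Elements of $\Sigma$ are quadruples $(D,x,y,b)$: $D\in\{\text{North, South, East, West, none}\}$ is the direction through which the agent arrived at the node, $x$ the number of tokens at the node, $y$ the number of tokens carried by the agent, and $b\in\{\text{true},\text{false}\}$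 tells whether at least one other agent is at the node. Elements of $\Lambda$ are quadruples $(P,s,X,M)$: $P\in\{\text{put},\text{pick}\}$ is an action on $s$ tokens, $X\in\{\text{North, South, East, West, none}\}$ is the edge marked as dangerous, and $M\in\{\text{North, South, East, West, none}\}$ is the move; the token action is performed before the marking, and the marking before the move. A link marked dangerous is permanently disabled. Solving BHS: for every position of the black hole and every initial placement of the scattered agents, within finite time all links incident to the black hole, and only those links, are marked dangerous and at least one agent survives. An algorithm solves BHS in all oriented tori (tori of arbitrary size) if this holds for all $n,m\ge 3$ with the same automaton. -}

module Defs where

open import Algebra.Properties.CommutativeMonoid.Sum using (sum)
open import Data.Bool using (Bool; true; false; _∨_; if_then_else_)
open import Data.Fin using (Fin; zero; suc; toℕ)
import Data.Fin.Properties as Fin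
open import Data.Maybe using (Maybe; just; nothing; Is-just; _>>=_)
open import Data.Maybe.Relation.Unary.Any as Any using (Any)
open import Data.Nat using (ℕ; zero; suc; _+_; _∸_; _⊓_; _≤_; z≤n)
open import Data.Nat.DivMod using (_mod_)
open import Data.Nat.GeneralisedArithmetic using (fold)
open import Data.Nat.Properties using
  ( +-0-commutativeMonoid; +-comm; +-monoʳ-≤; ≤-trans; ≤-reflexive
  ; m⊓n≤m; m⊓n+n∸m≡n; m≤n⇒m⊓n≡m; m+n≤o⇒m≤o; m+n≤o⇒m≤o∸n )
open import Data.Product using (_×_; _,_; ∃-syntax)
open import Data.Product.Properties using (≡-dec)
open import Function using (_⇔_; Injective)
open import Relation.Binary using (DecidableEquality)
open import Relation.Binary.PropositionalEquality using (_≡_; _≢_; refl; subst)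
open import Relation.Nullary using (Dec; yes; no; ¬?; _×-dec_)
open import Relation.Nullary.Decidable using (⌊_⌋)

∑ : ∀ {k} → (Fin k → ℕ) → ℕ
∑ = sum +-0-commutativeMonoid

data Direction : Set where
  north east south west : Direction

opposite : Direction → Direction
opposite north = south
opposite east  = west
opposite south = north
opposite west  = east

-- The direction "none" is represented by nothing.

record Input : Set where
  constructor input
  field
    arrival      : Maybe Direction
    tokensHere   : ℕ
    tokensHeld   : ℕ
    othersHere   : Bool

data Action : Set where
  put pick : Action

record Output : Set where
  constructor output
  field
    action : Action
    amount : ℕ
    danger : Maybe Direction
    move   : Maybe Direction

record Automaton : Set where
  field
    size    : ℕ
    initial : Fin size
    δ       : Fin size → Input → Fin size
    φ       : Fin size → Output

-- How the tokens of a node are shared out when agents there want to pick up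
-- some of them simultaneously: given the number of tokens available and the
-- number requested by each agent (0 for agents elsewhere), the number each
-- agent obtains.  Only when several agents compete for too few tokens, where
-- the model prescribes nothing, does the rule have any freedom; in particular
-- agents that do not compete cannot learn an identity from it.

record Arbiter (k : ℕ) : Set where
  field
    grant     : ℕ → (Fin k → ℕ) → Fin k → ℕ
    bounded   : ∀ x r i → grant x r i ≤ r i
    feasible  : ∀ x r → ∑ (grant x r) ≤ x
    satisfied : ∀ x r → ∑ r ≤ x → ∀ i → grant x r i ≡ r i
    alone     : ∀ x r i → (∀ j → j ≢ i → r j ≡ 0) → grant x r i ≡ r i ⊓ x

-- Such rules exist: for instance, serve the agents in the order of their index.

priority : ∀ k → Arbiter k
priority k = record
  { grant = greedy ; bounded = bnd ; feasible = feas ; satisfied = sat ; alone = aln }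
  where
  greedy : ∀ {k} → ℕ → (Fin k → ℕ) → Fin k → ℕ
  greedy x r zero    = r zero ⊓ x
  greedy x r (suc i) = greedy (x ∸ r zero) (λ j → r (suc j)) i

  bnd : ∀ {k} x (r : Fin k → ℕ) i → greedy x r i ≤ r i
  bnd x r zero    = m⊓n≤m (r zero) x
  bnd x r (suc i) = bnd (x ∸ r zero) (λ j → r (suc j)) i

  feas : ∀ {k} x (r : Fin k → ℕ) → ∑ (greedy x r) ≤ x
  feas {zero}  x r = z≤n
  feas {suc k} x r = ≤-trans
    (+-monoʳ-≤ (r zero ⊓ x) (feas (x ∸ r zero) (λ j → r (suc j))))
    (≤-reflexive (m⊓n+n∸m≡n (r zero) x))

  sat : ∀ {k} x (r : Fin k → ℕ) → ∑ r ≤ x → ∀ i → greedy x r i ≡ r i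
  sat x r p zero    = m≤n⇒m⊓n≡m (m+n≤o⇒m≤o (r zero) p)
  sat x r p (suc i) =
    sat (x ∸ r zero) (λ j → r (suc j))
        (m+n≤o⇒m≤o∸n _ (subst (_≤ x) (+-comm (r zero) _) p)) i

  aln : ∀ {k} x (r : Fin k → ℕ) i → (∀ j → j ≢ i → r j ≡ 0) →
        greedy x r i ≡ r i ⊓ x
  aln x r zero    h = refl
  aln x r (suc i) h rewrite h zero (λ ()) =
    aln x (λ j → r (suc j)) i (λ j j≢i → h (suc j) (λ e → j≢i (Fin.suc-injective e)))

next prev : ∀ {n} → Fin n → Fin n
next {suc n} i = suc (toℕ i) mod suc n
prev {suc n} i = (toℕ i + n) mod suc n

module Torus (n m : ℕ) where

  Node : Set
  Node = Fin n × Fin m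

  neighbour : Node → Direction → Node
  neighbour (x , y) north = x , next y
  neighbour (x , y) east  = next x , y
  neighbour (x , y) south = x , prev y
  neighbour (x , y) west  = prev x , y

  data Axis : Set where
    horizontal vertical : Axis

  -- (v , horizontal) is the undirected link between v and its east neighbour,
  -- (v , vertical) the one between v and its north neighbour; for n, m ≥ 3
  -- every link has exactly one such name.

  Link : Set
  Link = Node × Axis

  link : Node → Direction → Link
  link v north = v , vertical
  link v east  = v , horizontal
  link v south = neighbour v south , vertical
  link v west  = neighbour v west , horizontal

  Incident : Node → Link → Set
  Incident v l = ∃[ d ] link v d ≡ l

  _≟ᵛ_ : DecidableEquality Node
  _≟ᵛ_ = ≡-dec Fin._≟_ Fin._≟_

  _≟ᵃ_ : DecidableEquality Axis
  horizontal ≟ᵃ horizontal = yes refl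
  horizontal ≟ᵃ vertical   = no λ ()
  vertical   ≟ᵃ horizontal = no λ ()
  vertical   ≟ᵃ vertical   = yes refl

  _≟ˡ_ : DecidableEquality Link
  _≟ˡ_ = ≡-dec _≟ᵛ_ _≟ᵃ_

module Execution {k : ℕ} (arb : Arbiter k) (A : Automaton) (n m : ℕ)
                 (blackHole : Fin n × Fin m) where

  open Torus n m
  open Automaton A
  open Arbiter arb

  record Agent : Set where
    constructor agent
    field
      position : Node
      state    : Fin size
      arrived  : Maybe Direction
      held     : ℕ

  open Agent

  record Configuration : Set where
    constructor configuration
    field
      agents : Fin k → Maybe Agent    -- nothing: destroyed by the black hole
      tokens : Node → ℕ
      marked : Link → Bool

  open Configuration

  -- In one time unit every surviving agent observes its node, changes state,
  -- and performs the output of the new state.  (The first observation is the same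
  -- for all agents, so letting them act once before observing would define the
  -- same class of algorithms.)  The agents act in lockstep:
  -- first all token actions, then all markings, then all moves.

  module Step (c : Configuration) where

    At : Fin k → Node → Set
    At i v = Any (λ a → position a ≡ v) (agents c i)

    at? : ∀ i v → Dec (At i v)
    at? i v = Any.dec (λ a → position a ≟ᵛ v) (agents c i)

    observe : Fin k → Agent → Input
    observe i a = input (arrived a) (tokens c (position a)) (held a)
      ⌊ Fin.any? (λ j → ¬? (j Fin.≟ i) ×-dec at? j (position a)) ⌋

    newState : Fin k → Agent → Fin size
    newState i a = δ (state a) (observe i a)

    out : Fin k → Agent → Output
    out i a = φ (newState i a)

    module _ (v : Node) where

      ifHere : (Agent → ℕ) → Maybe Agent → ℕ
      ifHere f nothing  = 0
      ifHere f (just a) = if ⌊ position a ≟ᵛ v ⌋ then f a else 0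

      requestOf : Output → ℕ
      requestOf (output pick s _ _) = s
      requestOf (output put  _ _ _) = 0

      requests : Fin k → ℕ
      requests i = ifHere (λ a → requestOf (out i a)) (agents c i)

      -- An agent cannot put down more tokens than it carries.
      releaseOf : Output → ℕ → ℕ
      releaseOf (output put  s _ _) y = s ⊓ y
      releaseOf (output pick _ _ _) y = 0

      releases : Fin k → ℕ
      releases i = ifHere (λ a → releaseOf (out i a) (held a)) (agents c i)

      obtained : Fin k → ℕ
      obtained = grant (tokens c v) requests

    tokens′ : Node → ℕ
    tokens′ v = tokens c v ∸ ∑ (obtained v) + ∑ (releases v)

    held′ : Fin k → Agent → ℕ
    held′ i a = held a ∸ releases (position a) i + obtained (position a) i

    Marks : Link → Fin k → Set
    Marks l i =
      Any (λ a → Any (λ d → link (position a) d ≡ l) (Output.danger (out i a)))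
          (agents c i)

    marks? : ∀ l i → Dec (Marks l i)
    marks? l i =
      Any.dec (λ a → Any.dec (λ d → link (position a) d ≟ˡ l)
                             (Output.danger (out i a)))
              (agents c i)

    marked′ : Link → Bool
    marked′ l = marked c l ∨ ⌊ Fin.any? (marks? l) ⌋

    enter : Node → (Node → Agent) → Maybe Agent
    enter v f = if ⌊ v ≟ᵛ blackHole ⌋ then nothing else just (f v)

    -- An agent trying to use a disabled link stays where it is.
    moveAgent : Fin k → Agent → Maybe Agent
    moveAgent i a = go (Output.move (out i a))
      where
      stay : Maybe Agent
      stay = just (agent (position a) (newState i a) nothing (held′ i a))

      go : Maybe Direction → Maybe Agent
      go nothing  = stay
      go (just d) =
        if marked′ (link (position a) d)
        then stay
        else enter (neighbour (position a) d)
                   (λ v → agent v (newState i a) (just (opposite d)) (held′ i a))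

    step : Configuration
    step = configuration (λ i → agents c i >>= moveAgent i) tokens′ marked′

  start : (t : ℕ) (placement : Fin k → Node) → Configuration
  start t placement = configuration
    (λ i → just (agent (placement i) initial nothing t)) (λ _ → 0) (λ _ → false)

  run : (t : ℕ) (placement : Fin k → Node) → ℕ → Configuration
  run t placement = fold (start t placement) Step.step

  record Solved (c : Configuration) : Set where
    field
      exactlyMarked : ∀ l → marked c l ≡ true ⇔ Incident blackHole l
      survivor      : ∃[ i ] Is-just (agents c i)

SolvesBHS : {k : ℕ} → Arbiter k → (t : ℕ) → Automaton → Set
SolvesBHS {k} arb t A =
  ∀ n m → 3 ≤ n → 3 ≤ m →
  (blackHole : Fin n × Fin m) (placement : Fin k → Fin n × Fin m) →
  Injective _≡_ _≡_ placement → (∀ i → placement i ≢ blackHole) →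
  let open Execution arb A n m blackHole in
  ∃[ T ] (∀ T′ → T ≤ T′ → Solved (run t placement T′))

{-# OPTIONS --safe #-}

-- As long as no agent notices another one or its tokens, the run of k agents is the superposition
-- of k translates of the run of a single agent on the empty torus.
--
-- Two agents: let the first move of the single agent be in direction d.  If it ever leaves the line
-- through its home node in direction d, put the black hole where it then is, and start the other
-- agent just before the black hole, so that it dies on its first move: both agents die and no link
-- is marked.  If it never leaves the line, no agent finds a distant black hole.
--
-- Three agents with one token at most: between two meetings with its token the single agent is a
-- finite automaton on the empty plane, hence its walk eventually repeats a displacement v.  Assume
-- that such a walk is long and leaves the horizontal and vertical lines followed so far.  Then two
-- agents can be placed such that both die on long walks, for two distinct black holes β and β′, and
-- in both cases leave their tokens at the same two nodes.  The third agent cannot know which of β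
-- and β′ is the black hole: it marks no link, or a wrong one, or dies.  Therefore all long walks
-- follow a single row and a single column.  Since the states in which the agent meets its token also
-- recur, the nodes that it visits lie in a row, a column and a strip along the drift of the token,
-- and a black hole away from these is found by nobody.

module Submission where

open import Defs
open import Data.Nat using (ℕ; _≤_)
open import Data.Product using (_×_)
open import Data.Bool as Bool using (Bool; true; false; _∧_; _∨_; if_then_else_; not)
open import Data.Bool.Properties using (∨-zeroʳ)
open import Data.Empty using (⊥; ⊥-elim)
open import Data.Fin using (Fin; zero; suc; toℕ; fromℕ<; combine; #_)
import Data.Fin.Properties as Fin
open import Data.Integer as ℤ using (ℤ; +_; 0ℤ; 1ℤ; -1ℤ; ∣_∣)
open import Data.Integer.DivMod using (_/ℕ_; n%ℕd<d; a≡a%ℕn+[a/ℕn]*n)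
import Data.Integer.Properties as ℤ
open import Data.Integer.Tactic.RingSolver using (solve-∀)
open import Data.List using (List; []; _∷_)
open import Data.Maybe as Maybe using (Maybe; just; nothing)
import Data.Maybe.Properties as Maybe
open import Data.Maybe.Relation.Unary.Any using (Any; just)
open import Data.Nat as ℕ using (zero; suc; _<_; _+_; _*_; _∸_; _⊓_; z≤n; s≤s; s≤s⁻¹; NonZero; _<?_; _≤?_)
open import Data.Nat.DivMod using (_%_; _/_; m≡m%n+[m/n]*n; m%n<n)
import Data.Nat.Properties as ℕ
open import Data.Product using (_,_; ∃-syntax; proj₁; proj₂)
open import Data.Product.Properties using (≡-dec)
open import Data.Sum using (_⊎_; inj₁; inj₂; map₁)
open import Data.Unit using (⊤; tt)
open import Function using (_∘_; Equivalence; _⟨_⟩_)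
open import Relation.Binary.Definitions using (DecidableEquality; tri<; tri≈; tri>)
open import Relation.Binary.PropositionalEquality
open import Relation.Nullary using (Dec; yes; no; ¬_; ¬?; _×-dec_; ¬¬-excluded-middle)
open import Relation.Nullary.Decidable using (⌊_⌋; dec-true; dec-false; isYes≗does; decidable-stable)

-- The trajectory of an undisturbed agent does not depend on where the black hole is. So its silence
-- can be proved in one convenient world and used in all others. Agents in lockstep have displaced
-- their tokens equally; hence at a common time the agent from p meets the token of the agent from q
-- only if its offset from its own token is q - p on the torus. Keeping agents apart thus amounts to
-- avoiding single vectors. The black hole can be moved while the agents start at the same nodes,
-- because extra laps of periodic walks shift both deaths by the same vector.
--
-- The obstacle is the torus: a walk that never returns in the plane may wind around and find its
-- token again. Long walks therefore do not end the run, and constraints on them have to be carried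
-- through the sequence of meetings; the recurrence of meetings makes finitely many of them suffice.
--
-- One scale M exceeds all bounds derived from the number of states. Sites are of order M, the fatal
-- walks of order M^2 and M^3, cross products of order M^4; a side above 10000 M^4 excludes
-- accidental congruences between them.

-- Linear arithmetic over the natural numbers

module Linear where

  open import Data.List using (_++_; concatMap)
  open import Data.List.Properties using (++-assoc)
  open import Data.List.Relation.Unary.All using (All; []; _∷_)
  open import Data.List.Relation.Unary.All.Properties using (++⁺)
  open import Data.Vec as Vec using (Vec; []; _∷_; lookup; zipWith; replicate)
  open import Data.Vec.N-ary using (N-ary; _$ⁿ_; ∀ⁿ; curryⁿ)
  open import Data.Integer using (-[1+_]; +[1+_])

  -- A row a₁ ∷ … ∷ aₙ ∷ c ∷ [] stands for the constraint
  -- 0 ≤ a₁x₁ + … + aₙxₙ + c over natural numbers x₁, …, xₙ.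
  Row : ℕ → Set
  Row n = Vec ℤ (suc n)

  value : ∀ {n} → Row n → Vec ℕ n → ℤ
  value r []      = Vec.head r
  value r (x ∷ ρ) = Vec.head r ℤ.* + x ℤ.+ value (Vec.tail r) ρ

  Holds : ∀ {n} → Vec ℕ n → Row n → Set
  Holds ρ r = 0ℤ ℤ.≤ value r ρ

  comb : ∀ {n} → ℕ → Row n → ℕ → Row n → Row n
  comb a r b s = zipWith (λ x y → + a ℤ.* x ℤ.+ + b ℤ.* y) r s

  comb-value : ∀ {n} a (r : Row n) b s ρ →
    value (comb a r b s) ρ ≡ + a ℤ.* value r ρ ℤ.+ + b ℤ.* value s ρ
  comb-value a (x ∷ [])    b (y ∷ [])    []      = refl
  comb-value a (x ∷ r@(_ ∷ _)) b (y ∷ s@(_ ∷ _)) (k ∷ ρ) rewrite comb-value a r b s ρ =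
    shuffle (+ a) (+ b) x y (+ k) (value r ρ) (value s ρ)
    where
    shuffle : ∀ a b x y k p q → (a ℤ.* x ℤ.+ b ℤ.* y) ℤ.* k ℤ.+ (a ℤ.* p ℤ.+ b ℤ.* q)
            ≡ a ℤ.* (x ℤ.* k ℤ.+ p) ℤ.+ b ℤ.* (y ℤ.* k ℤ.+ q)
    shuffle = solve-∀

  comb-holds : ∀ {n} a (r : Row n) b s ρ → Holds ρ r → Holds ρ s → Holds ρ (comb a r b s)
  comb-holds a r b s ρ hr hs = subst (0ℤ ℤ.≤_) (sym (comb-value a r b s ρ))
    (ℤ.+-mono-≤ (scale a hr) (scale b hs))
    where
    scale : ∀ a {x} → 0ℤ ℤ.≤ x → 0ℤ ℤ.≤ + a ℤ.* x
    scale a {x} h = subst (ℤ._≤ + a ℤ.* x) (ℤ.*-zeroʳ (+ a)) (ℤ.*-monoˡ-≤-nonNeg (+ a) h)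

  -- Fourier–Motzkin elimination of the first variable.
  pairWith : ∀ {n} → ℕ → Row n → List (Row (suc n)) → List (Row n)
  pairWith b s []                    = []
  pairWith b s ((+[1+ a ] ∷ r) ∷ rs) = comb b r (suc a) s ∷ pairWith b s rs
  pairWith b s ((_ ∷ _) ∷ rs)        = pairWith b s rs

  -- Rows with a positive head are lower bounds on the first variable and are taken from `all`;
  -- upper bounds are taken from the list being traversed. The nonnegativity of the variable is a
  -- lower bound, so it is added to `all` only.
  project : ∀ {n} → List (Row (suc n)) → List (Row (suc n)) → List (Row n)
  project all []                      = []
  project all ((-[1+ b ] ∷ s) ∷ rs)   = pairWith (suc b) s all ++ project all rs
  project all ((+ zero ∷ r) ∷ rs)     = r ∷ project all rs
  project all ((+[1+ _ ] ∷ _) ∷ rs)   = project all rs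

  nonneg : ∀ {n} → Row (suc n)
  nonneg = 1ℤ ∷ replicate _ 0ℤ

  -- The elimination is rational: `true` means that some nonnegative combination of the constraints
  -- is a negative constant, as in Farkas' lemma. Integrality enters only where a strict inequality
  -- e < f is translated to 1 + e ≤ f.
  refutes : ∀ {n} → List (Row n) → Bool
  refutes {suc n} rs = refutes (project (nonneg ∷ rs) rs)
  refutes {zero}  []                        = false
  refutes {zero}  ((-[1+ _ ] ∷ []) ∷ rs)    = true
  refutes {zero}  ((+ _ ∷ []) ∷ rs)         = refutes {zero} rs

  pairWith-holds : ∀ {n} b (s : Row n) rs x ρ → Holds (x ∷ ρ) ((ℤ.- (+ b)) ∷ s) →
    All (Holds (x ∷ ρ)) rs → All (Holds ρ) (pairWith b s rs)
  pairWith-holds b s []                    x ρ hs []       = []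
  pairWith-holds b s ((+[1+ a ] ∷ r) ∷ rs) x ρ hs (h ∷ hr) =
    subst (0ℤ ℤ.≤_) (trans (cancel (+ b) +[1+ a ] (+ x) (value r ρ) (value s ρ))
                           (sym (comb-value b r (suc a) s ρ)))
          (subst (0ℤ ℤ.≤_) (comb-value b (+[1+ a ] ∷ r) (suc a) ((ℤ.- (+ b)) ∷ s) (x ∷ ρ))
                 (comb-holds b (+[1+ a ] ∷ r) (suc a) ((ℤ.- (+ b)) ∷ s) (x ∷ ρ) h hs))
    ∷ pairWith-holds b s rs x ρ hs hr
    where
    cancel : ∀ b a x p q → b ℤ.* (a ℤ.* x ℤ.+ p) ℤ.+ a ℤ.* ((ℤ.- b) ℤ.* x ℤ.+ q)
                           ≡ b ℤ.* p ℤ.+ a ℤ.* q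
    cancel = solve-∀
  pairWith-holds b s ((+ zero ∷ _) ∷ rs)   x ρ hs (_ ∷ hr) = pairWith-holds b s rs x ρ hs hr
  pairWith-holds b s ((-[1+ _ ] ∷ _) ∷ rs) x ρ hs (_ ∷ hr) = pairWith-holds b s rs x ρ hs hr

  project-holds : ∀ {n} (all rs : List (Row (suc n))) x ρ → All (Holds (x ∷ ρ)) all →
    All (Holds (x ∷ ρ)) rs → All (Holds ρ) (project all rs)
  project-holds all []                    x ρ ha []       = []
  project-holds all ((-[1+ b ] ∷ s) ∷ rs) x ρ ha (h ∷ hr) =
    ++⁺ (pairWith-holds (suc b) s all x ρ h ha) (project-holds all rs x ρ ha hr)
  project-holds all ((+ zero ∷ r) ∷ rs)   x ρ ha (h ∷ hr) =
    subst (0ℤ ℤ.≤_) (ℤ.+-identityˡ _) h ∷ project-holds all rs x ρ ha hr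
  project-holds all ((+[1+ _ ] ∷ _) ∷ rs) x ρ ha (_ ∷ hr) = project-holds all rs x ρ ha hr

  zero-value : ∀ {n} (ρ : Vec ℕ n) → value (replicate _ 0ℤ) ρ ≡ 0ℤ
  zero-value []      = refl
  zero-value (x ∷ ρ) rewrite zero-value ρ = refl

  refutes-sound : ∀ {n} (rs : List (Row n)) ρ → refutes rs ≡ true → All (Holds ρ) rs → ⊥
  refutes-sound {suc n} rs (x ∷ ρ) e h =
    refutes-sound (project (nonneg ∷ rs) rs) ρ e
      (project-holds (nonneg ∷ rs) rs x ρ (positive ∷ h) h)
    where
    positive : Holds (x ∷ ρ) nonneg
    positive rewrite zero-value ρ | ℤ.*-identityˡ (+ x) | ℤ.+-identityʳ (+ x) = ℤ.+≤+ z≤n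
  refutes-sound {zero} ((-[1+ _ ] ∷ []) ∷ rs) [] e (() ∷ _)
  refutes-sound {zero} ((+ _ ∷ []) ∷ rs)      [] e (_ ∷ h) = refutes-sound rs [] e h

  infixl 7 _:+_
  infixl 8 _:*_
  infix  6 _:≤_ _:<_ _:≡_
  infix  3 _⊢_

  data Expr (n : ℕ) : Set where
    con  : ℕ → Expr n
    var  : Fin n → Expr n
    _:+_ : Expr n → Expr n → Expr n
    _:*_ : ℕ → Expr n → Expr n

  eval : ∀ {n} → Vec ℕ n → Expr n → ℕ
  eval ρ (con c)  = c
  eval ρ (var i)  = lookup ρ i
  eval ρ (e :+ f) = eval ρ e ℕ.+ eval ρ f
  eval ρ (c :* e) = c ℕ.* eval ρ e

  unit : ∀ {n} → Fin n → Row n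
  unit {suc n} zero    = 1ℤ ∷ replicate _ 0ℤ
  unit {suc n} (suc i) = 0ℤ ∷ unit i

  constant : ∀ {n} → ℤ → Row n
  constant {zero}  c = c ∷ []
  constant {suc n} c = 0ℤ ∷ constant c

  row : ∀ {n} → Expr n → Row n
  row (con c)  = constant (+ c)
  row (var i)  = unit i
  row (e :+ f) = comb 1 (row e) 1 (row f)
  row (c :* e) = comb c (row e) 0 (row e)

  unit-value : ∀ {n} (i : Fin n) ρ → value (unit i) ρ ≡ + lookup ρ i
  unit-value zero    (x ∷ ρ) rewrite zero-value ρ | ℤ.*-identityˡ (+ x) = ℤ.+-identityʳ (+ x)
  unit-value (suc i) (x ∷ ρ) = trans (ℤ.+-identityˡ _) (unit-value i ρ)

  constant-value : ∀ {n} c (ρ : Vec ℕ n) → value (constant c) ρ ≡ c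
  constant-value c []      = refl
  constant-value c (x ∷ ρ) = trans (ℤ.+-identityˡ _) (constant-value c ρ)

  row-value : ∀ {n} (e : Expr n) ρ → value (row e) ρ ≡ + eval ρ e
  row-value (con c)  ρ = constant-value (+ c) ρ
  row-value (var i)  ρ = unit-value i ρ
  row-value (e :+ f) ρ rewrite comb-value 1 (row e) 1 (row f) ρ | row-value e ρ | row-value f ρ
    | ℤ.*-identityˡ (+ eval ρ e) | ℤ.*-identityˡ (+ eval ρ f) = refl
  row-value (c :* e) ρ rewrite comb-value c (row e) 0 (row e) ρ | row-value e ρ =
    trans (ℤ.+-identityʳ _) (sym (ℤ.pos-* c (eval ρ e)))

  data Fact (n : ℕ) : Set where
    _:≤_ _:<_ _:≡_ : Expr n → Expr n → Fact n

  ⟦_⟧ : ∀ {n} → Fact n → Vec ℕ n → Set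
  ⟦ e :≤ f ⟧ ρ = eval ρ e ≤ eval ρ f
  ⟦ e :< f ⟧ ρ = suc (eval ρ e) ≤ eval ρ f
  ⟦ e :≡ f ⟧ ρ = eval ρ e ≡ eval ρ f

  difference : ∀ {n} → Expr n → Expr n → Row n
  difference e f = zipWith (λ x y → x ℤ.+ ℤ.- y) (row f) (row e)

  difference-value : ∀ {n} (e f : Expr n) ρ → value (difference e f) ρ ≡ + eval ρ f ℤ.- + eval ρ e
  difference-value e f ρ = trans (go (row f) (row e) ρ) (cong₂ ℤ._-_ (row-value f ρ) (row-value e ρ))
    where
    shuffle : ∀ x y k p q → (x ℤ.+ ℤ.- y) ℤ.* k ℤ.+ (p ℤ.- q) ≡ x ℤ.* k ℤ.+ p ℤ.- (y ℤ.* k ℤ.+ q)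
    shuffle = solve-∀
    go : ∀ {n} (r s : Row n) ρ →
      value (zipWith (λ x y → x ℤ.+ ℤ.- y) r s) ρ ≡ value r ρ ℤ.- value s ρ
    go (x ∷ [])            (y ∷ [])            []      = refl
    go (x ∷ r@(_ ∷ _)) (y ∷ s@(_ ∷ _)) (k ∷ ρ) rewrite go r s ρ =
      shuffle x y (+ k) (value r ρ) (value s ρ)

  rows : ∀ {n} → Fact n → List (Row n)
  rows (e :≤ f) = difference e f ∷ []
  rows (e :< f) = difference (con 1 :+ e) f ∷ []
  rows (e :≡ f) = difference e f ∷ difference f e ∷ []

  ≤-row : ∀ {n} (e f : Expr n) ρ → eval ρ e ≤ eval ρ f → Holds ρ (difference e f)
  ≤-row e f ρ h = subst (0ℤ ℤ.≤_) (sym (difference-value e f ρ)) (ℤ.i≤j⇒0≤j-i (ℤ.+≤+ h))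

  rows-hold : ∀ {n} (p : Fact n) ρ → ⟦ p ⟧ ρ → All (Holds ρ) (rows p)
  rows-hold (e :≤ f) ρ h = ≤-row e f ρ h ∷ []
  rows-hold (e :< f) ρ h = ≤-row (con 1 :+ e) f ρ h ∷ []
  rows-hold (e :≡ f) ρ h = ≤-row e f ρ (ℕ.≤-reflexive h) ∷ ≤-row f e ρ (ℕ.≤-reflexive (sym h)) ∷ []

  data Sequent (n : ℕ) : Set where
    _⊢_ : List (Fact n) → Fact n → Sequent n

  decides : ∀ {n} → List (Row n) → Fact n → Bool
  decides rs (e :≤ f) = refutes (difference (con 1 :+ f) e ∷ rs)
  decides rs (e :< f) = refutes (difference f e ∷ rs)
  decides rs (e :≡ f) = refutes (difference (con 1 :+ f) e ∷ rs) ∧ refutes (difference (con 1 :+ e) f ∷ rs)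

  valid : ∀ {n} → Sequent n → Bool
  valid (ps ⊢ p) = decides (concatMap rows ps) p

  claim : ∀ {n} → Sequent n → Vec ℕ n → Set
  claim ([]     ⊢ q) ρ = ⟦ q ⟧ ρ
  claim (p ∷ ps ⊢ q) ρ = ⟦ p ⟧ ρ → claim (ps ⊢ q) ρ

  ≤-decides : ∀ {n} (rs : List (Row n)) e f ρ → All (Holds ρ) rs →
    refutes (difference (con 1 :+ f) e ∷ rs) ≡ true → eval ρ e ≤ eval ρ f
  ≤-decides rs e f ρ h eq with eval ρ e ℕ.≤? eval ρ f
  ... | yes le = le
  ... | no nle = ⊥-elim (refutes-sound _ ρ eq (≤-row (con 1 :+ f) e ρ (ℕ.≰⇒> nle) ∷ h))

  decides-sound : ∀ {n} (rs : List (Row n)) q ρ → All (Holds ρ) rs → decides rs q ≡ true → ⟦ q ⟧ ρ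
  decides-sound rs (e :≤ f) ρ h eq = ≤-decides rs e f ρ h eq
  decides-sound rs (e :< f) ρ h eq with suc (eval ρ e) ℕ.≤? eval ρ f
  ... | yes le = le
  ... | no nle = ⊥-elim (refutes-sound _ ρ eq (≤-row f e ρ (ℕ.≤-pred (ℕ.≰⇒> nle)) ∷ h))
  decides-sound rs (e :≡ f) ρ h eq
    with refutes (difference (con 1 :+ f) e ∷ rs) in eq₁ | refutes (difference (con 1 :+ e) f ∷ rs) in eq₂
  decides-sound rs (e :≡ f) ρ h refl | true | true =
    ℕ.≤-antisym (≤-decides rs e f ρ h eq₁) (≤-decides rs f e ρ h eq₂)

  -- A `claim` is a curried implication, so its hypotheses arrive one at a time; `rs` accumulates
  -- the rows of those already received.
  valid-sound : ∀ {n} (ps : List (Fact n)) q (rs : List (Row n)) ρ → All (Holds ρ) rs →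
    decides (rs ++ concatMap rows ps) q ≡ true → claim (ps ⊢ q) ρ
  valid-sound []       q rs ρ h eq = decides-sound _ q ρ (++⁺ h []) eq
  valid-sound (p ∷ ps) q rs ρ h eq hp =
    valid-sound ps q (rs ++ rows p) ρ (++⁺ h (rows-hold p ρ hp))
      (subst (λ z → decides z q ≡ true) (sym (++-assoc rs (rows p) (concatMap rows ps))) eq)

  variables : ∀ n → Vec (Expr n) n
  variables n = Vec.tabulate var

  -- linear 2 (λ x y → x :< y ∷ [] ⊢ x :≤ y) refl proves x < y → x ≤ y.
  linear : ∀ n (s : N-ary n (Expr n) (Sequent n)) → valid (s $ⁿ variables n) ≡ true →
    ∀ⁿ n (curryⁿ (claim (s $ⁿ variables n)))
  linear n s eq = spread n (sound (s $ⁿ variables n) eq)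
    where
    sound : ∀ (q : Sequent n) → valid q ≡ true → ∀ ρ → claim q ρ
    sound (ps ⊢ q) eq ρ = valid-sound ps q [] ρ [] eq
    spread : ∀ n {P : Vec ℕ n → Set} → (∀ ρ → P ρ) → ∀ⁿ n (curryⁿ P)
    spread zero    h   = h []
    spread (suc n) h x = spread n (λ ρ → h (x ∷ ρ))

open Linear using (linear; con; _:+_; _:*_; _:≤_; _:<_; _:≡_; _⊢_)

-- Case distinctions, least witnesses and finite sums

-- Excluded middle for an arbitrary `P`, available because the goal is `⊥`. It settles whether a run
-- ever moves and whether it ever leaves a line.
classically : ∀ {P : Set} → (P → ⊥) → (¬ P → ⊥) → ⊥
classically f g = g f

module _ {P : ℕ → Set} (P? : ∀ n → Dec (P n)) where

  search< : ∀ n → (∃[ m ] (m < n × P m × (∀ k → k < m → ¬ P k))) ⊎ (∀ k → k < n → ¬ P k)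
  search< zero = inj₂ λ _ ()
  search< (suc n) with search< n
  ... | inj₁ (m , m<n , p , least) = inj₁ (m , ℕ.m≤n⇒m≤1+n m<n , p , least)
  ... | inj₂ none with P? n
  ...   | yes p = inj₁ (n , ℕ.≤-refl , p , none)
  ...   | no ¬p = inj₂ below
    where
    below : ∀ k → k < suc n → ¬ P k
    below k (s≤s k≤n) with ℕ.m≤n⇒m<n∨m≡n k≤n
    ... | inj₁ k<n  = none k k<n
    ... | inj₂ refl = ¬p

  least : ∀ n → P n → ∃[ m ] (m ≤ n × P m × (∀ k → k < m → ¬ P k))
  least n p with search< (suc n)
  ... | inj₁ (m , s≤s m≤n , q , l) = m , m≤n , q , l
  ... | inj₂ none = ⊥-elim (none n ℕ.≤-refl p)

∑-zero : ∀ {k} (f : Fin k → ℕ) → (∀ i → f i ≡ 0) → ∑ f ≡ 0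
∑-zero {zero}  f h = refl
∑-zero {suc k} f h rewrite h zero = ∑-zero (f ∘ suc) (h ∘ suc)

∑-cong : ∀ {k} {f g : Fin k → ℕ} → (∀ i → f i ≡ g i) → ∑ f ≡ ∑ g
∑-cong {zero}  h = refl
∑-cong {suc k} h = cong₂ _+_ (h zero) (∑-cong (h ∘ suc))

∑-single : ∀ {k} (f : Fin k → ℕ) i → (∀ j → j ≢ i → f j ≡ 0) → ∑ f ≡ f i
∑-single f zero    h rewrite ∑-zero (f ∘ suc) (λ j → h (suc j) λ ()) = ℕ.+-identityʳ (f zero)
∑-single f (suc i) h rewrite h zero (λ ()) =
  ∑-single (f ∘ suc) i (λ j j≢i → h (suc j) (j≢i ∘ Fin.suc-injective))

⌊⌋-true : ∀ {P : Set} (p? : Dec P) → P → ⌊ p? ⌋ ≡ true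
⌊⌋-true p? p = trans (isYes≗does p?) (dec-true p? p)

⌊⌋-false : ∀ {P : Set} (p? : Dec P) → ¬ P → ⌊ p? ⌋ ≡ false
⌊⌋-false p? ¬p = trans (isYes≗does p?) (dec-false p? ¬p)

request : Output → ℕ
request (output pick s _ _) = s
request (output put  _ _ _) = 0

release : Output → ℕ → ℕ
release (output put  s _ _) y = s ⊓ y
release (output pick _ _ _) y = 0

-- Solo runs and their superposition

-- The run of a single agent in a torus without black hole and disabled links.
module SoloRun (A : Automaton) (n m : ℕ) where

  open Torus n m
  open Automaton A

  record Solo : Set where
    constructor solo
    field
      pos  : Node
      st   : Fin size
      arr  : Maybe Direction
      held : ℕ
      tok  : Node → ℕ

  open Solo public

  sees : Solo → Input
  sees σ = input (arr σ) (tok σ (pos σ)) (held σ) false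

  response : Solo → Output
  response σ = φ (δ (st σ) (sees σ))

  Silent : Solo → Set
  Silent σ = Output.danger (response σ) ≡ nothing

  gained given : Solo → ℕ
  gained σ = request (response σ) ⊓ tok σ (pos σ)
  given  σ = release (response σ) (held σ)

  tokAfter : Solo → Node → ℕ
  tokAfter σ v = if ⌊ pos σ ≟ᵛ v ⌋ then tok σ v ∸ gained σ + given σ else tok σ v

  heldAfter : Solo → ℕ
  heldAfter σ = held σ ∸ given σ + gained σ

  moved : Solo → Maybe Direction → Solo
  moved σ nothing  = solo (pos σ) (δ (st σ) (sees σ)) nothing (heldAfter σ) (tokAfter σ)
  moved σ (just d) = solo (neighbour (pos σ) d) (δ (st σ) (sees σ)) (just (opposite d))
                          (heldAfter σ) (tokAfter σ)

  soloStep : Solo → Solo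
  soloStep σ = moved σ (Output.move (response σ))

  tok-soloStep : ∀ σ v → tok (soloStep σ) v ≡ tokAfter σ v
  tok-soloStep σ v with Output.move (response σ)
  ... | nothing = refl
  ... | just d  = refl

  soloRun : Solo → ℕ → Solo
  soloRun σ zero    = σ
  soloRun σ (suc t) = soloStep (soloRun σ t)

module Superposition {k : ℕ} (arb : Arbiter k) (A : Automaton) (n m : ℕ)
                     (blackHole : Fin n × Fin m) where

  open Torus n m
  open Automaton A
  open Arbiter arb
  open SoloRun A n m
  open Execution arb A n m blackHole hiding (module Step)
  open Configuration
  module S = Execution.Step {k} arb A n m blackHole

  toAgent : Solo → Agent
  toAgent σ = agent (pos σ) (st σ) (arr σ) (held σ)

  -- An agent that is no longer alive contributes the tokens it has left behind.
  record Superposed (c : Configuration) (live : Fin k → Bool) (σ : Fin k → Solo) : Set where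
    field
      agents≡ : ∀ i → agents c i ≡ (if live i then just (toAgent (σ i)) else nothing)
      tokens≡ : ∀ v → tokens c v ≡ ∑ (λ i → tok (σ i) v)
      marked≡ : ∀ l → marked c l ≡ false
      outside : ∀ i → live i ≡ true → pos (σ i) ≢ blackHole

  -- The three fates during one step: already dead, surviving, or falling into the black hole. A
  -- dead agent keeps its last solo state, whose tokens remain on the ground.
  Advances : (live live′ : Fin k → Bool) (σ σ′ : Fin k → Solo) → Fin k → Set
  Advances live live′ σ σ′ i =
      (live i ≡ false × live′ i ≡ false × σ′ i ≡ σ i)
    ⊎ (live i ≡ true × σ′ i ≡ soloStep (σ i) ×
        ((live′ i ≡ true × pos (σ′ i) ≢ blackHole) ⊎ (live′ i ≡ false × pos (σ′ i) ≡ blackHole)))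

  -- These conditions make the observation of a live agent equal to that in its solo run. Tokens of
  -- dead agents count as foreign tokens too, but only the nodes of live agents matter.
  record Undisturbed (live : Fin k → Bool) (σ : Fin k → Solo) : Set where
    field
      unseen   : ∀ i j → live i ≡ true → j ≢ i → tok (σ j) (pos (σ i)) ≡ 0
      distinct : ∀ i j → live i ≡ true → live j ≡ true → j ≢ i → pos (σ j) ≢ pos (σ i)

  module _ {c : Configuration} {live : Fin k → Bool} {σ : Fin k → Solo}
           (sup : Superposed c live σ) (und : Undisturbed live σ) where
    open Superposed sup
    open Undisturbed und

    present : ∀ {i} → live i ≡ true → agents c i ≡ just (toAgent (σ i))
    present {i} l = trans (agents≡ i) (cong (if_then just (toAgent (σ i)) else nothing) l)

    absent : ∀ {i} → live i ≡ false → agents c i ≡ nothing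
    absent {i} l = trans (agents≡ i) (cong (if_then just (toAgent (σ i)) else nothing) l)

    tokens-here : ∀ {i} → live i ≡ true → tokens c (pos (σ i)) ≡ tok (σ i) (pos (σ i))
    tokens-here {i} l = trans (tokens≡ _) (∑-single _ i (λ j j≢i → unseen i j l j≢i))

    at-live : ∀ {j} v → S.At c j v → live j ≡ true × pos (σ j) ≡ v
    at-live {j} v h with live j in l
    ... | true  with agents c j | present l | h
    ...   | _ | refl | just e = refl , e
    at-live {j} v h | false with agents c j | absent l | h
    ...   | _ | refl | ()

    observe≡ : ∀ {i} → live i ≡ true → S.observe c i (toAgent (σ i)) ≡ sees (σ i)
    observe≡ {i} l = cong₂ (λ x b → input (arr (σ i)) x (held (σ i)) b) (tokens-here l)
      (⌊⌋-false (Fin.any? (λ j → ¬? (j Fin.≟ i) ×-dec S.at? c j (pos (σ i)))) alone-here)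
      where
      alone-here : ¬ (∃[ j ] (j ≢ i × S.At c j (pos (σ i))))
      alone-here (j , j≢i , h) with at-live (pos (σ i)) h
      ... | lj , e = distinct i j l lj j≢i e

    out≡ : ∀ {i} → live i ≡ true → S.out c i (toAgent (σ i)) ≡ response (σ i)
    out≡ {i} l = cong (λ x → φ (δ (st (σ i)) x)) (observe≡ l)

    requestOf≡ : ∀ v o → S.requestOf c v o ≡ request o
    requestOf≡ v (output put  _ _ _) = refl
    requestOf≡ v (output pick _ _ _) = refl

    releaseOf≡ : ∀ v o y → S.releaseOf c v o y ≡ release o y
    releaseOf≡ v (output put  _ _ _) y = refl
    releaseOf≡ v (output pick _ _ _) y = refl

    module _ {v : Node} where

      ifHere-elsewhere : ∀ f i → ¬ (live i ≡ true × pos (σ i) ≡ v) → S.ifHere c v f (agents c i) ≡ 0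
      ifHere-elsewhere f i h with live i in l
      ... | false = cong (S.ifHere c v f) (absent l)
      ... | true  = trans (cong (S.ifHere c v f) (present l))
        (cong (if_then f (toAgent (σ i)) else 0) (⌊⌋-false (pos (σ i) ≟ᵛ v) (λ e → h (refl , e))))

      ifHere-here : ∀ f i → live i ≡ true → pos (σ i) ≡ v →
                    S.ifHere c v f (agents c i) ≡ f (toAgent (σ i))
      ifHere-here f i l e = trans (cong (S.ifHere c v f) (present l))
        (cong (if_then f (toAgent (σ i)) else 0) (⌊⌋-true (pos (σ i) ≟ᵛ v) e))

      requests-here : ∀ i → live i ≡ true → pos (σ i) ≡ v → S.requests c v i ≡ request (response (σ i))
      requests-here i l e = trans (ifHere-here _ i l e)
        (trans (requestOf≡ v (S.out c i (toAgent (σ i)))) (cong request (out≡ {i} l)))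

      releases-here : ∀ i → live i ≡ true → pos (σ i) ≡ v → S.releases c v i ≡ given (σ i)
      releases-here i l e = trans (ifHere-here _ i l e)
        (trans (releaseOf≡ v (S.out c i (toAgent (σ i))) (held (σ i))) (cong (λ o → release o (held (σ i))) (out≡ {i} l)))

      obtained-elsewhere : ∀ i → ¬ (live i ≡ true × pos (σ i) ≡ v) → S.obtained c v i ≡ 0
      obtained-elsewhere i h = ℕ.n≤0⇒n≡0
        (ℕ.≤-trans (bounded _ _ i) (ℕ.≤-reflexive (ifHere-elsewhere _ i h)))

      others-elsewhere : ∀ i j → live i ≡ true → pos (σ i) ≡ v → j ≢ i →
                         ¬ (live j ≡ true × pos (σ j) ≡ v)
      others-elsewhere i j l e j≢i (lj , ej) = distinct i j l lj j≢i (trans ej (sym e))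

      -- An undisturbed agent has no competitor at its node, so the law `alone` determines what it
      -- obtains. This is why the arbiter may be arbitrary.
      obtained-here : ∀ i → live i ≡ true → pos (σ i) ≡ v → S.obtained c v i ≡ gained (σ i)
      obtained-here i l refl = trans
        (alone _ _ i (λ j j≢i → ifHere-elsewhere _ j (others-elsewhere i j l refl j≢i)))
        (cong₂ _⊓_ (requests-here i l refl) (tokens-here l))

    held≡ : ∀ i → live i ≡ true → S.held′ c i (toAgent (σ i)) ≡ heldAfter (σ i)
    held≡ i l = cong₂ (λ x y → held (σ i) ∸ x + y) (releases-here i l refl) (obtained-here i l refl)

    module _ (silent : ∀ i → live i ≡ true → Silent (σ i)) where

      unmarked : ∀ l → S.marked′ c l ≡ false
      unmarked l = trans (cong (_∨ ⌊ Fin.any? (S.marks? c l) ⌋) (marked≡ l))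
                         (⌊⌋-false (Fin.any? (S.marks? c l)) none)
        where
        silent-out : ∀ {i} → live i ≡ true → Output.danger (S.out c i (toAgent (σ i))) ≡ nothing
        silent-out l = trans (cong Output.danger (out≡ l)) (silent _ l)
        none : ¬ (∃[ i ] S.Marks c l i)
        none (i , h) with live i in li
        ... | true  with agents c i | present li | h
        ...   | _ | refl | just h′ with Output.danger (S.out c i (toAgent (σ i))) | silent-out li | h′
        ...     | _ | refl | ()
        none (i , h) | false with agents c i | absent li | h
        ...   | _ | refl | ()

      survivor : Solo → Maybe Agent
      survivor s = if ⌊ pos s ≟ᵛ blackHole ⌋ then nothing else just (toAgent s)

      moveAgent≡ : ∀ i → live i ≡ true →
        S.moveAgent c i (toAgent (σ i)) ≡ survivor (soloStep (σ i))
      moveAgent≡ i l rewrite out≡ l with Output.move (response (σ i))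
      ... | nothing rewrite ⌊⌋-false (pos (σ i) ≟ᵛ blackHole) (outside i l) =
        cong₂ (λ x y → just (agent (pos (σ i)) (δ (st (σ i)) x) nothing y)) (observe≡ l) (held≡ i l)
      ... | just d rewrite unmarked (link (pos (σ i)) d) =
        cong₂ (λ x y → if ⌊ neighbour (pos (σ i)) d ≟ᵛ blackHole ⌋ then nothing else
                 just (agent (neighbour (pos (σ i)) d) (δ (st (σ i)) x) (just (opposite d)) y))
              (observe≡ l) (held≡ i l)

      module _ {live′ : Fin k → Bool} {σ′ : Fin k → Solo}
               (adv : ∀ i → Advances live live′ σ σ′ i) where

        agents-step : ∀ i → agents (S.step c) i ≡
                            (if live′ i then just (toAgent (σ′ i)) else nothing)
        agents-step i with adv i
        ... | inj₁ (l , l′ , e) rewrite absent l | l′ = refl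
        ... | inj₂ (l , e , inj₁ (l′ , off)) rewrite present l | l′ | e =
          trans (moveAgent≡ i l) (cong (if_then nothing else just (toAgent (soloStep (σ i))))
            (⌊⌋-false (pos (soloStep (σ i)) ≟ᵛ blackHole) off))
        ... | inj₂ (l , e , inj₂ (l′ , on)) rewrite present l | l′ | e =
          trans (moveAgent≡ i l) (cong (if_then nothing else just (toAgent (soloStep (σ i))))
            (⌊⌋-true (pos (soloStep (σ i)) ≟ᵛ blackHole) on))

        tok-elsewhere : ∀ {v} i → ¬ (live i ≡ true × pos (σ i) ≡ v) → tok (σ′ i) v ≡ tok (σ i) v
        tok-elsewhere {v} i h with adv i
        ... | inj₁ (_ , _ , e) = cong (λ s → tok s v) e
        ... | inj₂ (l , e , _) = trans (cong (λ s → tok s v) e) (trans (tok-soloStep (σ i) v)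
          (cong (if_then tok (σ i) v ∸ gained (σ i) + given (σ i) else tok (σ i) v)
                (⌊⌋-false (pos (σ i) ≟ᵛ v) (λ p → h (l , p)))))

        tok-here : ∀ i → live i ≡ true → tok (σ′ i) (pos (σ i)) ≡
                     tok (σ i) (pos (σ i)) ∸ gained (σ i) + given (σ i)
        tok-here i l with adv i
        ... | inj₁ (d , _ , _) with () ← trans (sym l) d
        ... | inj₂ (_ , e , _) = trans (cong (λ s → tok s (pos (σ i))) e)
          (trans (tok-soloStep (σ i) (pos (σ i)))
            (cong (if_then tok (σ i) (pos (σ i)) ∸ gained (σ i) + given (σ i) else tok (σ i) (pos (σ i)))
                  (⌊⌋-true (pos (σ i) ≟ᵛ pos (σ i)) refl)))

        tokens-step : ∀ v → tokens (S.step c) v ≡ ∑ (λ i → tok (σ′ i) v)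
        tokens-step v with Fin.any? (λ i → (live i Bool.≟ true) ×-dec (pos (σ i) ≟ᵛ v))
        ... | no none = trans
          (cong₂ (λ x y → tokens c v ∸ x + y)
            (∑-zero _ (λ i → obtained-elsewhere i (λ h → none (i , h))))
            (∑-zero _ (λ i → ifHere-elsewhere _ i (λ h → none (i , h)))))
          (trans (ℕ.+-identityʳ _) (trans (tokens≡ v)
            (∑-cong (λ i → sym (tok-elsewhere i (λ h → none (i , h)))))))
        ... | yes (i , l , refl) = trans
          (cong₂ _+_
            (cong₂ _∸_ (tokens-here l)
              (trans (∑-single _ i (λ j j≢i → obtained-elsewhere j (others-elsewhere i j l refl j≢i)))
                     (obtained-here i l refl)))
            (trans (∑-single _ i (λ j j≢i → ifHere-elsewhere _ j (others-elsewhere i j l refl j≢i)))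
                   (releases-here i l refl)))
          (sym (trans (∑-single _ i (λ j j≢i →
                         trans (tok-elsewhere j (others-elsewhere i j l refl j≢i)) (unseen i j l j≢i)))
                      (tok-here i l)))

        superposed-step : Superposed (S.step c) live′ σ′
        superposed-step = record
          { agents≡ = agents-step ; tokens≡ = tokens-step ; marked≡ = unmarked ; outside = out }
          where
          out : ∀ i → live′ i ≡ true → pos (σ′ i) ≢ blackHole
          out i l′ with adv i
          ... | inj₁ (_ , d , _) with () ← trans (sym l′) d
          ... | inj₂ (_ , e , inj₁ (_ , off)) = off
          ... | inj₂ (_ , _ , inj₂ (d , _)) with () ← trans (sym l′) d

    marks-danger : ∀ i d → live i ≡ true → Output.danger (response (σ i)) ≡ just d →
                   marked (S.step c) (link (pos (σ i)) d) ≡ true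
    marks-danger i d l e = trans
      (cong (marked c (link (pos (σ i)) d) ∨_)
            (⌊⌋-true (Fin.any? (S.marks? c (link (pos (σ i)) d))) (i , marks)))
      (∨-zeroʳ _)
      where
      marks : S.Marks c (link (pos (σ i)) d) i
      marks rewrite present l = just (subst (Any _) (sym (trans (cong Output.danger (out≡ l)) e)) (just refl))

  marked-step : ∀ c l → marked c l ≡ true → marked (S.step c) l ≡ true
  marked-step c l e rewrite e = refl

  agents-vanish : ∀ c → (∀ i → agents c i ≡ nothing) → ∀ i → agents (S.step c) i ≡ nothing
  agents-vanish c h i rewrite h i = refl

  -- Marks are permanent and the dead do not come back. Hence a wrong mark or an extinction at time
  -- s persists until `T + s`, when the problem must be solved; the lemmas below are the
  -- contradictions obtained in this way.
  module Solving {t : ℕ} {placement : Fin k → Node}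
           (solves : ∃[ T ] (∀ T′ → T ≤ T′ → Solved (run t placement T′))) where

    private
      R : ℕ → Configuration
      R = run t placement

      T : ℕ
      T = proj₁ solves

      persist : (P : Configuration → Set) → (∀ c → P c → P (S.step c)) → ∀ s → P (R s) → P (R (T + s))
      persist P h s p = go T
        where
        go : ∀ j → P (R (j + s))
        go zero    = p
        go (suc j) = h _ (go j)

    marked⇒incident : ∀ {s l} → marked (R s) l ≡ true → Incident blackHole l
    marked⇒incident {s} {l} e = Equivalence.to
      (Solved.exactlyMarked (proj₂ solves (T + s) (ℕ.m≤m+n T s)) l)
      (persist (λ c → marked c l ≡ true) (λ c → marked-step c l) s e)

    not-extinct : ∀ {s} → (∀ i → agents (R s) i ≡ nothing) → ⊥
    not-extinct {s} h with Solved.survivor (proj₂ solves (T + s) (ℕ.m≤m+n T s))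
    ... | i , alive with agents (R (T + s)) i
                       | persist (λ c → ∀ i → agents c i ≡ nothing) agents-vanish s h i | alive
    ...   | _ | refl | ()

    not-unmarked : ∀ s → (∀ r → s ≤ r → ∀ l → marked (R r) l ≡ false) → ⊥
    not-unmarked s h with trans (sym (Equivalence.from
      (Solved.exactlyMarked (proj₂ solves (T + s) (ℕ.m≤m+n T s)) (link blackHole north)) (north , refl)))
      (h (T + s) (ℕ.m≤n+m s T) _)
    ... | ()

    danger⇒incident : ∀ {s live σ} → Superposed (R s) live σ → Undisturbed live σ →
      ∀ i d → live i ≡ true → Output.danger (response (σ i)) ≡ just d →
      Incident blackHole (link (pos (σ i)) d)
    danger⇒incident {s} sup und i d l e = marked⇒incident {suc s} (marks-danger sup und i d l e)

    superposed-extinct : ∀ {s live σ} → Superposed (R s) live σ → (∀ i → live i ≡ false) → ⊥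
    superposed-extinct {s} sup dead = not-extinct {s} (λ i →
      trans (Superposed.agents≡ sup i) (cong (if_then _ else nothing) (dead i)))

-- Congruences and neighbours on the torus

module Modular (N′ : ℕ) where

  N : ℕ
  N = suc N′

  infix 4 _≋_
  record _≋_ (a b : ℤ) : Set where
    constructor multiple
    field
      quotient : ℤ
      equation : a ≡ b ℤ.+ quotient ℤ.* + N

  ≋-sym : ∀ {a b} → a ≋ b → b ≋ a
  ≋-sym {a} {b} (multiple q refl) = multiple (ℤ.- q) (lemma b q (+ N))
    where
    lemma : ∀ b q n → b ≡ b ℤ.+ q ℤ.* n ℤ.+ (ℤ.- q) ℤ.* n
    lemma = solve-∀

  ≋-trans : ∀ {a b c} → a ≋ b → b ≋ c → a ≋ c
  ≋-trans {a} {b} {c} (multiple q refl) (multiple r refl) = multiple (q ℤ.+ r) (lemma c q r (+ N))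
    where
    lemma : ∀ c q r n → c ℤ.+ r ℤ.* n ℤ.+ q ℤ.* n ≡ c ℤ.+ (q ℤ.+ r) ℤ.* n
    lemma = solve-∀

  ≋-refl : ∀ {a} → a ≋ a
  ≋-refl {a} = multiple 0ℤ (sym (ℤ.+-identityʳ a))

  ≋-+ : ∀ {a b c d} → a ≋ b → c ≋ d → a ℤ.+ c ≋ b ℤ.+ d
  ≋-+ {b = b} {d = d} (multiple q refl) (multiple r refl) = multiple (q ℤ.+ r) (lemma b d q r (+ N))
    where
    lemma : ∀ b d q r n → b ℤ.+ q ℤ.* n ℤ.+ (d ℤ.+ r ℤ.* n) ≡ b ℤ.+ d ℤ.+ (q ℤ.+ r) ℤ.* n
    lemma = solve-∀

  ≋-neg : ∀ {a b} → a ≋ b → ℤ.- a ≋ ℤ.- b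
  ≋-neg {b = b} (multiple q refl) = multiple (ℤ.- q) (lemma b q (+ N))
    where
    lemma : ∀ b q n → ℤ.- (b ℤ.+ q ℤ.* n) ≡ ℤ.- b ℤ.+ (ℤ.- q) ℤ.* n
    lemma = solve-∀

  ≋-* : ∀ {a b} c → a ≋ b → c ℤ.* a ≋ c ℤ.* b
  ≋-* {b = b} c (multiple q refl) = multiple (c ℤ.* q) (lemma b c q (+ N))
    where
    lemma : ∀ b c q n → c ℤ.* (b ℤ.+ q ℤ.* n) ≡ c ℤ.* b ℤ.+ c ℤ.* q ℤ.* n
    lemma = solve-∀

  -- A multiple of N of absolute value below N is zero. All equalities of nodes are lifted to the
  -- plane in this way, which is the reason for tracking sizes throughout.
  ≋-near : ∀ {a b} → a ≋ b → ∣ a ℤ.- b ∣ < N → a ≡ b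
  ≋-near {a} {b} (multiple q refl) near = small q (subst (_< N) (trans (cong ∣_∣ (lemma b q (+ N))) (ℤ.abs-* q (+ N))) near)
    where
    lemma : ∀ b q n → b ℤ.+ q ℤ.* n ℤ.- b ≡ q ℤ.* n
    lemma = solve-∀
    small : ∀ q → ∣ q ∣ ℕ.* N < N → b ℤ.+ q ℤ.* + N ≡ b
    small (+ zero)        _ = ℤ.+-identityʳ b
    small (+ suc k)       h = ⊥-elim (ℕ.<⇒≱ h (ℕ.m≤m+n N (k ℕ.* N)))
    small ℤ.-[1+ k ]      h = ⊥-elim (ℕ.<⇒≱ h (ℕ.m≤m+n N (k ℕ.* N)))

  abstract
    residue : ℤ → Fin N
    residue a = fromℕ< (n%ℕd<d a N)

    residue-≋ : ∀ a → + toℕ (residue a) ≋ a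
    residue-≋ a = ≋-sym (multiple (a /ℕ N) (trans (a≡a%ℕn+[a/ℕn]*n a N)
      (cong (λ r → + r ℤ.+ (a /ℕ N) ℤ.* + N) (sym (Fin.toℕ-fromℕ< (n%ℕd<d a N))))))

  toℕ-≋ : ∀ {i j : Fin N} → + toℕ i ≋ + toℕ j → i ≡ j
  toℕ-≋ {i} {j} e = Fin.toℕ-injective (ℤ.+-injective (≋-near e close))
    where
    close : ∣ + toℕ i ℤ.- + toℕ j ∣ < N
    close rewrite ℤ.m-n≡m⊖n (toℕ i) (toℕ j) =
      ℕ.≤-<-trans (ℤ.∣m⊝n∣≤m⊔n (toℕ i) (toℕ j)) (ℕ.⊔-lub (Fin.toℕ<n i) (Fin.toℕ<n j))

  residue-cong : ∀ {a b} → a ≋ b → residue a ≡ residue b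
  residue-cong {a} {b} e = toℕ-≋ (≋-trans (residue-≋ a) (≋-trans e (≋-sym (residue-≋ b))))

  residue-injective : ∀ {a b} → residue a ≡ residue b → a ≋ b
  residue-injective {a} {b} e =
    ≋-trans (≋-sym (residue-≋ a)) (subst (λ r → + toℕ r ≋ b) (sym e) (residue-≋ b))

  residue-toℕ : ∀ i → residue (+ toℕ i) ≡ i
  residue-toℕ i = toℕ-≋ (residue-≋ (+ toℕ i))

  mod-≋ : ∀ m {i} → i ≡ m % N → + i ≋ + m
  mod-≋ m refl = ≋-sym (multiple (+ (m / N)) (trans (cong +_ (m≡m%n+[m/n]*n m N))
    (trans (ℤ.pos-+ (m % N) _) (cong (λ z → + (m % N) ℤ.+ z) (ℤ.pos-* (m / N) N)))))

  next-residue : ∀ a → next (residue a) ≡ residue (a ℤ.+ 1ℤ)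
  next-residue a = toℕ-≋ (≋-trans (mod-≋ (suc (toℕ (residue a))) (Fin.toℕ-fromℕ< _))
    (≋-trans (subst (_≋ (a ℤ.+ 1ℤ)) (ℤ.+-comm (+ toℕ (residue a)) 1ℤ) (≋-+ (residue-≋ a) ≋-refl))
             (≋-sym (residue-≋ (a ℤ.+ 1ℤ)))))

  prev-residue : ∀ a → prev (residue a) ≡ residue (a ℤ.+ -1ℤ)
  prev-residue a = toℕ-≋ (≋-trans (mod-≋ (toℕ (residue a) ℕ.+ N′) (Fin.toℕ-fromℕ< _))
    (≋-trans (≋-trans (multiple 1ℤ (trans (ℤ.pos-+ (toℕ (residue a)) N′) (lemma (+ toℕ (residue a)) (+ N′))))
                      (≋-+ (residue-≋ a) (≋-refl { -1ℤ})))
             (≋-sym (residue-≋ (a ℤ.+ -1ℤ)))))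
    where
    lemma : ∀ r n → r ℤ.+ n ≡ r ℤ.+ -1ℤ ℤ.+ 1ℤ ℤ.* (1ℤ ℤ.+ n)
    lemma = solve-∀

prev-next : ∀ {n} (i : Fin n) → prev (next i) ≡ i
prev-next {suc n} i = begin
  prev (next i)                           ≡⟨ cong (λ j → prev (next j)) (residue-toℕ i) ⟨
  prev (next (residue (+ toℕ i)))         ≡⟨ cong prev (next-residue _) ⟩
  prev (residue (+ toℕ i ℤ.+ 1ℤ))         ≡⟨ prev-residue _ ⟩
  residue (+ toℕ i ℤ.+ 1ℤ ℤ.+ -1ℤ)        ≡⟨ cong residue (cancel (+ toℕ i)) ⟩
  residue (+ toℕ i)                       ≡⟨ residue-toℕ i ⟩
  i                                       ∎
  where
  open Modular n
  open ≡-Reasoning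
  cancel : ∀ a → a ℤ.+ 1ℤ ℤ.+ -1ℤ ≡ a
  cancel = solve-∀

next-prev : ∀ {n} (i : Fin n) → next (prev i) ≡ i
next-prev {suc n} i = begin
  next (prev i)                           ≡⟨ cong (λ j → next (prev j)) (residue-toℕ i) ⟨
  next (prev (residue (+ toℕ i)))         ≡⟨ cong next (prev-residue _) ⟩
  next (residue (+ toℕ i ℤ.+ -1ℤ))        ≡⟨ next-residue _ ⟩
  residue (+ toℕ i ℤ.+ -1ℤ ℤ.+ 1ℤ)        ≡⟨ cong residue (cancel (+ toℕ i)) ⟩
  residue (+ toℕ i)                       ≡⟨ residue-toℕ i ⟩
  i                                       ∎
  where
  open Modular n
  open ≡-Reasoning
  cancel : ∀ a → a ℤ.+ -1ℤ ℤ.+ 1ℤ ≡ a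
  cancel = solve-∀

module _ {n m : ℕ} where
  open Torus n m

  neighbour-opposite : ∀ v d → neighbour (neighbour v (opposite d)) d ≡ v
  neighbour-opposite (x , y) north = cong (x ,_) (next-prev y)
  neighbour-opposite (x , y) east  = cong (_, y) (next-prev x)
  neighbour-opposite (x , y) south = cong (x ,_) (prev-next y)
  neighbour-opposite (x , y) west  = cong (_, y) (prev-next x)

  -- What a mark reveals: as only links of the black hole may be marked, an agent that marks is at
  -- distance at most one from it.
  incident⇒near : ∀ {b v} d → Incident b (link v d) → b ≡ v ⊎ ∃[ e ] b ≡ neighbour v e
  incident⇒near north (north , e) = inj₁ (cong proj₁ e)
  incident⇒near {b} north (south , e) =
    inj₂ (north , trans (sym (neighbour-opposite b north)) (cong (λ v → neighbour v north) (cong proj₁ e)))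
  incident⇒near south (north , e) = inj₂ (south , cong proj₁ e)
  incident⇒near {b} {v} south (south , e) = inj₁ (trans (sym (neighbour-opposite b north))
    (trans (cong (λ v → neighbour v north) (cong proj₁ e)) (neighbour-opposite v north)))
  incident⇒near east (east , e) = inj₁ (cong proj₁ e)
  incident⇒near {b} east (west , e) =
    inj₂ (east , trans (sym (neighbour-opposite b east)) (cong (λ v → neighbour v east) (cong proj₁ e)))
  incident⇒near west (east , e) = inj₂ (west , cong proj₁ e)
  incident⇒near {b} {v} west (west , e) = inj₁ (trans (sym (neighbour-opposite b east))
    (trans (cong (λ v → neighbour v east) (cong proj₁ e)) (neighbour-opposite v east)))
  incident⇒near north (east , e) with () ← cong proj₂ e
  incident⇒near north (west , e) with () ← cong proj₂ e
  incident⇒near south (east , e) with () ← cong proj₂ e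
  incident⇒near south (west , e) with () ← cong proj₂ e
  incident⇒near east (north , e) with () ← cong proj₂ e
  incident⇒near east (south , e) with () ← cong proj₂ e
  incident⇒near west (north , e) with () ← cong proj₂ e
  incident⇒near west (south , e) with () ← cong proj₂ e

_≟ᵈ_ : DecidableEquality Direction
north ≟ᵈ north = yes refl
north ≟ᵈ east  = no λ ()
north ≟ᵈ south = no λ ()
north ≟ᵈ west  = no λ ()
east  ≟ᵈ north = no λ ()
east  ≟ᵈ east  = yes refl
east  ≟ᵈ south = no λ ()
east  ≟ᵈ west  = no λ ()
south ≟ᵈ north = no λ ()
south ≟ᵈ east  = no λ ()
south ≟ᵈ south = yes refl
south ≟ᵈ west  = no λ ()
west  ≟ᵈ north = no λ ()
west  ≟ᵈ east  = no λ ()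
west  ≟ᵈ south = no λ ()
west  ≟ᵈ west  = yes refl

is-nothing : ∀ {m : Maybe Direction} → ¬ (m ≢ nothing) → m ≡ nothing
is-nothing {nothing} h = refl
is-nothing {just _}  h = ⊥-elim (h λ ())

something : ∀ {m : Maybe Direction} → m ≢ nothing → ∃[ d ] m ≡ just d
something {nothing} h = ⊥-elim (h refl)
something {just d}  h = d , refl

-- Two agents

module TwoAgents (t : ℕ) (arb : Arbiter 2) (A : Automaton) (solves : SolvesBHS arb t A) where

  open import Data.Nat.Properties

  -- Side 7 has room for the node (3, 3), at cyclic distance 3 from both the row and the column of
  -- (0, 0).
  open Torus 7 7
  open Automaton A
  open SoloRun A 7 7

  begins : Node → Solo
  begins p = solo p initial nothing t (λ _ → 0)

  p₂ : Node
  p₂ = zero , zero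

  walk : ℕ → Solo
  walk = soloRun (begins p₂)

  moves : ℕ → Maybe Direction
  moves s = Output.move (response (walk s))

  across : Direction → Node → Fin 7
  across north = proj₁
  across south = proj₁
  across east  = proj₂
  across west  = proj₂

  OnLine : Direction → Node → Set
  OnLine d v = across d v ≡ zero

  across-back : ∀ d v → across d (neighbour v (opposite d)) ≡ across d v
  across-back north v = refl
  across-back south v = refl
  across-back east  v = refl
  across-back west  v = refl

  start-on-line : ∀ d → OnLine d p₂
  start-on-line north = refl
  start-on-line south = refl
  start-on-line east  = refl
  start-on-line west  = refl

  far : Node
  far = # 3 , # 3

  far-off : ∀ d {v} → OnLine d v → ¬ (far ≡ v ⊎ ∃[ e ] far ≡ neighbour v e)
  far-off north e (inj₁ refl) with () ← e
  far-off south e (inj₁ refl) with () ← e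
  far-off east  e (inj₁ refl) with () ← e
  far-off west  e (inj₁ refl) with () ← e
  far-off north {_ , _} refl (inj₂ (north , e)) with () ← cong proj₁ e
  far-off north {_ , _} refl (inj₂ (south , e)) with () ← cong proj₁ e
  far-off north {_ , _} refl (inj₂ (east  , e)) with () ← cong proj₁ e
  far-off north {_ , _} refl (inj₂ (west  , e)) with () ← cong proj₁ e
  far-off south {_ , _} refl (inj₂ (north , e)) with () ← cong proj₁ e
  far-off south {_ , _} refl (inj₂ (south , e)) with () ← cong proj₁ e
  far-off south {_ , _} refl (inj₂ (east  , e)) with () ← cong proj₁ e
  far-off south {_ , _} refl (inj₂ (west  , e)) with () ← cong proj₁ e
  far-off east  {_ , _} refl (inj₂ (north , e)) with () ← cong proj₂ e
  far-off east  {_ , _} refl (inj₂ (south , e)) with () ← cong proj₂ e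
  far-off east  {_ , _} refl (inj₂ (east  , e)) with () ← cong proj₂ e
  far-off east  {_ , _} refl (inj₂ (west  , e)) with () ← cong proj₂ e
  far-off west  {_ , _} refl (inj₂ (north , e)) with () ← cong proj₂ e
  far-off west  {_ , _} refl (inj₂ (south , e)) with () ← cong proj₂ e
  far-off west  {_ , _} refl (inj₂ (east  , e)) with () ← cong proj₂ e
  far-off west  {_ , _} refl (inj₂ (west  , e)) with () ← cong proj₂ e

  tok-unvisited : ∀ {σ v} → v ≢ pos σ → tok (soloStep σ) v ≡ tok σ v
  tok-unvisited {σ} {v} off = trans (tok-soloStep σ v)
    (cong (if_then tok σ v ∸ gained σ + given σ else tok σ v) (⌊⌋-false (pos σ ≟ᵛ v) (off ∘ sym)))

  moved-nothing : ∀ σ → Output.move (response σ) ≡ nothing →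
    soloStep σ ≡ moved σ nothing
  moved-nothing σ e = cong (moved σ) e

  OnLineUntil : Direction → ℕ → Set
  OnLineUntil d s = ∀ r → r ≤ s → OnLine d (pos (walk r))

  tokens-on-line : ∀ d s → OnLineUntil d s → ∀ v → ¬ OnLine d v → tok (walk s) v ≡ 0
  tokens-on-line d zero    on v off = refl
  tokens-on-line d (suc s) on v off = trans
    (tok-unvisited {walk s} (λ e → off (trans (cong (across d) e) (on s (n≤1+n s)))))
    (tokens-on-line d s (λ r h → on r (m≤n⇒m≤1+n h)) v off)

  -- Until its first move an agent at p behaves like the one at p₂.
  record Alike (p : Node) (σ τ : Solo) : Set where
    field
      pos₁ : pos σ ≡ p
      pos₂ : pos τ ≡ p₂
      st≡  : st σ ≡ st τ
      arr≡ : arr σ ≡ arr τ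
      held≡ : held σ ≡ held τ
      tok≡ : tok σ (pos σ) ≡ tok τ (pos τ)
      only : ∀ v → v ≢ p → tok σ v ≡ 0

  module _ {p σ τ} (al : Alike p σ τ) where
    open Alike al

    sees≡ : sees σ ≡ sees τ
    sees≡ rewrite arr≡ | held≡ | tok≡ = refl

    response≡ : response σ ≡ response τ
    response≡ = cong φ (cong₂ δ st≡ sees≡)

    only-step : ∀ v → v ≢ p → tok (soloStep σ) v ≡ 0
    only-step v off = trans (tok-unvisited {σ} (λ e → off (trans e pos₁))) (only v off)

    alike-step : Output.move (response τ) ≡ nothing → Alike p (soloStep σ) (soloStep τ)
    alike-step quiet rewrite moved-nothing τ quiet
                           | moved-nothing σ (trans (cong Output.move response≡) quiet) = record
      { pos₁ = pos₁ ; pos₂ = pos₂ ; st≡ = cong₂ δ st≡ sees≡ ; arr≡ = refl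
      ; held≡ = cong₂ _+_ (cong₂ _∸_ held≡ given≡) gained≡
      ; tok≡ = trans (here σ) (trans (cong₂ _+_ (cong₂ _∸_ tok≡ gained≡) given≡) (sym (here τ)))
      ; only = λ v off → trans (trans (sym (tok-soloStep σ v)) (only-step v off)) refl }
      where
      given≡ : given σ ≡ given τ
      given≡ = cong₂ release response≡ held≡
      gained≡ : gained σ ≡ gained τ
      gained≡ = cong₂ _⊓_ (cong request response≡) tok≡
      here : ∀ σ → tokAfter σ (pos σ) ≡ tok σ (pos σ) ∸ gained σ + given σ
      here σ = cong (if_then tok σ (pos σ) ∸ gained σ + given σ else tok σ (pos σ))
        (⌊⌋-true (pos σ ≟ᵛ pos σ) refl)

  alike : ∀ p s → (∀ r → r < s → moves r ≡ nothing) → Alike p (soloRun (begins p) s) (walk s)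
  alike p zero    quiet = record
    { pos₁ = refl ; pos₂ = refl ; st≡ = refl ; arr≡ = refl ; held≡ = refl ; tok≡ = refl
    ; only = λ _ _ → refl }
  alike p (suc s) quiet = alike-step (alike p s (λ r h → quiet r (m≤n⇒m≤1+n h))) (quiet s ≤-refl)

  -- A world in which agent 1 enters the black hole b if its first move is made in direction d,
  -- while agent 2 walks along the line through p₂ in this direction.
  module World (d : Direction) (b : Node) (off : ¬ OnLine d b) where

    open Superposition arb A 7 7 b
    open Execution arb A 7 7 b using (run; module Configuration)

    p₁ : Node
    p₁ = neighbour b (opposite d)

    p₁-off : ¬ OnLine d p₁
    p₁-off e = off (trans (sym (across-back d b)) e)

    p₂-on : OnLine d p₂
    p₂-on = start-on-line d

    placement : Fin 2 → Node
    placement zero       = p₁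
    placement (suc zero) = p₂

    p₁≢b : p₁ ≢ b
    p₁≢b e = no-loop d b e
      where
      no-loop₁ : (x : Fin 7) → next x ≢ x
      no-loop₁ zero ()
      no-loop₁ (suc zero) ()
      no-loop₁ (suc (suc zero)) ()
      no-loop₁ (suc (suc (suc zero))) ()
      no-loop₁ (suc (suc (suc (suc zero)))) ()
      no-loop₁ (suc (suc (suc (suc (suc zero))))) ()
      no-loop₁ (suc (suc (suc (suc (suc (suc zero)))))) ()
      no-loop₂ : (x : Fin 7) → prev x ≢ x
      no-loop₂ x e = no-loop₁ x (trans (cong next (sym e)) (next-prev x))
      no-loop : ∀ d b → neighbour b (opposite d) ≢ b
      no-loop north b e = no-loop₂ _ (cong proj₂ e)
      no-loop south b e = no-loop₁ _ (cong proj₂ e)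
      no-loop east  b e = no-loop₂ _ (cong proj₁ e)
      no-loop west  b e = no-loop₁ _ (cong proj₁ e)

    placement-off : ∀ i → placement i ≢ b
    placement-off zero       = p₁≢b
    placement-off (suc zero) e = off (trans (cong (across d) (sym e)) p₂-on)

    placement-injective : ∀ {i j} → placement i ≡ placement j → i ≡ j
    placement-injective {zero}     {zero}     e = refl
    placement-injective {zero}     {suc zero} e = ⊥-elim (p₁-off (trans (cong (across d) e) p₂-on))
    placement-injective {suc zero} {zero}     e = ⊥-elim (p₁-off (trans (cong (across d) (sym e)) p₂-on))
    placement-injective {suc zero} {suc zero} e = refl

    open Solving {t} {placement} (solves 7 7 (s≤s (s≤s (s≤s z≤n))) (s≤s (s≤s (s≤s z≤n)))
                                         b placement placement-injective placement-off) public

    -- No move is made before time `T₀`. If the move at `T₀` is in direction d, agent 1 is dead from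
    -- time `suc T₀` on, and its solo run is frozen there by truncating the time.
    module Timed (T₀ : ℕ) (quiet : ∀ r → r < T₀ → moves r ≡ nothing) where

      live : ℕ → Fin 2 → Bool
      live s zero       = ⌊ s ≤? T₀ ⌋
      live s (suc zero) = true

      both : ℕ → Fin 2 → Solo
      both s zero       = soloRun (begins p₁) (s ⊓ suc T₀)
      both s (suc zero) = walk s

      alike₁ : ∀ s → s ≤ T₀ → Alike p₁ (both s zero) (walk s)
      alike₁ s h = subst (λ r → Alike p₁ (soloRun (begins p₁) r) (walk s))
        (sym (m≤n⇒m⊓n≡m (m≤n⇒m≤1+n h))) (alike p₁ s (λ r r<s → quiet r (<-≤-trans r<s h)))

      only₁ : ∀ s v → v ≢ p₁ → tok (both s zero) v ≡ 0
      only₁ s v ne = go (m≤n⇒m<n∨m≡n (m⊓n≤n s (suc T₀)))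
        where
        go : s ⊓ suc T₀ < suc T₀ ⊎ s ⊓ suc T₀ ≡ suc T₀ → tok (both s zero) v ≡ 0
        go (inj₁ (s≤s h)) = Alike.only (alike p₁ (s ⊓ suc T₀) (λ r r< → quiet r (<-≤-trans r< h))) v ne
        go (inj₂ e) = trans (cong (λ r → tok (soloRun (begins p₁) r) v) e)
          (only-step (alike p₁ T₀ quiet) v ne)

      module _ (s : ℕ) (on : OnLineUntil d s) where

        living : live s zero ≡ true → s ≤ T₀
        living l with s ≤? T₀
        ... | yes h = h
        living () | no _

        undisturbed : Undisturbed (live s) (both s)
        undisturbed = record { unseen = unseen ; distinct = distinct }
          where
          pos₂≢p₁ : pos (walk s) ≢ p₁
          pos₂≢p₁ e = p₁-off (trans (cong (across d) (sym e)) (on s ≤-refl))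
          unseen : ∀ i j → live s i ≡ true → j ≢ i → tok (both s j) (pos (both s i)) ≡ 0
          unseen zero zero l ne = ⊥-elim (ne refl)
          unseen zero (suc zero) l ne rewrite Alike.pos₁ (alike₁ s (living l)) =
            tokens-on-line d s on p₁ p₁-off
          unseen (suc zero) zero l ne = only₁ s _ pos₂≢p₁
          unseen (suc zero) (suc zero) l ne = ⊥-elim (ne refl)
          distinct : ∀ i j → live s i ≡ true → live s j ≡ true → j ≢ i → pos (both s j) ≢ pos (both s i)
          distinct zero zero l l′ ne = ⊥-elim (ne refl)
          distinct zero (suc zero) l l′ ne e = pos₂≢p₁ (trans e (Alike.pos₁ (alike₁ s (living l))))
          distinct (suc zero) zero l l′ ne e = pos₂≢p₁ (trans (sym e) (Alike.pos₁ (alike₁ s (living l′))))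
          distinct (suc zero) (suc zero) l l′ ne = ⊥-elim (ne refl)

      -- The first alternative serves an agent that never moves: then `T₀` can be chosen as late as
      -- desired and no first move has to be known.
      advance₁ : ∀ s → suc s ≤ T₀ ⊎ moves T₀ ≡ just d →
        Advances (live s) (live (suc s)) (both s) (both (suc s)) zero
      advance₁ s h with <-cmp s T₀
      ... | tri< s<T₀ _ _ = inj₂ (⌊⌋-true (s ≤? T₀) (<⇒≤ s<T₀) , steps , inj₁
              (⌊⌋-true (suc s ≤? T₀) s<T₀ , λ e → p₁≢b (trans (sym (Alike.pos₁ (alike₁ (suc s) s<T₀))) e)))
        where
        steps : both (suc s) zero ≡ soloStep (both s zero)
        steps = cong (λ r → soloStep (soloRun (begins p₁) r))
          (trans (m≤n⇒m⊓n≡m (<⇒≤ s<T₀)) (sym (m≤n⇒m⊓n≡m (m≤n⇒m≤1+n (<⇒≤ s<T₀)))))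
      ... | tri> _ _ T₀<s = inj₁ (⌊⌋-false (s ≤? T₀) (<⇒≱ T₀<s)
              , ⌊⌋-false (suc s ≤? T₀) (<⇒≱ (m≤n⇒m≤1+n T₀<s))
              , cong (soloRun (begins p₁)) (trans (m≥n⇒m⊓n≡n (m≤n⇒m≤1+n T₀<s)) (sym (m≥n⇒m⊓n≡n T₀<s))))
      advance₁ s (inj₁ h) | tri≈ _ s≡T₀ _ = ⊥-elim (<-irrefl s≡T₀ h)
      advance₁ s (inj₂ e) | tri≈ _ s≡T₀ _ = inj₂ (⌊⌋-true (s ≤? T₀) (≤-reflexive s≡T₀) , steps , inj₂
              (⌊⌋-false (suc s ≤? T₀) (<⇒≱ (s≤s (≤-reflexive (sym s≡T₀)))) , trans (cong pos steps) falls))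
        where
        steps : both (suc s) zero ≡ soloStep (both s zero)
        steps = cong (λ r → soloStep (soloRun (begins p₁) r))
          (trans (m≤n⇒m⊓n≡m (≤-reflexive s≡T₀)) (sym (m≤n⇒m⊓n≡m (m≤n⇒m≤1+n (≤-reflexive s≡T₀)))))
        al : Alike p₁ (both s zero) (walk s)
        al = alike₁ s (≤-reflexive s≡T₀)
        falls : pos (soloStep (both s zero)) ≡ b
        falls = trans (cong (λ x → pos (moved (both s zero) x))
                  (trans (cong Output.move (response≡ al)) (trans (cong moves s≡T₀) e)))
                (trans (cong (λ v → neighbour v d) (Alike.pos₁ al)) (neighbour-opposite b d))

      silent₁ : ∀ s → live s zero ≡ true → Silent (walk s) → Silent (both s zero)
      silent₁ s l q with s ≤? T₀
      ... | yes h = trans (cong Output.danger (response≡ (alike₁ s h))) q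
      silent₁ s () q | no _

      superposed : ∀ s → s ≤ T₀ ⊎ moves T₀ ≡ just d → OnLineUntil d s →
        (∀ r → r < s → Silent (walk r)) → Superposed (run t placement s) (live s) (both s)
      superposed zero    h on q = record
        { agents≡ = λ { zero → refl ; (suc zero) → refl } ; tokens≡ = λ _ → refl ; marked≡ = λ _ → refl
        ; outside = λ { zero _ → p₁≢b ; (suc zero) _ → placement-off (suc zero) } }
      superposed (suc s) h on q = superposed-step
        (superposed s (map₁ <⇒≤ h) on′ (λ r r<s → q r (m≤n⇒m≤1+n r<s)))
        (undisturbed s on′)
        (λ { zero l → silent₁ s l (q s ≤-refl) ; (suc zero) _ → q s ≤-refl })
        (λ { zero → advance₁ s h
           ; (suc zero) → inj₂ (refl , refl , inj₁ (refl , λ e → off (trans (cong (across d) (sym e)) (on (suc s) ≤-refl)))) })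
        where
        on′ : OnLineUntil d s
        on′ r h = on r (m≤n⇒m≤1+n h)

  -- With the black hole at (3, 3) an agent on its line is never next to it, so any mark would be
  -- wrong. The silence obtained here concerns the solo walk alone and is transferred to the world
  -- of `Leaving`, where the black hole is elsewhere.
  module Far (d : Direction) where

    far-off-line : ¬ OnLine d far
    far-off-line e = far-off d e (inj₁ refl)

    open World d far far-off-line public
    open Superposition arb A 7 7 far
    open Execution arb A 7 7 far using (run; module Configuration)

    module Silence (T₀ : ℕ) (quiet : ∀ r → r < T₀ → moves r ≡ nothing) where

      open Timed T₀ quiet public

      silent-at : ∀ s → s ≤ T₀ ⊎ moves T₀ ≡ just d → OnLineUntil d s →
                  (∀ r → r < s → Silent (walk r)) → Silent (walk s)
      silent-at s h on q = is-nothing λ danger → case (something danger)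
        where
        case : ∃[ e ] Output.danger (response (walk s)) ≡ just e → ⊥
        case (e , eq) = far-off d (on s ≤-refl) (incident⇒near e
          (danger⇒incident {s} (superposed s h on q) (undisturbed s on) (suc zero) e refl eq))

      silent : ∀ s → s ≤ T₀ ⊎ moves T₀ ≡ just d → OnLineUntil d s → ∀ r → r < s → Silent (walk r)
      silent (suc s) h on r r≤s = go (m≤n⇒m<n∨m≡n (s≤s⁻¹ r≤s))
        where
        h′ = map₁ <⇒≤ h
        on′ : OnLineUntil d s
        on′ r r≤s = on r (m≤n⇒m≤1+n r≤s)
        go : r < s ⊎ r ≡ s → Silent (walk r)
        go (inj₁ r<s)  = silent s h′ on′ r r<s
        go (inj₂ refl) = silent-at s h′ on′ (silent s h′ on′)

      unmarked-at : ∀ s → s ≤ T₀ ⊎ moves T₀ ≡ just d → OnLineUntil d s → ∀ l →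
        Configuration.marked (run t placement s) l ≡ false
      unmarked-at s h on = Superposed.marked≡ (superposed s h on (silent s h on))

  module Leaving (d : Direction) (T₀ : ℕ) (quiet : ∀ r → r < T₀ → moves r ≡ nothing)
                 (first : moves T₀ ≡ just d) (s : ℕ) (on : OnLineUntil d s)
                 (leaves : ¬ OnLine d (pos (walk (suc s)))) where

    moves⇒T₀≤ : T₀ ≤ s
    moves⇒T₀≤ with T₀ ≤? s
    ... | yes h = h
    ... | no h = ⊥-elim (leaves (trans (cong (λ σ → across d (pos σ))
                   (moved-nothing (walk s) (quiet s (≰⇒> h)))) (on s ≤-refl)))

    open World d (pos (walk (suc s))) leaves
    open Superposition arb A 7 7 (pos (walk (suc s)))
    open Timed T₀ quiet
    open Far.Silence d T₀ quiet using (silent; silent-at)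

    live′ : Fin 2 → Bool
    live′ zero       = live (suc s) zero
    live′ (suc zero) = false

    contradiction : ⊥
    contradiction = superposed-extinct {suc s} {live′} {both (suc s)}
      (superposed-step (superposed s (inj₂ first) on (silent s (inj₂ first) on)) (undisturbed s on)
        (λ { zero l → silent₁ s l quiet-now ; (suc zero) _ → quiet-now })
        (λ { zero → advance₁ s (inj₂ first)
           ; (suc zero) → inj₂ (refl , refl , inj₂ (refl , refl)) }))
      (λ { zero → ⌊⌋-false (suc s ≤? T₀) (<⇒≱ (s≤s moves⇒T₀≤)) ; (suc zero) → refl })
      where
      quiet-now = silent-at s (inj₂ first) on (silent s (inj₂ first) on)

  on-line? : ∀ d s → Dec (¬ OnLine d (pos (walk s)))
  on-line? d s = ¬? (across d (pos (walk s)) Fin.≟ zero)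

  moves? : ∀ s → Dec (moves s ≢ nothing)
  moves? s = ¬? (Maybe.≡-dec _≟ᵈ_ (moves s) nothing)

  impossible : ⊥
  impossible = classically {∃[ s ] moves s ≢ nothing} some none
    where
    none : ¬ (∃[ s ] moves s ≢ nothing) → ⊥
    none h = not-unmarked 0 (λ s _ → Silence.unmarked-at s (λ r _ → never r) s (inj₁ ≤-refl) (λ r _ → still r))
      where
      open Far north
      never : ∀ r → moves r ≡ nothing
      never r = is-nothing (λ m → h (r , m))
      still : ∀ r → OnLine north (pos (walk r))
      still r = cong (across north) (Alike.pos₂ (alike p₂ r (λ r _ → never r)))

    first-move : ∀ T₀ → (∀ r → r < T₀ → ¬ (moves r ≢ nothing)) → ∃[ d ] moves T₀ ≡ just d → ⊥
    first-move T₀ earlier (d , first) = classically {∃[ s ] ¬ OnLine d (pos (walk s))} off on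
      where
      quiet : ∀ r → r < T₀ → moves r ≡ nothing
      quiet r r<T₀ = is-nothing (earlier r r<T₀)
      on : ¬ (∃[ s ] ¬ OnLine d (pos (walk s))) → ⊥
      on h = not-unmarked 0 (λ s _ → Silence.unmarked-at T₀ quiet s (inj₂ first) (λ r _ → always r))
        where
        open Far d
        always : ∀ r → OnLine d (pos (walk r))
        always r = decidable-stable (across d (pos (walk r)) Fin.≟ zero) (λ o → h (r , o))
      off : ∃[ s ] ¬ OnLine d (pos (walk s)) → ⊥
      off (s₁ , o) with least (on-line? d) s₁ o
      ... | zero  , _ , o′ , _ = o′ (start-on-line d)
      ... | suc s , _ , o′ , before = Leaving.contradiction d T₀ quiet first s on′ o′
        where
        on′ : OnLineUntil d s
        on′ r r≤s = decidable-stable (across d (pos (walk r)) Fin.≟ zero) (before r (s≤s r≤s))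

    some : ∃[ s ] moves s ≢ nothing → ⊥
    some (s₀ , m) with least moves? s₀ m
    ... | T₀ , _ , moving , earlier = first-move T₀ earlier (something moving)

-- Plane vectors and their projection to the torus

data Coord : Set where
  X Y : Coord

other : Coord → Coord
other X = Y
other Y = X

ℤ² : Set
ℤ² = ℤ × ℤ

infix  8 _!_
_!_ : ℤ² → Coord → ℤ
z ! X = proj₁ z
z ! Y = proj₂ z

infixl 6 _⊕_ _⊖_
_⊕_ _⊖_ : ℤ² → ℤ² → ℤ²
(x , y) ⊕ (x′ , y′) = x ℤ.+ x′ , y ℤ.+ y′
(x , y) ⊖ (x′ , y′) = x ℤ.- x′ , y ℤ.- y′

𝟎 : ℤ²
𝟎 = 0ℤ , 0ℤ

infixr 7 _⊛_
_⊛_ : ℤ → ℤ² → ℤ²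
k ⊛ (x , y) = k ℤ.* x , k ℤ.* y

!-⊕ : ∀ z w a → (z ⊕ w) ! a ≡ z ! a ℤ.+ w ! a
!-⊕ z w X = refl
!-⊕ z w Y = refl

!-⊖ : ∀ z w a → (z ⊖ w) ! a ≡ z ! a ℤ.- w ! a
!-⊖ z w X = refl
!-⊖ z w Y = refl

!-⊛ : ∀ k z a → (k ⊛ z) ! a ≡ k ℤ.* z ! a
!-⊛ k z X = refl
!-⊛ k z Y = refl

𝟎! : ∀ a → 𝟎 ! a ≡ 0ℤ
𝟎! X = refl
𝟎! Y = refl

vec≡ : ∀ {z w} → (∀ a → z ! a ≡ w ! a) → z ≡ w
vec≡ h = cong₂ _,_ (h X) (h Y)

⊕-assoc : ∀ z w v → z ⊕ w ⊕ v ≡ z ⊕ (w ⊕ v)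
⊕-assoc (a , b) (c , d) (e , f) = cong₂ _,_ (ℤ.+-assoc a c e) (ℤ.+-assoc b d f)

⊕-comm : ∀ z w → z ⊕ w ≡ w ⊕ z
⊕-comm (a , b) (c , d) = cong₂ _,_ (ℤ.+-comm a c) (ℤ.+-comm b d)

⊕-identityʳ : ∀ z → z ⊕ 𝟎 ≡ z
⊕-identityʳ (a , b) = cong₂ _,_ (ℤ.+-identityʳ a) (ℤ.+-identityʳ b)

⊕-identityˡ : ∀ z → 𝟎 ⊕ z ≡ z
⊕-identityˡ (a , b) = cong₂ _,_ (ℤ.+-identityˡ a) (ℤ.+-identityˡ b)

⊕-inverse : ∀ z w → w ⊕ (z ⊖ w) ≡ z
⊕-inverse (a , b) (c , d) = cong₂ _,_ (lemma a c) (lemma b d)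
  where
  lemma : ∀ a c → c ℤ.+ (a ℤ.- c) ≡ a
  lemma = solve-∀

δ⟦_⟧ : Direction → ℤ²
δ⟦ north ⟧ = 0ℤ , 1ℤ
δ⟦ east  ⟧ = 1ℤ , 0ℤ
δ⟦ south ⟧ = 0ℤ , -1ℤ
δ⟦ west  ⟧ = -1ℤ , 0ℤ

δ? : Maybe Direction → ℤ²
δ? nothing  = 𝟎
δ? (just d) = δ⟦ d ⟧

δ-bound : ∀ d a → ∣ δ⟦ d ⟧ ! a ∣ ≤ 1
δ-bound north X = z≤n
δ-bound north Y = ℕ.≤-refl
δ-bound south X = z≤n
δ-bound south Y = ℕ.≤-refl
δ-bound east X = ℕ.≤-refl
δ-bound east Y = z≤n
δ-bound west X = ℕ.≤-refl
δ-bound west Y = z≤n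

δ?-bound : ∀ m a → ∣ δ? m ! a ∣ ≤ 1
δ?-bound nothing  X = z≤n
δ?-bound nothing  Y = z≤n
δ?-bound (just d) a = δ-bound d a

module Projection (N′ : ℕ) where

  open Modular N′ public
  open Torus N N

  ι : ℤ² → Node
  ι (x , y) = residue x , residue y

  ι-neighbour : ∀ z d → neighbour (ι z) d ≡ ι (z ⊕ δ⟦ d ⟧)
  ι-neighbour (x , y) north = cong₂ _,_ (cong residue (sym (ℤ.+-identityʳ x))) (next-residue y)
  ι-neighbour (x , y) east  = cong₂ _,_ (next-residue x) (cong residue (sym (ℤ.+-identityʳ y)))
  ι-neighbour (x , y) south = cong₂ _,_ (cong residue (sym (ℤ.+-identityʳ x))) (prev-residue y)
  ι-neighbour (x , y) west  = cong₂ _,_ (prev-residue x) (cong residue (sym (ℤ.+-identityʳ y)))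

  ι⇒≋ : ∀ {z w} → ι z ≡ ι w → ∀ a → z ! a ≋ w ! a
  ι⇒≋ e X = residue-injective (cong proj₁ e)
  ι⇒≋ e Y = residue-injective (cong proj₂ e)

  ≋⇒ι : ∀ {z w} → (∀ a → z ! a ≋ w ! a) → ι z ≡ ι w
  ≋⇒ι h = cong₂ _,_ (residue-cong (h X)) (residue-cong (h Y))

  infix 4 _≈_ _≉_
  _≈_ _≉_ : ℤ² → ℤ² → Set
  z ≈ w = ι z ≡ ι w
  z ≉ w = ¬ (z ≈ w)

  ≈-⊕ : ∀ {z w z′ w′} → z ≈ w → z′ ≈ w′ → z ⊕ z′ ≈ w ⊕ w′
  ≈-⊕ {z} {w} {z′} {w′} e e′ = ≋⇒ι λ a → subst₂ _≋_ (sym (!-⊕ z z′ a)) (sym (!-⊕ w w′ a))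
    (≋-+ (ι⇒≋ e a) (ι⇒≋ e′ a))

  ≈-cancelˡ : ∀ p {z w} → p ⊕ z ≈ p ⊕ w → z ≈ w
  ≈-cancelˡ p {z} {w} e = subst₂ _≈_ (drop p z) (drop p w) (≈-⊕ {𝟎 ⊖ p} {𝟎 ⊖ p} refl e)
    where
    lemma : ∀ a c → 0ℤ ℤ.- a ℤ.+ (a ℤ.+ c) ≡ c
    lemma = solve-∀
    drop : ∀ p z → (𝟎 ⊖ p) ⊕ (p ⊕ z) ≡ z
    drop (a , b) (c , d) = cong₂ _,_ (lemma a c) (lemma b d)

  ≈-cancelʳ : ∀ p {z w} → z ⊕ p ≈ w ⊕ p → z ≈ w
  ≈-cancelʳ p {z} {w} e = ≈-cancelˡ p (subst₂ _≈_ (⊕-comm z p) (⊕-comm w p) e)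

  ≈-near : ∀ {z w} a → z ≈ w → ∣ z ! a ℤ.- w ! a ∣ < N → z ! a ≡ w ! a
  ≈-near a e = ≋-near (ι⇒≋ e a)

  incident⇒≈ : ∀ {b z} d → Incident (ι b) (link (ι z) d) → ∃[ m ] b ≈ z ⊕ δ? m
  incident⇒≈ {b} {z} d h with incident⇒near d h
  ... | inj₁ e       = nothing , trans e (cong ι (sym (⊕-identityʳ z)))
  ... | inj₂ (f , e) = just f , trans e (ι-neighbour z f)

-- Runs with at most one token in plane coordinates

-- The run of a single agent with at most one token on the N × N torus, in plane coordinates
-- relative to its starting node.  The token lies at the home node, or travels with the agent.
module AbstractRun (A : Automaton) (t : ℕ) (t≤1 : t ≤ 1) (N′ : ℕ) (1≤N′ : 1 ≤ N′) where

  open Automaton A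
  open Projection N′ public
  open Torus N N
  open SoloRun A N N

  Mind : Set
  Mind = Fin size × Maybe Direction

  data Cfg : Set where
    at   : Mind → (carried : Bool) → (home : ℤ²) → Cfg
    away : Mind → (home offset : ℤ²) → Cfg

  -- For t = 0 the flag moves a phantom token of weight 0. Agents without tokens and with one token
  -- are thereby treated together.
  load : Bool → ℕ
  load c = if c then t else 0

  respond : Mind → (here hand : ℕ) → Fin size
  respond (s , a) here hand = δ s (input a here hand false)

  -- Without disabled links the arrival direction is a function of the state: the reverse of the
  -- move that this state prescribes.
  think : Fin size → Mind
  think s = s , Maybe.map opposite (Output.move (φ s))

  -- With at most one token, every positive amount means the whole supply, since excess requests and
  -- releases are truncated.
  carriedAfter : Output → Bool → Bool
  carriedAfter (output _    zero    _ _) c = c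
  carriedAfter (output put  (suc _) _ _) c = false
  carriedAfter (output pick (suc _) _ _) c = true

  coState : Mind → Bool → Fin size
  coState x c = respond x (load (not c)) (load c)

  freeState : Mind → Fin size
  freeState x = respond x 0 0

  leave : Mind → Bool → ℤ² → Maybe Direction → Cfg
  leave x true  u m        = at x true (u ⊕ δ? m)
  leave x false u nothing  = at x false u
  leave x false u (just d) = away x u δ⟦ d ⟧

  -- The test is made on the torus although `ω` is a plane vector: a walk that has wound around and
  -- found its token is put back to offset `𝟎`. Plane positions may thus jump by multiples of N,
  -- which `ι` does not see.
  roam : Mind → ℤ² → ℤ² → Cfg
  roam x u ω = if ⌊ ι ω ≟ᵛ ι 𝟎 ⌋ then at x false u else away x u ω

  next-state : Cfg → Fin size
  next-state (at x c u)   = coState x c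
  next-state (away x u ω) = freeState x

  answer : Cfg → Output
  answer α = φ (next-state α)

  cfgStep : Cfg → Cfg
  cfgStep (at x c u)   = let s = coState x c in
    leave (think s) (carriedAfter (φ s) c) u (Output.move (φ s))
  cfgStep (away x u ω) = let s = freeState x in
    roam (think s) u (ω ⊕ δ? (Output.move (φ s)))

  home offset place : Cfg → ℤ²
  home (at x c u)     = u
  home (away x u ω)   = u
  offset (at x c u)   = 𝟎
  offset (away x u ω) = ω
  place α = home α ⊕ offset α

  mind : Cfg → Mind
  mind (at x c u)   = x
  mind (away x u ω) = x

  carried : Cfg → Bool
  carried (at x c u)   = c
  carried (away x u ω) = false

  Proper : Cfg → Set
  Proper (at _ _ _)   = ⊤
  Proper (away _ _ ω) = ω ≉ 𝟎

  outset : Cfg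
  outset = at (initial , nothing) true 𝟎

  cfg : ℕ → Cfg
  cfg zero    = outset
  cfg (suc s) = cfgStep (cfg s)

  record Represents (p : ℤ²) (σ : Solo) (α : Cfg) : Set where
    field
      pos≡   : pos σ ≡ ι (p ⊕ place α)
      st≡    : st σ ≡ proj₁ (mind α)
      arr≡   : arr σ ≡ proj₂ (mind α)
      held≡  : held σ ≡ load (carried α)
      tok≡   : ∀ v → tok σ v ≡ (if ⌊ ι (p ⊕ home α) ≟ᵛ v ⌋ then load (not (carried α)) else 0)
      proper : Proper α

  transfer-held : ∀ o c → let y = load c; x = load (not c) in
    y ∸ release o y + (request o ⊓ x) ≡ load (carriedAfter o c)
  transfer-held o c = go o c t t≤1
    where
    go : ∀ o c t → t ≤ 1 → let y = if c then t else 0; x = if not c then t else 0 in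
      y ∸ release o y + (request o ⊓ x) ≡ (if carriedAfter o c then t else 0)
    go (output put  zero    _ _) true  t h = ℕ.+-identityʳ t
    go (output put  zero    _ _) false t h = refl
    go (output put  (suc k) _ _) true  .0 z≤n = refl
    go (output put  (suc k) _ _) true  .1 (s≤s z≤n) rewrite ℕ.⊓-zeroʳ k = refl
    go (output put  (suc k) _ _) false t h = refl
    go (output pick zero    _ _) true  t h = ℕ.+-identityʳ t
    go (output pick zero    _ _) false t h = refl
    go (output pick (suc k) _ _) true  t h = ℕ.+-identityʳ t
    go (output pick (suc k) _ _) false .0 z≤n = refl
    go (output pick (suc k) _ _) false .1 (s≤s z≤n) rewrite ℕ.⊓-zeroʳ k = refl

  transfer-ground : ∀ o c → let y = load c; x = load (not c) in
    x ∸ (request o ⊓ x) + release o y ≡ load (not (carriedAfter o c))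
  transfer-ground o c = go o c t t≤1
    where
    go : ∀ o c t → t ≤ 1 → let y = if c then t else 0; x = if not c then t else 0 in
      x ∸ (request o ⊓ x) + release o y ≡ (if not (carriedAfter o c) then t else 0)
    go (output put  zero    _ _) true  t h = refl
    go (output put  zero    _ _) false t h = ℕ.+-identityʳ t
    go (output put  (suc k) _ _) true  .0 z≤n = refl
    go (output put  (suc k) _ _) true  .1 (s≤s z≤n) rewrite ℕ.⊓-zeroʳ k = refl
    go (output put  (suc k) _ _) false t h = ℕ.+-identityʳ t
    go (output pick zero    _ _) true  t h = refl
    go (output pick zero    _ _) false t h = ℕ.+-identityʳ t
    go (output pick (suc k) _ _) true  t h = refl
    go (output pick (suc k) _ _) false .0 z≤n = refl
    go (output pick (suc k) _ _) false .1 (s≤s z≤n) rewrite ℕ.⊓-zeroʳ k = refl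

  here : Cfg → ℕ
  here (at x c u)   = load (not c)
  here (away x u ω) = 0

  if-zero : ∀ b → (if b then 0 else 0) ≡ 0
  if-zero true  = refl
  if-zero false = refl

  δ≉𝟎 : ∀ d → δ⟦ d ⟧ ≉ 𝟎
  δ≉𝟎 north e with () ← ≈-near Y e (s≤s 1≤N′)
  δ≉𝟎 south e with () ← ≈-near Y e (s≤s 1≤N′)
  δ≉𝟎 east  e with () ← ≈-near X e (s≤s 1≤N′)
  δ≉𝟎 west  e with () ← ≈-near X e (s≤s 1≤N′)

  release-0 : ∀ o → release o 0 ≡ 0
  release-0 (output put  s _ _) = ℕ.⊓-zeroʳ s
  release-0 (output pick s _ _) = refl

  represented-here : ∀ {p σ α} → Represents p σ α → tok σ (pos σ) ≡ here α
  represented-here {p} {σ} {at x c u} r = trans (Represents.tok≡ r (pos σ))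
    (cong (if_then load (not c) else 0) (⌊⌋-true (ι (p ⊕ u) ≟ᵛ pos σ)
      (sym (trans (Represents.pos≡ r) (cong (λ z → ι (p ⊕ z)) (⊕-identityʳ u))))))
  represented-here {p} {σ} {away x u ω} r = trans (Represents.tok≡ r (pos σ))
    (cong (if_then t else 0) (⌊⌋-false (ι (p ⊕ u) ≟ᵛ pos σ) (λ e → Represents.proper r
      (≈-cancelˡ u (≈-cancelˡ p (trans (sym (Represents.pos≡ r))
        (trans (sym e) (cong (λ z → ι (p ⊕ z)) (sym (⊕-identityʳ u))))))))))

  next-state≡ : ∀ α → next-state α ≡ respond (mind α) (here α) (load (carried α))
  next-state≡ (at x c u)   = refl
  next-state≡ (away x u ω) = refl

  represented-state : ∀ {p σ α} → Represents p σ α → δ (st σ) (sees σ) ≡ next-state α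
  represented-state {p} {σ} {α} r = trans
    (cong₂ (λ s i → δ s i) st≡
      (trans (cong₂ (λ a x → input a x (held σ) false) arr≡ (represented-here r))
             (cong (λ y → input (proj₂ (mind α)) (here α) y false) held≡)))
    (sym (next-state≡ α))
    where open Represents r

  represented-answer : ∀ {p σ α} → Represents p σ α → response σ ≡ answer α
  represented-answer r = cong φ (represented-state r)

  represents-moved : ∀ {p σ α} β m → Represents p σ α → place α ⊕ δ? m ≈ place β →
    mind β ≡ (next-state α , Maybe.map opposite m) → heldAfter σ ≡ load (carried β) →
    (∀ v → tokAfter σ v ≡ (if ⌊ ι (p ⊕ home β) ≟ᵛ v ⌋ then load (not (carried β)) else 0)) →
    Proper β → Represents p (moved σ m) β
  represents-moved {p} {σ} {α} β nothing r e x h τ pr = record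
    { pos≡ = trans (Represents.pos≡ r) (≈-⊕ {p} {p} refl (subst (_≈ place β) (⊕-identityʳ (place α)) e))
    ; st≡ = trans (represented-state r) (sym (cong proj₁ x)) ; arr≡ = sym (cong proj₂ x)
    ; held≡ = h ; tok≡ = τ ; proper = pr }
  represents-moved {p} {σ} {α} β (just d) r e x h τ pr = record
    { pos≡ = trans (cong (λ v → neighbour v d) (Represents.pos≡ r))
        (trans (ι-neighbour (p ⊕ place α) d)
          (trans (cong ι (⊕-assoc p (place α) δ⟦ d ⟧)) (≈-⊕ {p} {p} refl e)))
    ; st≡ = trans (represented-state r) (sym (cong proj₁ x)) ; arr≡ = sym (cong proj₂ x)
    ; held≡ = h ; tok≡ = τ ; proper = pr }

  held-at : ∀ {p σ x c u} → Represents p σ (at x c u) →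
    heldAfter σ ≡ load (carriedAfter (φ (coState x c)) c)
  held-at {p} {σ} {x} {c} {u} r = trans
    (cong₂ (λ y q → y ∸ release (response σ) y + q) held≡
      (cong (request (response σ) ⊓_) (represented-here r)))
    (trans (cong (λ o → load c ∸ release o (load c) + (request o ⊓ load (not c))) (represented-answer r))
           (transfer-held (φ (coState x c)) c))
    where open Represents r

  tokens-at : ∀ {p σ x c u} → Represents p σ (at x c u) → ∀ v → tokAfter σ v ≡
    (if ⌊ ι (p ⊕ u) ≟ᵛ v ⌋ then load (not (carriedAfter (φ (coState x c)) c)) else 0)
  tokens-at {p} {σ} {x} {c} {u} r v = go (pos σ ≟ᵛ v)
    where
    open Represents r
    pos≡ιu : pos σ ≡ ι (p ⊕ u)
    pos≡ιu = trans pos≡ (cong (λ z → ι (p ⊕ z)) (⊕-identityʳ u))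
    amount : tok σ v ≡ load (not c) → tok σ v ∸ gained σ + given σ ≡
             load (not (carriedAfter (φ (coState x c)) c))
    amount e = trans
      (cong₂ _+_ (cong₂ (λ k g → k ∸ g) e (cong₂ _⊓_ (cong request (represented-answer r)) (represented-here r)))
                 (cong₂ release (represented-answer r) held≡))
      (transfer-ground (φ (coState x c)) c)
    go : Dec (pos σ ≡ v) → _
    go (yes refl) = trans (cong (if_then tok σ v ∸ gained σ + given σ else tok σ v) (⌊⌋-true (pos σ ≟ᵛ v) refl))
      (trans (amount (represented-here r))
        (sym (cong (if_then _ else 0) (⌊⌋-true (ι (p ⊕ u) ≟ᵛ v) (sym pos≡ιu)))))
    go (no ne) = trans (cong (if_then tok σ v ∸ gained σ + given σ else tok σ v) (⌊⌋-false (pos σ ≟ᵛ v) ne))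
      (trans (tok≡ v) (trans (cong (if_then load (not c) else 0) elsewhere)
        (sym (cong (if_then load (not (carriedAfter (φ (coState x c)) c)) else 0) elsewhere))))
      where
      elsewhere : ⌊ ι (p ⊕ u) ≟ᵛ v ⌋ ≡ false
      elsewhere = ⌊⌋-false (ι (p ⊕ u) ≟ᵛ v) (λ e → ne (trans pos≡ιu e))

  held-away : ∀ {p σ x u ω} → Represents p σ (away x u ω) → heldAfter σ ≡ 0
  held-away {p} {σ} r = cong₂ _+_
    (trans (cong₂ (λ y q → y ∸ q) held≡ (trans (cong (release (response σ)) held≡) (release-0 (response σ)))) refl)
    (trans (cong (request (response σ) ⊓_) (represented-here r)) (ℕ.⊓-zeroʳ (request (response σ))))
    where open Represents r

  tokens-away : ∀ {p σ x u ω} → Represents p σ (away x u ω) → ∀ v → tokAfter σ v ≡ tok σ v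
  tokens-away {p} {σ} r v = go (pos σ ≟ᵛ v)
    where
    open Represents r
    go : Dec (pos σ ≡ v) → _
    go (yes refl) = trans (cong (if_then tok σ v ∸ gained σ + given σ else tok σ v) (⌊⌋-true (pos σ ≟ᵛ v) refl))
      (trans (cong₂ (λ g h → tok σ v ∸ g + h)
        (trans (cong (request (response σ) ⊓_) (represented-here r)) (ℕ.⊓-zeroʳ (request (response σ))))
        (trans (cong (release (response σ)) held≡) (release-0 (response σ))))
        (ℕ.+-identityʳ (tok σ v)))
    go (no ne) = cong (if_then tok σ v ∸ gained σ + given σ else tok σ v) (⌊⌋-false (pos σ ≟ᵛ v) ne)

  represents-step : ∀ {p σ α} → Represents p σ α → Represents p (soloStep σ) (cfgStep α)
  represents-step {p} {σ} {at x c u} r =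
    subst (λ m → Represents p (moved σ m) (cfgStep (at x c u)))
      (sym (cong Output.move (represented-answer r)))
      (go (Output.move (φ s)) (carriedAfter (φ s) c) (held-at r) (tokens-at r) refl)
    where
    s : Fin size
    s = coState x c
    go : ∀ m c′ → heldAfter σ ≡ load c′ →
      (∀ v → tokAfter σ v ≡ (if ⌊ ι (p ⊕ u) ≟ᵛ v ⌋ then load (not c′) else 0)) → ∀ {y} →
      y ≡ (s , Maybe.map opposite m) → Represents p (moved σ m) (leave y c′ u m)
    go m true h τ refl = represents-moved (at _ true (u ⊕ δ? m)) m r
      (cong ι (trans (cong (_⊕ δ? m) (⊕-identityʳ u)) (sym (⊕-identityʳ (u ⊕ δ? m))))) refl h
      (λ v → trans (τ v) (trans (if-zero _) (sym (if-zero _)))) tt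
    go nothing false h τ refl = represents-moved (at _ false u) nothing r
      (cong ι (⊕-identityʳ (u ⊕ 𝟎))) refl h τ tt
    go (just d) false h τ refl = represents-moved (away _ u δ⟦ d ⟧) (just d) r
      (cong (λ z → ι (z ⊕ δ⟦ d ⟧)) (⊕-identityʳ u)) refl h τ (δ≉𝟎 d)
  represents-step {p} {σ} {away x u ω} r =
    subst (λ m → Represents p (moved σ m) (cfgStep (away x u ω)))
      (sym (cong Output.move (represented-answer r)))
      (go (Output.move (φ (freeState x))))
    where
    go : ∀ m → Represents p (moved σ m) (roam (freeState x , Maybe.map opposite m) u (ω ⊕ δ? m))
    go m with ι (ω ⊕ δ? m) ≟ᵛ ι 𝟎
    ... | yes e = represents-moved (at _ false u) m r
          (trans (cong ι (⊕-assoc u ω (δ? m))) (≈-⊕ {u} {u} refl e)) refl (held-away r)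
          (λ v → trans (tokens-away r v) (Represents.tok≡ r v)) tt
    ... | no ne = represents-moved (away _ u (ω ⊕ δ? m)) m r
          (cong ι (⊕-assoc u ω (δ? m))) refl (held-away r)
          (λ v → trans (tokens-away r v) (Represents.tok≡ r v)) ne

  begins : ℤ² → Solo
  begins p = solo (ι p) initial nothing t (λ _ → 0)

  represents : ∀ p s → Represents p (soloRun (begins p) s) (cfg s)
  represents p zero = record
    { pos≡ = cong ι (sym (trans (cong (p ⊕_) (⊕-identityʳ 𝟎)) (⊕-identityʳ p))) ; st≡ = refl ; arr≡ = refl
    ; held≡ = refl ; tok≡ = λ v → sym (if-zero _) ; proper = tt }
  represents p (suc s) = represents-step (represents p s)

-- Eventually periodic walks in the plane

nonzero-coordinate : ∀ {v} → v ≢ 𝟎 → ∃[ a ] v ! a ≢ 0ℤ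
nonzero-coordinate {x , y} h with x ℤ.≟ 0ℤ
... | no x≢0   = X , x≢0
... | yes refl = Y , λ { refl → h refl }

∣∣-positive : ∀ {x} → x ≢ 0ℤ → 1 ≤ ∣ x ∣
∣∣-positive {+ zero}  h = ⊥-elim (h refl)
∣∣-positive {+ suc _} h = s≤s z≤n
∣∣-positive {ℤ.-[1+ _ ]} h = s≤s z≤n

-- Cross product with W: constant on the lines that are parallel to W.
level : ℤ² → ℤ² → ℤ
level W z = W ! X ℤ.* z ! Y ℤ.- W ! Y ℤ.* z ! X

level-⊕ : ∀ W z w → level W (z ⊕ w) ≡ level W z ℤ.+ level W w
level-⊕ (a , b) (x , y) (x′ , y′) = lemma a b x y x′ y′
  where
  lemma : ∀ a b x y x′ y′ → a ℤ.* (y ℤ.+ y′) ℤ.- b ℤ.* (x ℤ.+ x′) ≡ a ℤ.* y ℤ.- b ℤ.* x ℤ.+ (a ℤ.* y′ ℤ.- b ℤ.* x′)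
  lemma = solve-∀

level-⊖ : ∀ W z w → level W (z ⊖ w) ≡ level W z ℤ.- level W w
level-⊖ (a , b) (x , y) (x′ , y′) = lemma a b x y x′ y′
  where
  lemma : ∀ a b x y x′ y′ → a ℤ.* (y ℤ.- y′) ℤ.- b ℤ.* (x ℤ.- x′) ≡ a ℤ.* y ℤ.- b ℤ.* x ℤ.- (a ℤ.* y′ ℤ.- b ℤ.* x′)
  lemma = solve-∀

level-self : ∀ k W → level W (k ⊛ W) ≡ 0ℤ
level-self k (a , b) = lemma k a b
  where
  lemma : ∀ k a b → a ℤ.* (k ℤ.* b) ℤ.- b ℤ.* (k ℤ.* a) ≡ 0ℤ
  lemma = solve-∀

level-zero : ∀ k W → level W (k ⊛ 𝟎) ≡ 0ℤ
level-zero k (a , b) = lemma k a b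
  where
  lemma : ∀ k a b → a ℤ.* (k ℤ.* 0ℤ) ℤ.- b ℤ.* (k ℤ.* 0ℤ) ≡ 0ℤ
  lemma = solve-∀

∣level∣ : ∀ W z B E F → (∀ a → ∣ W ! a ∣ ≤ B) → ∣ z ! X ∣ ≤ E → ∣ z ! Y ∣ ≤ F → ∣ level W z ∣ ≤ B * F + B * E
∣level∣ W z B E F hW hX hY = ℕ.≤-trans (ℤ.∣i-j∣≤∣i∣+∣j∣ (W ! X ℤ.* z ! Y) (W ! Y ℤ.* z ! X))
  (ℕ.+-mono-≤ (subst (_≤ B * F) (sym (ℤ.abs-* (W ! X) (z ! Y))) (ℕ.*-mono-≤ (hW X) hY))
              (subst (_≤ B * E) (sym (ℤ.abs-* (W ! Y) (z ! X))) (ℕ.*-mono-≤ (hW Y) hX)))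

+-sub : ∀ x y → x ℤ.+ y ℤ.- x ≡ y
+-sub = solve-∀

+-zero : ∀ {x y} → x ℤ.+ y ≡ x → y ≡ 0ℤ
+-zero {x} {y} e = trans (sym (+-sub x y)) (trans (cong (ℤ._- x) e) (ℤ.+-inverseʳ x))

*-zero : ∀ {x y} → x ≢ 0ℤ → x ℤ.* y ≡ 0ℤ → y ≡ 0ℤ
*-zero {x} x≢0 e with ℤ.i*j≡0⇒i≡0∨j≡0 x e
... | inj₁ z = ⊥-elim (x≢0 z)
... | inj₂ z = z

-- A path with unit steps that ends up repeating, after h steps, the displacement v every p steps.
record Walk (c : ℕ) : Set where
  field
    o        : ℕ → ℤ²
    unit-steps : ∀ r → ∃[ m ] o (suc r) ≡ o r ⊕ δ? m
    start    : ∀ a → ∣ o 0 ! a ∣ ≤ 1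
    h p      : ℕ
    p>0      : 0 < p
    h+p≤c    : h + p ≤ c
    v        : ℤ²
    law      : ∀ q → o (p + (q + h)) ≡ o (q + h) ⊕ v

  bound : ∀ r a → ∣ o r ! a ∣ ≤ suc r
  bound zero    a = start a
  bound (suc r) a with unit-steps r
  ... | m , e = subst (λ z → ∣ z ! a ∣ ≤ suc (suc r)) (sym e)
    (ℕ.≤-trans (subst (λ x → ∣ x ∣ ≤ ∣ o r ! a ∣ + ∣ δ? m ! a ∣) (sym (!-⊕ (o r) (δ? m) a))
                      (ℤ.∣i+j∣≤∣i∣+∣j∣ (o r ! a) (δ? m ! a)))
      (subst (∣ o r ! a ∣ + ∣ δ? m ! a ∣ ≤_) (ℕ.+-comm (suc r) 1) (ℕ.+-mono-≤ (bound r a) (δ?-bound m a))))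

  laps : ∀ k r → h ≤ r → o (k * p + r) ≡ o r ⊕ + k ⊛ v
  laps k r h≤r = subst (λ r → o (k * p + r) ≡ o r ⊕ + k ⊛ v) (ℕ.m∸n+n≡m h≤r) (go k (r ℕ.∸ h))
    where
    zero-lap : ∀ z v → z ≡ z ⊕ 0ℤ ⊛ v
    zero-lap (x , y) (a , b) = cong₂ _,_ (lemma x a) (lemma y b)
      where
      lemma : ∀ x a → x ≡ x ℤ.+ 0ℤ ℤ.* a
      lemma = solve-∀
    suc-lap : ∀ k z v → z ⊕ k ⊛ v ⊕ v ≡ z ⊕ (1ℤ ℤ.+ k) ⊛ v
    suc-lap k (x , y) (a , b) = cong₂ _,_ (lemma k x a) (lemma k y b)
      where
      lemma : ∀ k x a → x ℤ.+ k ℤ.* a ℤ.+ a ≡ x ℤ.+ (1ℤ ℤ.+ k) ℤ.* a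
      lemma = solve-∀
    go : ∀ k q → o (k * p + (q + h)) ≡ o (q + h) ⊕ + k ⊛ v
    go zero    q = zero-lap (o (q + h)) v
    go (suc k) q = begin
      o (p + k * p + (q + h))     ≡⟨ cong o (trans (ℕ.+-assoc p (k * p) (q + h))
                                       (cong (λ x → p + x) (sym (ℕ.+-assoc (k * p) q h)))) ⟩
      o (p + (k * p + q + h))     ≡⟨ law (k * p + q) ⟩
      o (k * p + q + h) ⊕ v       ≡⟨ cong (λ r → o r ⊕ v) (ℕ.+-assoc (k * p) q h) ⟩
      o (k * p + (q + h)) ⊕ v     ≡⟨ cong (_⊕ v) (go k q) ⟩
      o (q + h) ⊕ + k ⊛ v ⊕ v     ≡⟨ suc-lap (+ k) (o (q + h)) v ⟩
      o (q + h) ⊕ + suc k ⊛ v     ∎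
      where open ≡-Reasoning

  phase : ∀ r → h ≤ r → ∃[ k ] ∃[ q ] (h ≤ q × q < h + p × r ≡ k * p + q)
  phase r h≤r = (r ℕ.∸ h) / p , (r ℕ.∸ h) % p + h
    , ℕ.m≤n+m h _ , subst ((r ℕ.∸ h) % p + h <_) (ℕ.+-comm p h) (ℕ.+-monoˡ-< h (m%n<n (r ℕ.∸ h) p))
    , (begin
        r                                                       ≡⟨ ℕ.m∸n+n≡m h≤r ⟨
        r ℕ.∸ h + h                                             ≡⟨ cong (_+ h) (m≡m%n+[m/n]*n (r ℕ.∸ h) p) ⟩
        (r ℕ.∸ h) % p + (r ℕ.∸ h) / p * p + h                   ≡⟨ cong (_+ h) (ℕ.+-comm ((r ℕ.∸ h) % p) _) ⟩
        (r ℕ.∸ h) / p * p + (r ℕ.∸ h) % p + h                   ≡⟨ ℕ.+-assoc ((r ℕ.∸ h) / p * p) _ h ⟩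
        (r ℕ.∸ h) / p * p + ((r ℕ.∸ h) % p + h)                 ∎)
    where
    open ≡-Reasoning
    instance
      p≢0 : NonZero p
      p≢0 = ℕ.>-nonZero p>0

  -- The k laps move coordinate a by at least k, as a nonzero integer drift has size at least 1; the
  -- phase q accounts for at most c.
  growth : ∀ a → v ! a ≢ 0ℤ → ∀ k q → h ≤ q → q < h + p → k ≤ ∣ o (k * p + q) ! a ∣ + c
  growth a va≢0 k q h≤q q<h+p = ℕ.≤-trans
    (subst₂ _≤_ (ℕ.*-identityʳ k) (sym (ℤ.abs-* (+ k) (v ! a))) (ℕ.*-monoʳ-≤ k (∣∣-positive va≢0)))
    (ℕ.≤-trans (subst (λ x → ∣ x ∣ ≤ ∣ o (k * p + q) ! a ∣ + ∣ o q ! a ∣)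
        (difference (o q ! a) (+ k ℤ.* v ! a) _ (sym coordinate))
        (ℤ.∣i-j∣≤∣i∣+∣j∣ (o (k * p + q) ! a) (o q ! a)))
      (ℕ.+-monoʳ-≤ ∣ o (k * p + q) ! a ∣ (ℕ.≤-trans (bound q a) (ℕ.≤-trans q<h+p h+p≤c))))
    where
    coordinate : o (k * p + q) ! a ≡ o q ! a ℤ.+ + k ℤ.* v ! a
    coordinate = trans (cong (_! a) (laps k q h≤q))
      (trans (!-⊕ (o q) (+ k ⊛ v) a) (cong (λ x → o q ! a ℤ.+ x) (!-⊛ (+ k) v a)))
    difference : ∀ x y z → x ℤ.+ y ≡ z → z ℤ.- x ≡ y
    difference x y .(x ℤ.+ y) refl = +-sub x y

  -- A return in lap k forces k ≤ c by `growth`. As a lap takes at most c steps and a phase is below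
  -- c, no return occurs from this time on.
  horizon : ℕ
  horizon = c * c + c

  no-late-return : v ≢ 𝟎 → ∀ r → horizon ≤ r → o r ≢ 𝟎
  no-late-return v≢0 r late or≡0 with nonzero-coordinate v≢0
  ... | a , va≢0 with phase r (ℕ.≤-trans (ℕ.≤-trans (ℕ.m≤m+n h p) h+p≤c) (ℕ.≤-trans (ℕ.m≤n+m c (c * c)) late))
  ...   | k , q , h≤q , q<h+p , refl = ℕ.<⇒≱ early late
    where
    k≤c : k ≤ c
    k≤c = subst (λ x → k ≤ ∣ x ∣ + c) (trans (cong (_! a) or≡0) (𝟎! a)) (growth a va≢0 k q h≤q q<h+p)
    early : k * p + q < c * c + c
    early = ℕ.+-mono-≤-< (ℕ.*-mono-≤ k≤c (ℕ.≤-trans (ℕ.m≤n+m p h) h+p≤c)) (ℕ.<-≤-trans q<h+p h+p≤c)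

  v-bound : ∀ a → ∣ v ! a ∣ ≤ 2 * c + 2
  v-bound a = subst (λ x → ∣ x ∣ ≤ 2 * c + 2) (eq (o (p + h)) (o h) v (law 0)) (ℕ.≤-trans
    (ℤ.∣i-j∣≤∣i∣+∣j∣ (o (p + h) ! a) (o h ! a))
      (linear 5 (λ c h p x y → x :≤ con 1 :+ (p :+ h) ∷ y :≤ con 1 :+ h ∷ h :+ p :≤ c ∷ [] ⊢ x :+ y :≤ 2 :* c :+ con 2) refl
        c h p (∣ o (p + h) ! a ∣) (∣ o h ! a ∣) (bound (p + h) a) (bound h a) h+p≤c))
    where
    eq : ∀ z w v → z ≡ w ⊕ v → z ! a ℤ.- w ! a ≡ v ! a
    eq .(w ⊕ v) w v refl = trans (cong (ℤ._- w ! a) (!-⊕ w v a)) (+-sub (w ! a) (v ! a))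

  bounded : v ≡ 𝟎 → ∀ r a → ∣ o r ! a ∣ ≤ c
  bounded v≡𝟎 r a with h ℕ.≤? r
  ... | no early = ℕ.≤-trans (bound r a) (ℕ.≤-trans (ℕ.≰⇒> early) (ℕ.≤-trans (ℕ.m≤m+n h p) h+p≤c))
  ... | yes late with phase r late
  ...   | k , q , h≤q , q<h+p , refl = subst (λ z → ∣ z ! a ∣ ≤ c)
    (sym (trans (laps k q h≤q) (trans (cong (λ w → o q ⊕ + k ⊛ w) v≡𝟎)
      (trans (cong (λ w → o q ⊕ w) (cong₂ _,_ (ℤ.*-zeroʳ (+ k)) (ℤ.*-zeroʳ (+ k)))) (⊕-identityʳ (o q))))))
    (ℕ.≤-trans (bound q a) (ℕ.≤-trans q<h+p h+p≤c))

  -- Only times below the horizon are inspected, which makes the property decidable;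
  -- `no-late-return` extends it to all times.
  Long : Set
  Long = v ≢ 𝟎 × ∀ r → r < horizon → o r ≢ 𝟎

  _≟²_ : (z w : ℤ²) → Dec (z ≡ w)
  _≟²_ = ≡-dec ℤ._≟_ ℤ._≟_

  long? : Dec Long
  long? with v ≟² 𝟎
  ... | yes v≡𝟎 = no λ l → proj₁ l v≡𝟎
  ... | no v≢𝟎 with search< (λ r → o r ≟² 𝟎) horizon
  ...   | inj₁ (r , r< , returns , _) = no λ l → proj₂ l r r< returns
  ...   | inj₂ never = yes (v≢𝟎 , never)

  long-never-returns : Long → ∀ r → o r ≢ 𝟎
  long-never-returns (v≢𝟎 , early) r with r ℕ.<? horizon
  ... | yes r< = early r r<
  ... | no r≮  = no-late-return v≢𝟎 r (ℕ.≮⇒≥ r≮)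

  -- A walk that is not long either has no drift, and is bounded, or returns before the horizon. In
  -- the second case the absence of a return up to q bounds the time q, and hence the distance.
  short-bound : ¬ Long → ∀ q → (∀ r → r ≤ q → o r ≢ 𝟎) → ∀ a → ∣ o q ! a ∣ ≤ horizon
  short-bound short q away a with v ≟² 𝟎
  ... | yes v≡𝟎 = ℕ.≤-trans (bounded v≡𝟎 q a) (ℕ.m≤n+m c (c * c))
  ... | no v≢𝟎 with q ℕ.<? horizon
  ...   | yes q< = ℕ.≤-trans (bound q a) q<
  ...   | no q≮ = ⊥-elim (short (v≢𝟎 , λ r r< → away r (ℕ.≤-trans (ℕ.<⇒≤ r<) (ℕ.≮⇒≥ q≮))))

  D : ℤ² → ℤ
  D = level v

  D-laps : ∀ k r → h ≤ r → D (o (k * p + r)) ≡ D (o r)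
  D-laps k r h≤r = trans (cong D (laps k r h≤r)) (trans (level-⊕ v (o r) (+ k ⊛ v))
    (trans (cong (λ x → D (o r) ℤ.+ x) (level-self (+ k) v)) (ℤ.+-identityʳ (D (o r)))))

  maximum : ∀ (f : ℕ → ℤ) n → ∃[ m ] (m ≤ n × ∀ k → k ≤ n → f k ℤ.≤ f m)
  maximum f zero = 0 , z≤n , λ { .0 z≤n → ℤ.≤-refl }
  maximum f (suc n) with maximum f n
  ... | m , m≤n , max with f (suc n) ℤ.≤? f m
  ...   | yes le = m , ℕ.m≤n⇒m≤1+n m≤n , bigger
    where
    bigger : ∀ k → k ≤ suc n → f k ℤ.≤ f m
    bigger k k≤ with ℕ.m≤n⇒m<n∨m≡n k≤
    ... | inj₁ (s≤s k≤n) = max k k≤n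
    ... | inj₂ refl = le
  ...   | no nle = suc n , ℕ.≤-refl , bigger
    where
    bigger : ∀ k → k ≤ suc n → f k ℤ.≤ f (suc n)
    bigger k k≤ with ℕ.m≤n⇒m<n∨m≡n k≤
    ... | inj₁ (s≤s k≤n) = ℤ.≤-trans (max k k≤n) (ℤ.<⇒≤ (ℤ.≰⇒> nle))
    ... | inj₂ refl = ℤ.≤-refl

  maximal-phase : ∀ (f : ℤ² → ℤ) → (∀ k r → h ≤ r → f (o (k * p + r)) ≡ f (o r)) →
    ∃[ m ] (h ≤ m × m < h + p × ∀ r → h ≤ r → f (o r) ℤ.≤ f (o m))
  maximal-phase f periodic with maximum (λ q → f (o (q + h))) (ℕ.pred p)
  ... | m , m≤ , max = m + h , ℕ.m≤n+m h m
    , subst (suc (m + h) ≤_) (trans (cong (_+ h) (ℕ.suc-pred p)) (ℕ.+-comm p h)) (s≤s (ℕ.+-monoˡ-≤ h m≤)) , bigger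
    where
    instance
      p≢0 : NonZero p
      p≢0 = ℕ.>-nonZero p>0
    bigger : ∀ r → h ≤ r → f (o r) ℤ.≤ f (o (m + h))
    bigger r h≤r with phase r h≤r
    ... | k , q , h≤q , q<h+p , refl = subst (ℤ._≤ f (o (m + h)))
      (sym (trans (periodic k q h≤q) (cong (λ x → f (o x)) (sym (ℕ.m∸n+n≡m h≤q)))))
      (max (q ℕ.∸ h) (ℕ.≤-pred (subst (suc (q ℕ.∸ h) ≤_) (sym (ℕ.suc-pred p))
        (ℕ.+-cancelʳ-≤ h _ _ (subst₂ _≤_ (sym (cong suc (ℕ.m∸n+n≡m h≤q))) (ℕ.+-comm h p) q<h+p)))))

  -- If the walk does not stay on the line through 0 parallel to v, two of its phases differ by a
  -- vector that (like its translates by multiples of v) is not visited.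
  skew-phases : ∀ r₀ → h ≤ r₀ → D (o r₀) ≢ 0ℤ →
    ∃[ r₁ ] ∃[ r₂ ] (h ≤ r₁ × r₁ < h + p × h ≤ r₂ × r₂ < h + p ×
      ∀ r → h ≤ r → D (o r) ≢ D (o r₁) ℤ.- D (o r₂))
  skew-phases r₀ h≤r₀ D≢0 with maximal-phase D D-laps
                              | maximal-phase (λ z → ℤ.- D z) (λ k r h≤r → cong ℤ.-_ (D-laps k r h≤r))
  ... | m , h≤m , m< , max | n , h≤n , n< , max′ with D (o n) ℤ.<? 0ℤ
  -- If the minimum of D is negative, maximum minus minimum exceeds the maximum. Otherwise the
  -- maximum is positive, because D is nonzero at `r₀`, and minimum minus maximum lies below the
  -- minimum.
  ...   | yes neg = m , n , h≤m , m< , h≤n , n< , λ r h≤r e → ℤ.<-irrefl e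
          (ℤ.≤-<-trans (max r h≤r) (subst (ℤ._< D (o m) ℤ.- D (o n)) (ℤ.+-identityʳ (D (o m)))
            (ℤ.+-monoʳ-< (D (o m)) (ℤ.neg-mono-< neg))))
  ...   | no nonneg = n , m , h≤n , n< , h≤m , m< , λ r h≤r e → ℤ.<-irrefl (sym e)
          (ℤ.<-≤-trans (subst (D (o n) ℤ.- D (o m) ℤ.<_) (ℤ.+-identityʳ (D (o n)))
            (ℤ.+-monoʳ-< (D (o n)) (ℤ.neg-mono-< positive))) (min r h≤r))
    where
    min : ∀ r → h ≤ r → D (o n) ℤ.≤ D (o r)
    min r h≤r = ℤ.neg-cancel-≤ (max′ r h≤r)
    positive : 0ℤ ℤ.< D (o m)
    positive = ℤ.<-≤-trans (ℤ.≤∧≢⇒< (ℤ.≤-trans (ℤ.≮⇒≥ nonneg) (min r₀ h≤r₀)) (λ e → D≢0 (sym e))) (max r₀ h≤r₀)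

  steps-parallel : (∀ r → h ≤ r → D (o r) ≡ 0ℤ) → ∀ r → h ≤ r → ∃[ m ] (o (suc r) ≡ o r ⊕ δ? m × D (δ? m) ≡ 0ℤ)
  steps-parallel flat r h≤r with unit-steps r
  ... | m , e = m , e , +-zero {D (o r)} (trans (sym (level-⊕ v (o r) (δ? m)))
    (trans (cong D (sym e)) (trans (flat (suc r) (ℕ.m≤n⇒m≤1+n h≤r)) (sym (flat r h≤r)))))

  stuck : v ! X ≢ 0ℤ → v ! Y ≢ 0ℤ → ∀ m → D (δ? m) ≡ 0ℤ → δ? m ≡ 𝟎
  stuck x≢0 y≢0 nothing e = refl
  stuck x≢0 y≢0 (just north) e = ⊥-elim (x≢0 (trans (lemma (v ! X) (v ! Y)) e))
    where
    lemma : ∀ a b → a ≡ a ℤ.* 1ℤ ℤ.- b ℤ.* 0ℤ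
    lemma = solve-∀
  stuck x≢0 y≢0 (just south) e = ⊥-elim (x≢0 (trans (lemma (v ! X) (v ! Y)) (cong ℤ.-_ e)))
    where
    lemma : ∀ a b → a ≡ ℤ.- (a ℤ.* -1ℤ ℤ.- b ℤ.* 0ℤ)
    lemma = solve-∀
  stuck x≢0 y≢0 (just east) e = ⊥-elim (y≢0 (trans (lemma (v ! X) (v ! Y)) (cong ℤ.-_ e)))
    where
    lemma : ∀ a b → b ≡ ℤ.- (a ℤ.* 0ℤ ℤ.- b ℤ.* 1ℤ)
    lemma = solve-∀
  stuck x≢0 y≢0 (just west) e = ⊥-elim (y≢0 (trans (lemma (v ! X) (v ! Y)) e))
    where
    lemma : ∀ a b → b ≡ a ℤ.* 0ℤ ℤ.- b ℤ.* -1ℤ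
    lemma = solve-∀

  -- No unit step is parallel to a vector that is not parallel to an axis.
  axis-parallel : v ≢ 𝟎 → (∀ r → h ≤ r → D (o r) ≡ 0ℤ) →
    ∃[ a ] (v ! other a ≡ 0ℤ × ∀ r → h ≤ r → o r ! other a ≡ 0ℤ)
  axis-parallel v≢0 flat with v ! X ℤ.≟ 0ℤ | v ! Y ℤ.≟ 0ℤ
  ... | yes x≡0 | yes y≡0 = ⊥-elim (v≢0 (cong₂ _,_ x≡0 y≡0))
  ... | yes x≡0 | no y≢0 = Y , x≡0 , λ r h≤r → *-zero y≢0 (trans (lemma (v ! X) (v ! Y) (o r ! X) (o r ! Y) x≡0)
                              (cong ℤ.-_ (flat r h≤r)))
    where
    lemma : ∀ a b x y → a ≡ 0ℤ → b ℤ.* x ≡ ℤ.- (a ℤ.* y ℤ.- b ℤ.* x)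
    lemma .0ℤ b x y refl = lemma′ b x y
      where
      lemma′ : ∀ b x y → b ℤ.* x ≡ ℤ.- (0ℤ ℤ.* y ℤ.- b ℤ.* x)
      lemma′ = solve-∀
  ... | no x≢0 | yes y≡0 = X , y≡0 , λ r h≤r → *-zero x≢0 (trans (lemma (v ! X) (v ! Y) (o r ! X) (o r ! Y) y≡0) (flat r h≤r))
    where
    lemma : ∀ a b x y → b ≡ 0ℤ → a ℤ.* y ≡ a ℤ.* y ℤ.- b ℤ.* x
    lemma a .0ℤ x y refl = lemma′ a x y
      where
      lemma′ : ∀ a x y → a ℤ.* y ≡ a ℤ.* y ℤ.- 0ℤ ℤ.* x
      lemma′ = solve-∀
  ... | no x≢0 | no y≢0 = ⊥-elim (v≢0 (still-zero (o h) v (trans (sym (law 0)) (still p))))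
    where
    still : ∀ k → o (k + h) ≡ o h
    still zero = refl
    still (suc k) with steps-parallel flat (k + h) (ℕ.m≤n+m h k)
    ... | m , e , z = trans e (trans (cong (o (k + h) ⊕_) (stuck x≢0 y≢0 m z)) (trans (⊕-identityʳ _) (still k)))
    still-zero : ∀ z v → z ⊕ v ≡ z → v ≡ 𝟎
    still-zero (x , y) (a , b) e = cong₂ _,_ (+-zero {x} (cong proj₁ e)) (+-zero {y} (cong proj₂ e))

-- Meetings of an agent with its token

-- The run of a single agent, cut into the moments when it is at the same node as its token.
module MacroRun (A : Automaton) (t : ℕ) (t≤1 : t ≤ 1) (N′ : ℕ) (1≤N′ : 1 ≤ N′) where

  open AbstractRun A t t≤1 N′ 1≤N′ public
  open Torus N N
  open Automaton A

  free : Mind → Mind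
  free x = think (freeState x)

  freely : Mind → ℕ → Mind
  freely x zero    = x
  freely x (suc r) = free (freely x r)

  freeMove : Mind → Maybe Direction
  freeMove x = Output.move (φ (freeState x))

  -- The offset from the token as if the token were never met again. This is a walk in the plane,
  -- independent of the torus, which only determines when the tour is cut off.
  path : Mind → Direction → ℕ → ℤ²
  path x d zero    = δ⟦ d ⟧
  path x d (suc r) = path x d r ⊕ δ? (freeMove (freely x r))

  minds : ℕ
  minds = size * 5

  code : Maybe Direction → Fin 5
  code nothing      = zero
  code (just north) = suc zero
  code (just east)  = suc (suc zero)
  code (just south) = suc (suc (suc zero))
  code (just west)  = suc (suc (suc (suc zero)))

  code-injective : ∀ {a b} → code a ≡ code b → a ≡ b
  code-injective {nothing}    {nothing}    _ = refl
  code-injective {just north} {just north} _ = refl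
  code-injective {just east}  {just east}  _ = refl
  code-injective {just south} {just south} _ = refl
  code-injective {just west}  {just west}  _ = refl
  code-injective {nothing}    {just north} ()
  code-injective {nothing}    {just east}  ()
  code-injective {nothing}    {just south} ()
  code-injective {nothing}    {just west}  ()
  code-injective {just north} {nothing}    ()
  code-injective {just north} {just east}  ()
  code-injective {just north} {just south} ()
  code-injective {just north} {just west}  ()
  code-injective {just east}  {nothing}    ()
  code-injective {just east}  {just north} ()
  code-injective {just east}  {just south} ()
  code-injective {just east}  {just west}  ()
  code-injective {just south} {nothing}    ()
  code-injective {just south} {just north} ()
  code-injective {just south} {just east}  ()
  code-injective {just south} {just west}  ()
  code-injective {just west}  {nothing}    ()
  code-injective {just west}  {just north} ()
  code-injective {just west}  {just east}  ()
  code-injective {just west}  {just south} ()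

  number : Mind → Fin minds
  number (s , a) = combine s (code a)

  number-injective : ∀ {x y} → number x ≡ number y → x ≡ y
  number-injective {s , a} {s′ , a′} e with Fin.combine-injective s (code a) s′ (code a′) e
  ... | s≡ , a≡ = cong₂ _,_ s≡ (code-injective a≡)

  abstract
    repetition : ∀ x → ∃[ h ] ∃[ p ] (0 < p × h + p ≤ minds × freely x (p + h) ≡ freely x h)
    repetition x with Fin.pigeonhole {m = minds} ℕ.≤-refl (λ i → number (freely x (toℕ i)))
    ... | i , j , i<j , e = toℕ i , toℕ j ℕ.∸ toℕ i , ℕ.m<n⇒0<n∸m i<j
        , subst (_≤ minds) (sym (ℕ.m+[n∸m]≡n (ℕ.<⇒≤ i<j))) (ℕ.≤-pred (Fin.toℕ<n j))
        , sym (trans (number-injective e) (cong (freely x) (sym (ℕ.m∸n+n≡m (ℕ.<⇒≤ i<j)))))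

  swap : ∀ v x y → v ⊕ x ⊕ y ≡ v ⊕ y ⊕ x
  swap v x y = trans (⊕-assoc v x y) (trans (cong (v ⊕_) (⊕-comm x y)) (sym (⊕-assoc v y x)))

  walk : Mind → Direction → Walk minds
  walk x d = record
    { o = path x d ; unit-steps = λ r → freeMove (freely x r) , refl ; start = δ-bound d
    ; h = h ; p = p ; p>0 = proj₁ (proj₂ (proj₂ (repetition x))) ; h+p≤c = proj₁ (proj₂ (proj₂ (proj₂ (repetition x))))
    ; v = path x d (p + h) ⊖ path x d h ; law = law }
    where
    h p : ℕ
    h = proj₁ (repetition x)
    p = proj₁ (proj₂ (repetition x))
    again : ∀ q → freely x (p + (q + h)) ≡ freely x (q + h)
    again zero    = proj₂ (proj₂ (proj₂ (proj₂ (repetition x))))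
    again (suc q) = trans (cong (freely x) (ℕ.+-suc p (q + h))) (cong free (again q))
    law : ∀ q → path x d (p + (q + h)) ≡ path x d (q + h) ⊕ (path x d (p + h) ⊖ path x d h)
    law zero    = sym (⊕-inverse (path x d (p + h)) (path x d h))
    law (suc q) = trans (cong (path x d) (ℕ.+-suc p (q + h)))
      (trans (cong₂ _⊕_ (law q) (cong (δ? ∘ freeMove) (again q))) (swap (path x d (q + h)) (path x d (p + h) ⊖ path x d h) (δ? (freeMove (freely x (q + h))))))

  Meeting : Set
  Meeting = Mind × Bool

  met : Meeting → ℤ² → Cfg
  met (x , c) u = at x c u

  split : Mind → Bool → Maybe Direction → (Meeting × ℤ²) ⊎ (Mind × Direction)
  split x true  m        = inj₁ ((x , true) , δ? m)
  split x false nothing  = inj₁ ((x , false) , 𝟎)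
  split x false (just d) = inj₂ (x , d)

  depart : Meeting → (Meeting × ℤ²) ⊎ (Mind × Direction)
  depart (x , c) = let s = coState x c in split (think s) (carriedAfter (φ s) c) (Output.move (φ s))

  after : ℤ² → (Meeting × ℤ²) ⊎ (Mind × Direction) → Cfg
  after u (inj₁ (y , e)) = met y (u ⊕ e)
  after u (inj₂ (x , d)) = away x u δ⟦ d ⟧

  step-met : ∀ y u → cfgStep (met y u) ≡ after u (depart y)
  step-met (x , c) u = go (think (coState x c)) (carriedAfter (φ (coState x c)) c) (Output.move (φ (coState x c)))
    where
    go : ∀ x c m → leave x c u m ≡ after u (split x c m)
    go x true  m        = refl
    go x false nothing  = cong (at x false) (sym (⊕-identityʳ u))
    go x false (just d) = refl

  shift-bound : ∀ y y′ e → depart y ≡ inj₁ (y′ , e) → ∀ a → ∣ e ! a ∣ ≤ 1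
  shift-bound (x , c) y′ e = go (think (coState x c)) (carriedAfter (φ (coState x c)) c) (Output.move (φ (coState x c)))
    where
    go : ∀ x c m → split x c m ≡ inj₁ (y′ , e) → ∀ a → ∣ e ! a ∣ ≤ 1
    go x true  m       refl a = δ?-bound m a
    go x false nothing refl a = δ?-bound nothing a

  -- Whether a tour returns on the torus is a question about all times. The answer is assumed here;
  -- since the eventual goal is `⊥` and there are finitely many minds and directions, excluded
  -- middle will supply it.
  module _ (oracle : ∀ x d → Dec (∃[ r ] path x d r ≈ 𝟎)) where

    record Jump : Set where
      constructor jumpTo
      field
        target   : Meeting
        shift    : ℤ²
        duration : ℕ

    open Jump

    -- The jump of a tour that never returns is a dummy.
    tour : Meeting → ∀ x d → Dec (∃[ r ] path x d r ≈ 𝟎) → Jump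
    tour y x d (yes (r , e)) = let r′ = proj₁ (least (λ q → ι (path x d q) ≟ᵛ ι 𝟎) r e) in
      jumpTo (freely x r′ , false) 𝟎 (suc r′)
    tour y x d (no _)  = jumpTo y 𝟎 0

    jumpBy : Meeting → (Meeting × ℤ²) ⊎ (Mind × Direction) → Jump
    jumpBy y (inj₁ (y′ , e)) = jumpTo y′ e 1
    jumpBy y (inj₂ (x , d))  = tour y x d (oracle x d)

    jump : Meeting → Jump
    jump y = jumpBy y (depart y)

    -- Everything until the next meeting is invariant under translation, so the next meeting and the
    -- shift of the token depend on the present meeting only. Meetings form an orbit in a finite set
    -- and recur.
    meeting : ℕ → Meeting
    meeting zero    = (initial , nothing) , true
    meeting (suc i) = target (jump (meeting i))

    site : ℕ → ℤ²
    site zero    = 𝟎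
    site (suc i) = site i ⊕ shift (jump (meeting i))

    meeting-step : ∀ m n → meeting m ≡ meeting n → meeting (suc m) ≡ meeting (suc n)
    meeting-step m n = cong (target ∘ jump)

    site-step : ∀ m n w → meeting m ≡ meeting n → site m ≡ site n ⊕ w → site (suc m) ≡ site (suc n) ⊕ w
    site-step m n w e e′ = trans (cong₂ _⊕_ e′ (cong (shift ∘ jump) e)) (swap (site n) w (shift (jump (meeting n))))

    moment : ℕ → ℕ
    moment zero    = 0
    moment (suc i) = duration (jump (meeting i)) + moment i

    Tour : ℕ → Mind → Direction → Set
    Tour k x d = depart (meeting k) ≡ inj₂ (x , d)

    Gone : Mind → Direction → ℕ → Set
    Gone x d q = ∀ r → r ≤ q → path x d r ≉ 𝟎

    Lost : ℕ → Set
    Lost k = ∃[ x ] ∃[ d ] (Tour k x d × ∀ r → path x d r ≉ 𝟎)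

    Reached : ℕ → Set
    Reached i = ∀ k → k < i → ¬ Lost k

    touring : ∀ k x d → Tour k x d → cfg (moment k) ≡ met (meeting k) (site k) → ∀ q → Gone x d q →
      cfg (q + suc (moment k)) ≡ away (freely x q) (site k) (path x d q)
    touring k x d T e zero    gone = trans (cong cfgStep e) (trans (step-met (meeting k) (site k)) (cong (after (site k)) T))
    touring k x d T e (suc q) gone = trans (cong cfgStep (touring k x d T e q (λ r h → gone r (ℕ.m≤n⇒m≤1+n h))))
      (cong (if_then at (free (freely x q)) false (site k) else away (free (freely x q)) (site k) (path x d (suc q)))
            (⌊⌋-false (ι (path x d (suc q)) ≟ᵛ ι 𝟎) (gone (suc q) ℕ.≤-refl)))

    returning : ∀ k x d → Tour k x d → cfg (moment k) ≡ met (meeting k) (site k) → ∀ r →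
      (∀ q → q < r → path x d q ≉ 𝟎) → path x d r ≈ 𝟎 → cfg (r + suc (moment k)) ≡ at (freely x r) false (site k)
    returning k x d T e zero    before back = ⊥-elim (δ≉𝟎 d back)
    returning k x d T e (suc r) before back = trans (cong cfgStep (touring k x d T e r (λ q h → before q (s≤s h))))
      (cong (if_then at (free (freely x r)) false (site k) else away (free (freely x r)) (site k) (path x d (suc r)))
            (⌊⌋-true (ι (path x d (suc r)) ≟ᵛ ι 𝟎) back))

    -- What happens between the k-th meeting and the next one.
    data Stretch (k : ℕ) : Set where
      direct : ∀ y e → depart (meeting k) ≡ inj₁ (y , e) → meeting (suc k) ≡ y → site (suc k) ≡ site k ⊕ e →
               moment (suc k) ≡ suc (moment k) → Stretch k
      trip   : ∀ x d r → Tour k x d → (∀ q → q < r → path x d q ≉ 𝟎) → path x d r ≈ 𝟎 →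
               meeting (suc k) ≡ (freely x r , false) → site (suc k) ≡ site k →
               moment (suc k) ≡ r + suc (moment k) → Stretch k
      gone   : Lost k → Stretch k

    stretch : ∀ k → Stretch k
    stretch k = go (depart (meeting k)) refl
      where
      go : ∀ w → depart (meeting k) ≡ w → Stretch k
      go (inj₁ (y , e)) eq = direct y e eq (cong (target ∘ jumpBy (meeting k)) eq)
        (cong (λ w → site k ⊕ shift (jumpBy (meeting k) w)) eq)
        (cong (λ w → duration (jumpBy (meeting k) w) + moment k) eq)
      go (inj₂ (x , d)) eq = back (oracle x d) refl
        where
        back : ∀ w → oracle x d ≡ w → Stretch k
        back (no never) _ = gone (x , d , eq , λ r e → never (r , e))
        back (yes (r , e)) eq′ = trip x d r′ eq (proj₂ (proj₂ (proj₂ found))) (proj₁ (proj₂ (proj₂ found)))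
          (cong target jump≡) (trans (cong (λ j → site k ⊕ shift j) jump≡) (⊕-identityʳ (site k)))
          (trans (cong (λ j → duration j + moment k) jump≡) (sym (ℕ.+-suc r′ (moment k))))
          where
          found = least (λ q → ι (path x d q) ≟ᵛ ι 𝟎) r e
          r′ = proj₁ found
          jump≡ : jump (meeting k) ≡ jumpTo (freely x r′ , false) 𝟎 (suc r′)
          jump≡ = trans (cong (jumpBy (meeting k)) eq) (cong (tour (meeting k) x d) eq′)

    visited : ∀ i → Reached i → cfg (moment i) ≡ met (meeting i) (site i)
    visited zero    _ = refl
    visited (suc i) reached with stretch i | visited i (λ k h → reached k (ℕ.m≤n⇒m≤1+n h))
    ... | direct y e eq y≡ u≡ t≡ | now = trans (cong cfg t≡) (trans (cong cfgStep now)
          (trans (step-met (meeting i) (site i)) (trans (cong (after (site i)) eq) (cong₂ met (sym y≡) (sym u≡)))))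
    ... | trip x d r T before back y≡ u≡ t≡ | now = trans (cong cfg t≡)
          (trans (returning i x d T now r before back) (cong₂ met (sym y≡) (sym u≡)))
    ... | gone lost | _ = ⊥-elim (reached i ℕ.≤-refl lost)

    data Phase (s k : ℕ) : Set where
      meets  : cfg s ≡ met (meeting k) (site k) → Phase s k
      tours  : ∀ x d q → Tour k x d → Gone x d q → s ≡ q + suc (moment k) →
               cfg s ≡ away (freely x q) (site k) (path x d q) → Phase s k

    phases : ∀ i → Reached i → ∀ s → s < moment i → ∃[ k ] (k < i × Phase s k)
    phases (suc i) reached s s< with s ℕ.<? moment i
    ... | yes h with phases i (λ k h → reached k (ℕ.m≤n⇒m≤1+n h)) s h
    ...   | k , k<i , ph = k , ℕ.m≤n⇒m≤1+n k<i , ph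
    phases (suc i) reached s s< | no h with visited i (λ k h → reached k (ℕ.m≤n⇒m≤1+n h)) | stretch i
    ... | now | gone lost = ⊥-elim (reached i ℕ.≤-refl lost)
    ... | now | direct y e eq y≡ u≡ t≡ = i , ℕ.≤-refl , meets (trans (cong cfg
            (ℕ.≤-antisym (ℕ.≤-pred (subst (s <_) t≡ s<)) (ℕ.≮⇒≥ h))) now)
    ... | now | trip x d r T before back y≡ u≡ t≡ with ℕ.m≤n⇒m<n∨m≡n (ℕ.≮⇒≥ h)
    ...   | inj₂ refl = i , ℕ.≤-refl , meets now
    ...   | inj₁ later = i , ℕ.≤-refl , tours x d q T gone′ s≡ (trans (cong cfg s≡) (touring i x d T now q gone′))
      where
      q : ℕ
      q = s ℕ.∸ suc (moment i)
      s≡ : s ≡ q + suc (moment i)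
      s≡ = sym (ℕ.m∸n+n≡m later)
      gone′ : Gone x d q
      gone′ r′ r′≤q = before r′ (ℕ.≤-<-trans r′≤q (ℕ.+-cancelʳ-< (suc (moment i)) q r (subst₂ _<_ s≡ t≡ s<)))

    -- The token travels only while it is carried, by one step per meeting. A tour leaves it in
    -- place, no matter how long it takes.
    site-bound : ∀ i a → ∣ site i ! a ∣ ≤ i
    site-bound zero    X = z≤n
    site-bound zero    Y = z≤n
    site-bound (suc i) a with stretch i
    ... | direct y e eq _ u≡ _ = subst (λ z → ∣ z ! a ∣ ≤ suc i) (sym u≡)
          (subst₂ (λ x n → ∣ x ∣ ≤ n) (sym (!-⊕ (site i) e a)) (ℕ.+-comm i 1)
            (ℕ.≤-trans (ℤ.∣i+j∣≤∣i∣+∣j∣ (site i ! a) (e ! a)) (ℕ.+-mono-≤ (site-bound i a) (shift-bound _ y e eq a))))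
    ... | trip _ _ _ _ _ _ _ u≡ _ = subst (λ z → ∣ z ! a ∣ ≤ suc i) (sym u≡) (ℕ.m≤n⇒m≤1+n (site-bound i a))
    ... | gone (x , d , T , never) = subst (λ z → ∣ z ! a ∣ ≤ suc i) (sym still) (ℕ.m≤n⇒m≤1+n (site-bound i a))
      where
      lost-tour : ∀ w → (∃[ r ] path x d r ≈ 𝟎 → ⊥) → shift (tour (meeting i) x d w) ≡ 𝟎
      lost-tour (yes w) h = ⊥-elim (h w)
      lost-tour (no _)  h = refl
      still : site (suc i) ≡ site i
      still = trans (cong (λ w → site i ⊕ shift (jumpBy (meeting i) w)) T)
        (trans (cong (site i ⊕_) (lost-tour (oracle x d) (λ { (r , e) → never r e }))) (⊕-identityʳ (site i)))

-- Three agents in lockstep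

-- With drifts x and y, ∣y∣ laps of the first and ∣x∣ laps of the second cover equal distances, in
-- the same or in opposite directions. Two agents with different drifts can so be led to the same
-- pair of black holes.
same-length : ∀ x y → (+ ∣ y ∣ ℤ.* x ≡ + ∣ x ∣ ℤ.* y) ⊎ (+ ∣ x ∣ ℤ.* y ℤ.+ + ∣ y ∣ ℤ.* x ≡ 0ℤ)
same-length (+ m)      (+ n)      = inj₁ (ℤ.*-comm (+ n) (+ m))
same-length (+ m)      ℤ.-[1+ n ] = inj₂ (lemma (+ m) (+ suc n))
  where
  lemma : ∀ m n → m ℤ.* (ℤ.- n) ℤ.+ n ℤ.* m ≡ 0ℤ
  lemma = solve-∀
same-length ℤ.-[1+ m ] (+ n)      = inj₂ (lemma (+ suc m) (+ n))
  where
  lemma : ∀ m n → m ℤ.* n ℤ.+ n ℤ.* (ℤ.- m) ≡ 0ℤ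
  lemma = solve-∀
same-length ℤ.-[1+ m ] ℤ.-[1+ n ] = inj₁ (lemma (+ suc m) (+ suc n))
  where
  lemma : ∀ m n → n ℤ.* (ℤ.- m) ≡ m ℤ.* (ℤ.- n)
  lemma = solve-∀

two-coordinates : ∀ (P : Coord → Set) a → P a → P (other a) → ∀ b → P b
two-coordinates P X p q X = p
two-coordinates P X p q Y = q
two-coordinates P Y p q X = q
two-coordinates P Y p q Y = p

same-or-other : ∀ a b → b ≡ a ⊎ b ≡ other a
same-or-other a = two-coordinates (λ b → b ≡ a ⊎ b ≡ other a) a (inj₁ refl) (inj₂ refl)

other-other : ∀ a → other (other a) ≡ a
other-other X = refl
other-other Y = refl

pattern 1st = zero
pattern 2nd = suc zero
pattern 3rd = suc (suc zero)

module Three (arb : Arbiter 3) (A : Automaton) (t : ℕ) (t≤1 : t ≤ 1) (N′ : ℕ) (2≤N′ : 2 ≤ N′)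
             (solves : SolvesBHS arb t A) where

  1≤N′ : 1 ≤ N′
  1≤N′ = ℕ.≤-trans (s≤s z≤n) 2≤N′

  open MacroRun A t t≤1 N′ 1≤N′
  open Torus N N
  open Automaton A
  open SoloRun A N N

  π u ω : ℕ → ℤ²
  π s = place (cfg s)
  u s = home (cfg s)
  ω s = offset (cfg s)

  Quiet : ℕ → Set
  Quiet s = Output.danger (answer (cfg s)) ≡ nothing

  ≈-small : ∀ {z w} a → z ≈ w → ∣ z ! a ∣ + ∣ w ! a ∣ < N → z ! a ≡ w ! a
  ≈-small {z} {w} a e h = ≈-near a e (ℕ.≤-<-trans (ℤ.∣i-j∣≤∣i∣+∣j∣ (z ! a) (w ! a)) h)

  -- Both tokens have been displaced by the same vector `u s`, which cancels; only the offset from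
  -- the agent's own token remains.
  relative : ∀ {p q} s → p ⊕ π s ≈ q ⊕ u s → p ⊕ ω s ≈ q
  relative {p} {q} s e = ≈-cancelʳ (u s) (subst (_≈ q ⊕ u s) (lemma p (u s) (ω s)) e)
    where
    lemma : ∀ p u ω → p ⊕ (u ⊕ ω) ≡ p ⊕ ω ⊕ u
    lemma p u ω = trans (cong (p ⊕_) (⊕-comm u ω)) (sym (⊕-assoc p ω u))

  module World (p : Fin 3 → ℤ²) (b : ℤ²) (separate : ∀ i j → j ≢ i → p j ≉ p i)
               (off : ∀ i → p i ≉ b) where

    open Superposition arb A N N (ι b) public
    open Execution arb A N N (ι b) using (run; module Configuration) public

    placement : Fin 3 → Node
    placement i = ι (p i)

    placement-injective : ∀ {i j} → placement i ≡ placement j → i ≡ j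
    placement-injective {i} {j} e = decidable-stable (i Fin.≟ j) (λ i≢j → separate j i i≢j e)

    open Solving {t} {placement} (solves N N (s≤s 2≤N′) (s≤s 2≤N′) (ι b) placement
                                         placement-injective off) public

    sol : Fin 3 → ℕ → Solo
    sol i = soloRun (begins (p i))

    rep : ∀ i s → Represents (p i) (sol i s) (cfg s)
    rep i = represents (p i)

    -- Up to time T the agents move in lockstep, agent i falling into the black hole at time d i.
    module Fates (T : ℕ) (d : Fin 3 → ℕ)
      (before : ∀ i s → s < d i → s ≤ T → p i ⊕ π s ≉ b)
      (dies   : ∀ i → d i ≤ T → p i ⊕ π (d i) ≈ b)
      (clear  : ∀ i j → j ≢ i → ∀ s → s ≤ T → s < d i → p i ⊕ π s ≉ p j ⊕ u (s ⊓ d j)) where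

      live : ℕ → Fin 3 → Bool
      live s i = ⌊ s <? d i ⌋

      frozen : ℕ → Fin 3 → Solo
      frozen s i = sol i (s ⊓ d i)

      living : ∀ s i → live s i ≡ true → s < d i
      living s i l with s <? d i
      ... | yes h = h
      living s i () | no _

      frozen-live : ∀ s i → s < d i → frozen s i ≡ sol i s
      frozen-live s i h = cong (sol i) (ℕ.m≤n⇒m⊓n≡m (ℕ.<⇒≤ h))

      pos-live : ∀ s i → s < d i → pos (frozen s i) ≡ ι (p i ⊕ π s)
      pos-live s i h = trans (cong pos (frozen-live s i h)) (Represents.pos≡ (rep i s))

      undisturbed : ∀ s → s ≤ T → Undisturbed (live s) (frozen s)
      undisturbed s s≤T = record
        { unseen = λ i j l j≢i → trans (Represents.tok≡ (rep j (s ⊓ d j)) _)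
            (cong (if_then load (not (carried (cfg (s ⊓ d j)))) else 0)
              (⌊⌋-false (ι (p j ⊕ u (s ⊓ d j)) ≟ᵛ pos (frozen s i))
                (λ e → clear i j j≢i s s≤T (living s i l) (sym (trans e (pos-live s i (living s i l)))))))
        ; distinct = λ i j l l′ j≢i e → separate i j j≢i (≈-cancelʳ (π s)
            (trans (sym (pos-live s j (living s j l′))) (trans e (pos-live s i (living s i l))))) }

      advance : ∀ s → suc s ≤ T → ∀ i → Advances (live s) (live (suc s)) (frozen s) (frozen (suc s)) i
      advance s s<T i with ℕ.<-cmp s (d i)
      ... | tri> _ _ d<s = inj₁ (⌊⌋-false (s <? d i) (ℕ.<⇒≯ d<s)
            , ⌊⌋-false (suc s <? d i) (ℕ.<⇒≯ (ℕ.m≤n⇒m≤1+n d<s))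
            , cong (sol i) (trans (ℕ.m≥n⇒m⊓n≡n (ℕ.m≤n⇒m≤1+n (ℕ.<⇒≤ d<s))) (sym (ℕ.m≥n⇒m⊓n≡n (ℕ.<⇒≤ d<s)))))
      ... | tri≈ _ s≡d _ = inj₁ (⌊⌋-false (s <? d i) (ℕ.<-irrefl s≡d)
            , ⌊⌋-false (suc s <? d i) (ℕ.<⇒≯ (s≤s (ℕ.≤-reflexive (sym s≡d))))
            , cong (sol i) (trans (ℕ.m≥n⇒m⊓n≡n (ℕ.m≤n⇒m≤1+n (ℕ.≤-reflexive (sym s≡d))))
                                  (sym (ℕ.m≥n⇒m⊓n≡n (ℕ.≤-reflexive (sym s≡d))))))
      ... | tri< s<d _ _ = inj₂ (⌊⌋-true (s <? d i) s<d , steps , fate (ℕ.m≤n⇒m<n∨m≡n s<d))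
        where
        steps : frozen (suc s) i ≡ soloStep (frozen s i)
        steps = trans (cong (sol i) (ℕ.m≤n⇒m⊓n≡m s<d)) (cong soloStep (sym (frozen-live s i s<d)))
        fate : suc s < d i ⊎ suc s ≡ d i →
          (live (suc s) i ≡ true × pos (frozen (suc s) i) ≢ ι b)
          ⊎ (live (suc s) i ≡ false × pos (frozen (suc s) i) ≡ ι b)
        fate (inj₁ h) = inj₁ (⌊⌋-true (suc s <? d i) h ,
          λ e → before i (suc s) h s<T (trans (sym (pos-live (suc s) i h)) e))
        fate (inj₂ h) = inj₂ (⌊⌋-false (suc s <? d i) (ℕ.<-irrefl h) ,
          trans (cong (pos ∘ sol i) (trans (ℕ.m≥n⇒m⊓n≡n (ℕ.≤-reflexive (sym h))) (sym h)))
            (trans (Represents.pos≡ (rep i (suc s)))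
              (trans (cong (λ r → ι (p i ⊕ π r)) h) (dies i (subst (_≤ T) h s<T)))))

      alive-at-0 : ∀ i → 0 < d i
      alive-at-0 i with d i in eq
      ... | suc _ = s≤s z≤n
      ... | zero = ⊥-elim (off i (trans (cong ι (sym (trans (cong (p i ⊕_) (⊕-identityʳ 𝟎)) (⊕-identityʳ (p i)))))
                     (subst (λ r → p i ⊕ π r ≈ b) eq (dies i (subst (_≤ T) (sym eq) z≤n)))))

      superposed : ∀ s → s ≤ T → (∀ r → r < s → Quiet r) → Superposed (run t placement s) (live s) (frozen s)
      superposed zero _ q = record
        { agents≡ = λ i → sym (cong (if_then just (toAgent (begins (p i))) else nothing) (⌊⌋-true (0 <? d i) (alive-at-0 i)))
        ; tokens≡ = λ _ → refl ; marked≡ = λ _ → refl ; outside = λ i _ → off i }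
      superposed (suc s) s<T q = superposed-step (superposed s (ℕ.<⇒≤ s<T) (λ r r<s → q r (ℕ.m≤n⇒m≤1+n r<s)))
        (undisturbed s (ℕ.<⇒≤ s<T))
        (λ i l → trans (cong Output.danger (trans (cong response (frozen-live s i (living s i l)))
                                                  (represented-answer (rep i s)))) (q s ℕ.≤-refl))
        (advance s s<T)

  -- Here v is a node where a mark is made, and z and w are two candidates for the black hole. A
  -- mark that is correct for both needs both within one step of v; the size hypothesis makes this a
  -- statement about the plane.
  distance-bound : ∀ {z w v m m′} a → v ⊕ δ? m ≈ z → v ⊕ δ? m′ ≈ w →
    ∣ z ! a ∣ + ∣ w ! a ∣ + 2 < N → ∣ z ! a ℤ.- w ! a ∣ ≤ 2
  distance-bound {z} {w} {v} {m} {m′} a e e′ h =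
    subst (_≤ 2) (cong ∣_∣ (sym (trans (shift (z ! a) (w ! a) (δ? m ! a) (δ? m′ ! a) coordinate) refl))) bound
    where
    bound : ∣ δ? m ! a ℤ.- δ? m′ ! a ∣ ≤ 2
    bound = ℕ.≤-trans (ℤ.∣i-j∣≤∣i∣+∣j∣ (δ? m ! a) (δ? m′ ! a)) (ℕ.+-mono-≤ (δ?-bound m a) (δ?-bound m′ a))
    crossed : z ⊕ δ? m′ ≈ w ⊕ δ? m
    crossed = trans (≈-⊕ {z} {v ⊕ δ? m} {δ? m′} (sym e) refl)
      (trans (cong ι (swap v (δ? m) (δ? m′))) (≈-⊕ {v ⊕ δ? m′} {w} {δ? m} e′ refl))
    reach : ∀ z m → ∣ (z ⊕ δ? m) ! a ∣ ≤ ∣ z ! a ∣ + 1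
    reach z m = subst (λ x → ∣ x ∣ ≤ ∣ z ! a ∣ + 1) (sym (!-⊕ z (δ? m) a))
      (ℕ.≤-trans (ℤ.∣i+j∣≤∣i∣+∣j∣ (z ! a) (δ? m ! a)) (ℕ.+-monoʳ-≤ ∣ z ! a ∣ (δ?-bound m a)))
    coordinate : z ! a ℤ.+ δ? m′ ! a ≡ w ! a ℤ.+ δ? m ! a
    coordinate = trans (sym (!-⊕ z (δ? m′) a)) (trans (≈-small a crossed
      (linear 5 (λ x y x′ y′ n → x′ :≤ x :+ con 1 ∷ y′ :≤ y :+ con 1 ∷ x :+ y :+ con 2 :< n ∷ [] ⊢ x′ :+ y′ :< n) refl
        (∣ z ! a ∣) (∣ w ! a ∣) (∣ (z ⊕ δ? m′) ! a ∣) (∣ (w ⊕ δ? m) ! a ∣) N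
        (reach z m′) (reach w m) h)) (!-⊕ w (δ? m) a))
    shift : ∀ x y p q → x ℤ.+ q ≡ y ℤ.+ p → x ℤ.- y ≡ p ℤ.- q
    shift x y p q h = trans (lemma₁ x y q) (trans (cong (λ k → k ℤ.- q ℤ.- y) h) (lemma₂ y p q))
      where
      lemma₁ : ∀ x y q → x ℤ.- y ≡ x ℤ.+ q ℤ.- q ℤ.- y
      lemma₁ = solve-∀
      lemma₂ : ∀ y p q → y ℤ.+ p ℤ.- q ℤ.- y ≡ p ℤ.- q
      lemma₂ = solve-∀

  sum-size : ∀ x y z → x ℤ.+ y ≡ z → ∣ z ∣ ≤ ∣ x ∣ + ∣ y ∣ × ∣ x ∣ ≤ ∣ z ∣ + ∣ y ∣ × ∣ y ∣ ≤ ∣ z ∣ + ∣ x ∣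
  sum-size x y z refl = ℤ.∣i+j∣≤∣i∣+∣j∣ x y
    , subst (λ k → ∣ k ∣ ≤ ∣ z ∣ + ∣ y ∣) (lemma x y) (ℤ.∣i-j∣≤∣i∣+∣j∣ z y)
    , subst (λ k → ∣ k ∣ ≤ ∣ z ∣ + ∣ x ∣) (+-sub x y) (ℤ.∣i-j∣≤∣i∣+∣j∣ z x)
    where
    lemma : ∀ x y → x ℤ.+ y ℤ.- y ≡ x
    lemma = solve-∀

  ⊕-size : ∀ z w a → ∣ (z ⊕ w) ! a ∣ ≤ ∣ z ! a ∣ + ∣ w ! a ∣
                   × ∣ z ! a ∣ ≤ ∣ (z ⊕ w) ! a ∣ + ∣ w ! a ∣ × ∣ w ! a ∣ ≤ ∣ (z ⊕ w) ! a ∣ + ∣ z ! a ∣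
  ⊕-size z w a = sum-size (z ! a) (w ! a) ((z ⊕ w) ! a) (sym (!-⊕ z w a))

  -- Three agents, placed diagonally at distance K, that do not meet each other's tokens and never
  -- visit b: no agent can mark a link, for another one would mark a distant link.
  module Diagonal (K : ℕ) (3≤K : 3 ≤ K) (C : ℕ) (C<K : C < K) (wide : 10 * K < N) where

    multiple-of-K : Fin 3 → ℕ
    multiple-of-K 1st = 0
    multiple-of-K 2nd = K
    multiple-of-K 3rd = K + K

    diagonal : Fin 3 → ℤ²
    diagonal i = + multiple-of-K i , + multiple-of-K i

    diagonal! : ∀ i a → diagonal i ! a ≡ + multiple-of-K i
    diagonal! i X = refl
    diagonal! i Y = refl

    ∣diagonal∣ : ∀ i a → ∣ diagonal i ! a ∣ ≡ multiple-of-K i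
    ∣diagonal∣ i a = cong ∣_∣ (diagonal! i a)

    at-most : ∀ i → multiple-of-K i ≤ 2 * K
    at-most 1st = z≤n
    at-most 2nd = ℕ.m≤m+n K (K + 0)
    at-most 3rd = ℕ.≤-reflexive (cong (λ k → K + k) (sym (ℕ.+-identityʳ K)))

    gap : ∀ i j → j ≢ i → multiple-of-K i + K ≤ multiple-of-K j ⊎ multiple-of-K j + K ≤ multiple-of-K i
    gap 1st 1st h = ⊥-elim (h refl)
    gap 2nd 2nd h = ⊥-elim (h refl)
    gap 3rd 3rd h = ⊥-elim (h refl)
    gap 1st 2nd h = inj₁ ℕ.≤-refl
    gap 1st 3rd h = inj₁ (ℕ.m≤m+n K K)
    gap 2nd 3rd h = inj₁ ℕ.≤-refl
    gap 2nd 1st h = inj₂ ℕ.≤-refl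
    gap 3rd 1st h = inj₂ (ℕ.m≤m+n K K)
    gap 3rd 2nd h = inj₂ ℕ.≤-refl

    not-close : ∀ {z} i j → j ≢ i → ∀ a → diagonal i ⊕ z ≈ diagonal j → ∣ z ! a ∣ < K → ⊥
    not-close {z} i j j≢i a e small = go (gap i j j≢i)
      where
      m n x : ℕ
      m = multiple-of-K i
      n = multiple-of-K j
      x = ∣ z ! a ∣
      sizes = ⊕-size (diagonal i) z a
      equal : (diagonal i ⊕ z) ! a ≡ diagonal j ! a
      equal = ≈-small a e (linear 7 (λ k m m′ n n′ x s → m :≤ 2 :* k ∷ n :≤ 2 :* k ∷ m′ :≡ m ∷ n′ :≡ n ∷ x :< k ∷
          s :≤ m′ :+ x ∷ [] ⊢ s :+ n′ :< 10 :* k) refl K m (∣ diagonal i ! a ∣) n (∣ diagonal j ! a ∣) x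
          (∣ (diagonal i ⊕ z) ! a ∣) (at-most i) (at-most j) (∣diagonal∣ i a) (∣diagonal∣ j a) small (proj₁ sizes)
        ⟨ ℕ.<-trans ⟩ wide)
      sums : + m ℤ.+ z ! a ≡ + n
      sums = trans (cong (ℤ._+ z ! a) (sym (diagonal! i a)))
        (trans (sym (!-⊕ (diagonal i) z a)) (trans equal (diagonal! j a)))
      go : m + K ≤ n ⊎ n + K ≤ m → ⊥
      go (inj₁ h) = ℕ.<⇒≱ (linear 4 (λ k m n x → m :+ k :≤ n ∷ x :< k ∷ [] ⊢ m :+ x :< n) refl K m n x h small)
                          (proj₁ (sum-size (+ m) (z ! a) (+ n) sums))
      go (inj₂ h) = ℕ.<⇒≱ (linear 4 (λ k m n x → n :+ k :≤ m ∷ x :< k ∷ [] ⊢ n :+ x :< m) refl K m n x h small)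
                          (proj₁ (proj₂ (sum-size (+ m) (z ! a) (+ n) sums)))

    apart : ∀ i j → j ≢ i → diagonal j ≉ diagonal i
    apart i j j≢i e = not-close {𝟎} i j j≢i X (trans (cong ι (⊕-identityʳ (diagonal i))) (sym e))
      (ℕ.<-≤-trans (s≤s z≤n) 3≤K)

    module Idle (b : ℤ²) (off : ∀ i → diagonal i ≉ b) where

     open World diagonal b apart off

     module Until (T : ℕ) (band : ∀ s → s ≤ T → ∃[ a ] ∣ ω s ! a ∣ ≤ C)
                  (unvisited : ∀ s → s ≤ T → ∀ i → diagonal i ⊕ π s ≉ b) where

      clear : ∀ i j → j ≢ i → ∀ s → s ≤ T → s < suc T → diagonal i ⊕ π s ≉ diagonal j ⊕ u (s ⊓ suc T)
      clear i j j≢i s s≤T s<d e = let a , small = band s s≤T in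
        not-close i j j≢i a (relative {diagonal i} {diagonal j} s
          (subst (λ r → diagonal i ⊕ π s ≈ diagonal j ⊕ u r) (ℕ.m≤n⇒m⊓n≡m (ℕ.<⇒≤ s<d)) e))
          (ℕ.≤-<-trans small C<K)

      -- The death time `suc T` expresses survival during the whole period considered.
      open Fates T (λ _ → suc T) (λ i s _ s≤T → unvisited s s≤T i) (λ i h → ⊥-elim (ℕ.<-irrefl refl h)) clear

      near-b : ∀ s → (∀ r → r < s → Quiet r) → s ≤ T → ∀ i e → Output.danger (answer (cfg s)) ≡ just e →
        ∃[ m ] b ≈ diagonal i ⊕ π s ⊕ δ? m
      near-b s q s≤T i e eq = incident⇒≈ e (subst (λ v → Incident (ι b) (link v e)) (pos-live s i (s≤s s≤T))
        (danger⇒incident {s} (superposed s s≤T q) (undisturbed s s≤T) i e (⌊⌋-true (s <? suc T) (s≤s s≤T))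
          (trans (cong Output.danger (trans (cong response (frozen-live s i (s≤s s≤T)))
                                            (represented-answer (rep i s)))) eq)))

      quiet-at : ∀ s → (∀ r → r < s → Quiet r) → s ≤ T → Quiet s
      quiet-at s q s≤T = is-nothing λ danger → go (something danger)
        where
        go : ∃[ e ] Output.danger (answer (cfg s)) ≡ just e → ⊥
        go (e , eq) = clash (near-b s q s≤T 1st e eq) (near-b s q s≤T 2nd e eq)
          where
          clash : ∃[ m ] b ≈ diagonal 1st ⊕ π s ⊕ δ? m → ∃[ m ] b ≈ diagonal 2nd ⊕ π s ⊕ δ? m → ⊥
          clash (m , x) (m′ , y) = not-close {δ? m ⊖ δ? m′} 1st 2nd (λ ()) X
            (≈-cancelʳ (π s ⊕ δ? m′) (subst₂ _≈_ (lemma (diagonal 1st) (π s) (δ? m) (δ? m′))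
              (⊕-assoc (diagonal 2nd) (π s) (δ? m′)) (trans (sym x) y)))
            (ℕ.≤-trans (s≤s (ℕ.≤-trans (ℤ.∣i-j∣≤∣i∣+∣j∣ (δ? m ! X) (δ? m′ ! X))
              (ℕ.+-mono-≤ (δ?-bound m X) (δ?-bound m′ X)))) 3≤K)
            where
            scalar : ∀ a b c d → a ℤ.+ b ℤ.+ c ≡ a ℤ.+ (c ℤ.- d) ℤ.+ (b ℤ.+ d)
            scalar = solve-∀
            lemma : ∀ p z x y → p ⊕ z ⊕ x ≡ p ⊕ (x ⊖ y) ⊕ (z ⊕ y)
            lemma (p , p′) (z , z′) (x , x′) (y , y′) = cong₂ _,_ (scalar p z x y) (scalar p′ z′ x′ y′)

      quiet : ∀ s → s ≤ T → Quiet s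
      quiet s s≤T = below (suc s) (s≤s s≤T) s ℕ.≤-refl
        where
        below : ∀ n → n ≤ suc T → ∀ r → r < n → Quiet r
        below (suc n) h r r≤n = go (ℕ.m≤n⇒m<n∨m≡n (ℕ.s≤s⁻¹ r≤n))
          where
          n≤ : n ≤ suc T
          n≤ = ℕ.m≤n⇒m≤1+n (ℕ.s≤s⁻¹ h)
          go : r < n ⊎ r ≡ n → Quiet r
          go (inj₁ r<n) = below n n≤ r r<n
          go (inj₂ r≡n) = subst Quiet (sym r≡n) (quiet-at n (below n n≤) (ℕ.s≤s⁻¹ h))

      still-unmarked : ∀ l → Configuration.marked (run t placement T) l ≡ false
      still-unmarked = Superposed.marked≡ (superposed T ℕ.≤-refl (λ r r<T → quiet r (ℕ.<⇒≤ r<T)))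

     forever : (∀ s → ∃[ a ] ∣ ω s ! a ∣ ≤ C) → (∀ s i → diagonal i ⊕ π s ≉ b) → ⊥
     forever band unvisited = not-unmarked 0 λ s _ →
       Until.still-unmarked s (λ r _ → band r) (λ r _ → unvisited r)

  ∣negated∣ : ∀ z a → ∣ (𝟎 ⊖ z) ! a ∣ ≡ ∣ z ! a ∣
  ∣negated∣ z a = trans (cong ∣_∣ (trans (!-⊖ 𝟎 z a) (trans (cong (ℤ._- z ! a) (𝟎! a)) (ℤ.+-identityˡ (ℤ.- (z ! a))))))
    (ℤ.∣-i∣≡∣i∣ (z ! a))

  nonzero-along : ∀ {z} a → z ≢ 𝟎 → z ! other a ≡ 0ℤ → z ! a ≢ 0ℤ
  nonzero-along {z} a z≢𝟎 e e′ = z≢𝟎 (vec≡ (two-coordinates (λ c → z ! c ≡ 𝟎 ! c) a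
    (trans e′ (sym (𝟎! a))) (trans e (sym (𝟎! (other a))))))

  ⊕𝟎𝟎 : ∀ z → z ⊕ (𝟎 ⊕ 𝟎) ≡ z
  ⊕𝟎𝟎 z = trans (cong (z ⊕_) (⊕-identityʳ 𝟎)) (⊕-identityʳ z)

  node-ι : ∀ v → ∃[ z ] v ≡ ι z
  node-ι (x , y) = (+ toℕ x , + toℕ y) , sym (cong₂ _,_ (residue-toℕ x) (residue-toℕ y))

  -- The time of death depends on the black hole. If it falls in this interval, the node of the
  -- abandoned token does not.
  LeavesToken : (U : ℤ²) (E₀ E : ℕ) → Set
  LeavesToken U E₀ E = ∀ s → E₀ < s → s ≤ E → u s ≡ U × carried (cfg s) ≡ false

  record Falls (p β : ℤ²) (E₀ E : ℕ) : Set where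
    field
      time    : ℕ
      time≤   : time ≤ E
      visit   : p ⊕ π time ≈ β
      unseen  : ∀ s → s ≤ E₀ → p ⊕ π s ≉ β

  -- Agents that stay in horizontal and vertical bands neither mark a link nor find the black hole.
  module Corner (C K : ℕ) (large : C + 3 ≤ K) (wide : 10 * K < N) where

    open Diagonal K (ℕ.≤-trans (ℕ.m≤n+m 3 C) large) C
      (linear 2 (λ c k → c :+ con 3 :≤ k ∷ [] ⊢ c :< k) refl C K large) wide

    -- The agents start with coordinates at most 2K, and one coordinate, possibly varying with time,
    -- changes by at most C < K. So whichever coordinate this is, it differs from 3K.
    b₀ : ℤ²
    b₀ = + (3 * K) , + (3 * K)

    ∣b₀∣ : ∀ a → ∣ b₀ ! a ∣ ≡ 3 * K
    ∣b₀∣ X = refl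
    ∣b₀∣ Y = refl

    outside : ∀ i {z} a → diagonal i ⊕ z ≈ b₀ → ∣ z ! a ∣ ≤ C → ⊥
    outside i {z} a e h = ℕ.<⇒≱
      (linear 5 (λ c k d x b → c :+ con 3 :≤ k ∷ d :≤ 2 :* k ∷ x :≤ c ∷ b :≡ 3 :* k ∷ [] ⊢ d :+ x :< b) refl
        C K (∣ diagonal i ! a ∣) (∣ z ! a ∣) (∣ b₀ ! a ∣) large bound h (∣b₀∣ a))
      (subst (λ x → ∣ x ∣ ≤ ∣ diagonal i ! a ∣ + ∣ z ! a ∣) equal (proj₁ sizes))
      where
      sizes = ⊕-size (diagonal i) z a
      bound : ∣ diagonal i ! a ∣ ≤ 2 * K
      bound = subst (_≤ 2 * K) (sym (∣diagonal∣ i a)) (at-most i)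
      equal : (diagonal i ⊕ z) ! a ≡ b₀ ! a
      equal = ≈-small a e (ℕ.<-trans (linear 6 (λ c k d x b s → c :+ con 3 :≤ k ∷ d :≤ 2 :* k ∷ x :≤ c
          ∷ b :≡ 3 :* k ∷ s :≤ d :+ x ∷ [] ⊢ s :+ b :< 10 :* k) refl
        C K (∣ diagonal i ! a ∣) (∣ z ! a ∣) (∣ b₀ ! a ∣) (∣ (diagonal i ⊕ z) ! a ∣) large bound h (∣b₀∣ a) (proj₁ sizes)) wide)

    open Idle b₀ (λ i e → outside i {𝟎} X (trans (cong ι (⊕-identityʳ (diagonal i))) e) z≤n)

    quiet : ∀ T → (∀ s → s ≤ T → ∃[ a ] ∣ ω s ! a ∣ ≤ C) → (∀ s → s ≤ T → ∃[ a ] ∣ π s ! a ∣ ≤ C) →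
      ∀ s → s ≤ T → Quiet s
    quiet T bandω bandπ = Until.quiet T bandω (λ s s≤T i e → let a , h = bandπ s s≤T in outside i a e h)

    stay-forever : (∀ s → ∃[ a ] ∣ ω s ! a ∣ ≤ C) → (∀ s → ∃[ a ] ∣ π s ! a ∣ ≤ C) → ⊥
    stay-forever bandω bandπ = forever bandω (λ s i e → let a , h = bandπ s in outside i a e h)

  -- If two agents fall into the black hole, leaving their tokens at the same nodes, wherever the
  -- black hole is among two distant nodes, then a third one has no way to find out where it is.
  module Ambiguity (C G K : ℕ) (large : C + 2 * G + 3 ≤ K) (wide : 10 * K < N)
    (T : ℕ) (bandω : ∀ s → s ≤ T → ∃[ a ] ∣ ω s ! a ∣ ≤ C) (bandπ : ∀ s → s ≤ T → ∃[ a ] ∣ π s ! a ∣ ≤ C)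
    (p₁ p₂ U₁ U₂ : ℤ²) (E₁⁰ E₁ E₂⁰ E₂ : ℕ) (E₁≤T : E₁ ≤ T) (E₂≤T : E₂ ≤ T)
    (boxp₁ : ∀ a → ∣ p₁ ! a ∣ ≤ G) (boxp₂ : ∀ a → ∣ p₂ ! a ∣ ≤ G)
    (boxU₁ : ∀ a → ∣ U₁ ! a ∣ ≤ G) (boxU₂ : ∀ a → ∣ U₂ ! a ∣ ≤ G)
    (lost₁ : LeavesToken U₁ E₁⁰ E₁) (lost₂ : LeavesToken U₂ E₂⁰ E₂)
    (clear₁₂ : ∀ s → s ≤ E₁ → p₁ ⊕ π s ≉ p₂ ⊕ u s)
    (clear₁₂′ : ∀ s → E₂⁰ < s → s ≤ E₁ → p₁ ⊕ π s ≉ p₂ ⊕ U₂)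
    (clear₂₁ : ∀ s → s ≤ E₂ → s ≤ E₁ → p₂ ⊕ π s ≉ p₁ ⊕ u s)
    (clear₂₁′ : ∀ s → E₁⁰ < s → s ≤ E₂ → p₂ ⊕ π s ≉ p₁ ⊕ U₁) where

    p : Fin 3 → ℤ²
    p 1st = p₁
    p 2nd = p₂
    p 3rd = + K , + K

    p₃! : ∀ a → p 3rd ! a ≡ + K
    p₃! X = refl
    p₃! Y = refl

    beyond : ∀ a {z w} → p 3rd ⊕ z ≈ w → ∣ z ! a ∣ + ∣ w ! a ∣ < K → ⊥
    beyond a {z} {w} e h = ℕ.<⇒≱
      (linear 4 (λ k k′ x y → x :+ y :< k ∷ k′ :≡ k ∷ [] ⊢ y :+ x :< k′) refl K (∣ p 3rd ! a ∣) (∣ z ! a ∣) (∣ w ! a ∣)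
        h (cong ∣_∣ (p₃! a)))
      (subst (λ x → ∣ p 3rd ! a ∣ ≤ ∣ x ∣ + ∣ z ! a ∣) equal (proj₁ (proj₂ sizes)))
      where
      sizes = ⊕-size (p 3rd) z a
      equal : (p 3rd ⊕ z) ! a ≡ w ! a
      equal = ≈-small a e (linear 6 (λ k k′ x y s n → x :+ y :< k ∷ k′ :≡ k ∷ s :≤ k′ :+ x ∷ 10 :* k :< n ∷ [] ⊢ s :+ y :< n)
        refl K (∣ p 3rd ! a ∣) (∣ z ! a ∣) (∣ w ! a ∣) (∣ (p 3rd ⊕ z) ! a ∣) N h (cong ∣_∣ (p₃! a)) (proj₁ sizes) wide)

    beyond-origin : ∀ {w} → p 3rd ≈ w → ∃[ a ] ∣ w ! a ∣ < K → ⊥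
    beyond-origin {w} e (a , h) = beyond a {𝟎} {w} (trans (cong ι (⊕-identityʳ (p 3rd))) e)
      (subst (λ x → ∣ x ∣ + ∣ w ! a ∣ < K) (sym (𝟎! a)) h)

    G<K : G < K
    G<K = linear 3 (λ c g k → c :+ 2 :* g :+ con 3 :≤ k ∷ [] ⊢ g :< k) refl C G K large

    sum<K : ∀ {x y} → x ≤ C → y ≤ 2 * G → x + y < K
    sum<K {x} {y} = λ h h′ → linear 5 (λ c g k x y → c :+ 2 :* g :+ con 3 :≤ k ∷ x :≤ c ∷ y :≤ 2 :* g ∷ [] ⊢ x :+ y :< k) refl
      C G K x y large h h′

    G≤2G : G ≤ 2 * G
    G≤2G = ℕ.m≤m+n G (G + 0)

    add-boxes : ∀ {z w} → (∀ a → ∣ z ! a ∣ ≤ G) → (∀ a → ∣ w ! a ∣ ≤ G) → ∀ a → ∣ (z ⊕ w) ! a ∣ ≤ 2 * G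
    add-boxes {z} {w} h h′ a = ℕ.≤-trans (proj₁ (⊕-size z w a))
      (subst (∣ z ! a ∣ + ∣ w ! a ∣ ≤_) (cong (λ x → G + x) (sym (ℕ.+-identityʳ G))) (ℕ.+-mono-≤ (h a) (h′ a)))

    sync-from : ∀ q → (∀ a → ∣ q ! a ∣ ≤ G) → ∀ s → s ≤ T → q ⊕ π s ≉ p 3rd ⊕ u s
    sync-from q box s s≤T e = let a , h = bandω s s≤T in
      beyond-origin (sym (relative {q} {p 3rd} s e)) (a , ℕ.≤-<-trans
        (ℕ.≤-trans (proj₁ (⊕-size q (ω s) a)) (ℕ.≤-reflexive (ℕ.+-comm ∣ q ! a ∣ ∣ ω s ! a ∣)))
        (sum<K h (ℕ.≤-trans (box a) G≤2G)))

    sync-to : ∀ q → (∀ a → ∣ q ! a ∣ ≤ G) → ∀ s → s ≤ T → p 3rd ⊕ π s ≉ q ⊕ u s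
    sync-to q box s s≤T e = let a , h = bandω s s≤T in
      beyond a (relative {p 3rd} {q} s e) (sum<K h (ℕ.≤-trans (box a) G≤2G))

    avoids : ∀ q → (∀ a → ∣ q ! a ∣ ≤ 2 * G) → ∀ s → s ≤ T → p 3rd ⊕ π s ≉ q
    avoids q box s s≤T e = let a , h = bandπ s s≤T in beyond a e (sum<K h (box a))

    -- Silence is a property of the solo run. It is proved in the world of `Corner`, which has
    -- another placement and another black hole.
    quiet : ∀ s → s ≤ T → Quiet s
    quiet = Corner.quiet C K (linear 3 (λ c g k → c :+ 2 :* g :+ con 3 :≤ k ∷ [] ⊢ c :+ con 3 :≤ k) refl C G K large) wide
              T bandω bandπ

    tokens-left : Node → ℕ
    tokens-left v = (if ⌊ ι (p₁ ⊕ U₁) ≟ᵛ v ⌋ then t else 0) + ((if ⌊ ι (p₂ ⊕ U₂) ≟ᵛ v ⌋ then t else 0) +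
      (tok (soloRun (begins (p 3rd)) T) v + 0))

    -- After time T the third agent is alone, so all tokens on the ground, including those of the
    -- dead, can be attributed to its own solo run. It may then use them freely, and its run is the
    -- same for both black holes as long as it neither marks nor dies.
    witness : ℕ → Solo
    witness = soloRun (solo (pos σ) (st σ) (arr σ) (held σ) tokens-left)
      where
      σ : Solo
      σ = soloRun (begins (p 3rd)) T

    onlyThird : Fin 3 → Bool
    onlyThird 1st = false
    onlyThird 2nd = false
    onlyThird 3rd = true

    lone : ℕ → Fin 3 → Solo
    lone s 1st = solo (ι 𝟎) initial nothing 0 (λ _ → 0)
    lone s 2nd = solo (ι 𝟎) initial nothing 0 (λ _ → 0)
    lone s 3rd = witness s

    p₁≉p₂ : p₁ ≉ p₂
    p₁≉p₂ e = clear₁₂ 0 z≤n (trans (cong ι (⊕𝟎𝟎 p₁)) (trans e (cong ι (sym (⊕-identityʳ p₂)))))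

    separate : ∀ i j → j ≢ i → p j ≉ p i
    separate 1st 1st h = ⊥-elim (h refl)
    separate 2nd 2nd h = ⊥-elim (h refl)
    separate 3rd 3rd h = ⊥-elim (h refl)
    separate 1st 2nd h e = p₁≉p₂ (sym e)
    separate 2nd 1st h e = p₁≉p₂ e
    separate 1st 3rd h e = beyond-origin e (X , ℕ.≤-<-trans (boxp₁ X) G<K)
    separate 2nd 3rd h e = beyond-origin e (X , ℕ.≤-<-trans (boxp₂ X) G<K)
    separate 3rd 1st h e = beyond-origin (sym e) (X , ℕ.≤-<-trans (boxp₁ X) G<K)
    separate 3rd 2nd h e = beyond-origin (sym e) (X , ℕ.≤-<-trans (boxp₂ X) G<K)

    module Case (β : ℤ²) (boxβ : ∀ a → ∣ β ! a ∣ ≤ G)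
                (falls₁ : Falls p₁ β E₁⁰ E₁) (falls₂ : Falls p₂ β E₂⁰ E₂) where

      off : ∀ i → p i ≉ β
      off 1st e = Falls.unseen falls₁ 0 z≤n (trans (cong ι (⊕𝟎𝟎 p₁)) e)
      off 2nd e = Falls.unseen falls₂ 0 z≤n (trans (cong ι (⊕𝟎𝟎 p₂)) e)
      off 3rd e = beyond-origin e (X , ℕ.≤-<-trans (boxβ X) G<K)

      open World p β separate off public

      first : ∀ i {E₀ E} → Falls (p i) β E₀ E →
        ∃[ d ] (E₀ < d × d ≤ E × p i ⊕ π d ≈ β × (∀ s → s < d → p i ⊕ π s ≉ β))
      first i f with least (λ s → ι (p i ⊕ π s) ≟ᵛ ι β) (Falls.time f) (Falls.visit f)
      ... | d , d≤ , v , before = d , ℕ.≰⇒> (λ h → Falls.unseen f d h v) , ℕ.≤-trans d≤ (Falls.time≤ f) , v , before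

      F₁ = first 1st falls₁
      F₂ = first 2nd falls₂

      d : Fin 3 → ℕ
      d 1st = proj₁ F₁
      d 2nd = proj₁ F₂
      d 3rd = suc T

      before : ∀ i s → s < d i → s ≤ T → p i ⊕ π s ≉ β
      before 1st s h _ = proj₂ (proj₂ (proj₂ (proj₂ F₁))) s h
      before 2nd s h _ = proj₂ (proj₂ (proj₂ (proj₂ F₂))) s h
      before 3rd s h s≤T = avoids β (λ a → ℕ.≤-trans (boxβ a) G≤2G) s s≤T

      dies : ∀ i → d i ≤ T → p i ⊕ π (d i) ≈ β
      dies 1st _ = proj₁ (proj₂ (proj₂ (proj₂ F₁)))
      dies 2nd _ = proj₁ (proj₂ (proj₂ (proj₂ F₂)))
      dies 3rd h = ⊥-elim (ℕ.<-irrefl refl h)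

      home₁ : u (d 1st) ≡ U₁ × carried (cfg (d 1st)) ≡ false
      home₁ = lost₁ _ (proj₁ (proj₂ F₁)) (proj₁ (proj₂ (proj₂ F₁)))
      home₂ : u (d 2nd) ≡ U₂ × carried (cfg (d 2nd)) ≡ false
      home₂ = lost₂ _ (proj₁ (proj₂ F₂)) (proj₁ (proj₂ (proj₂ F₂)))

      either : ∀ q q′ s d → (s ≤ d → q ⊕ π s ≉ q′ ⊕ u s) → (d ≤ s → q ⊕ π s ≉ q′ ⊕ u d) →
        q ⊕ π s ≉ q′ ⊕ u (s ⊓ d)
      either q q′ s d f g e = go (ℕ.≤-total s d)
        where
        go : s ≤ d ⊎ d ≤ s → ⊥
        go (inj₁ h) = f h (subst (λ r → q ⊕ π s ≈ q′ ⊕ u r) (ℕ.m≤n⇒m⊓n≡m h) e)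
        go (inj₂ h) = g h (subst (λ r → q ⊕ π s ≈ q′ ⊕ u r) (ℕ.m≥n⇒m⊓n≡n h) e)

      to-third : ∀ q → (∀ a → ∣ q ! a ∣ ≤ G) → ∀ s → s ≤ T → q ⊕ π s ≉ p 3rd ⊕ u (s ⊓ suc T)
      to-third q box s s≤T = either q (p 3rd) s (suc T) (λ _ → sync-from q box s s≤T)
        (λ h → ⊥-elim (ℕ.<⇒≱ h s≤T))

      clear : ∀ i j → j ≢ i → ∀ s → s ≤ T → s < d i → p i ⊕ π s ≉ p j ⊕ u (s ⊓ d j)
      clear 1st 1st h = ⊥-elim (h refl)
      clear 2nd 2nd h = ⊥-elim (h refl)
      clear 3rd 3rd h = ⊥-elim (h refl)
      clear 1st 2nd _ s _ s<d = let s≤E₁ = ℕ.≤-trans (ℕ.<⇒≤ s<d) (proj₁ (proj₂ (proj₂ F₁))) in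
        either p₁ p₂ s (d 2nd) (λ _ → clear₁₂ s s≤E₁)
          (λ d≤s → subst (λ z → p₁ ⊕ π s ≉ p₂ ⊕ z) (sym (proj₁ home₂))
                     (clear₁₂′ s (ℕ.<-≤-trans (proj₁ (proj₂ F₂)) d≤s) s≤E₁))
      clear 2nd 1st _ s _ s<d = let s≤E₂ = ℕ.≤-trans (ℕ.<⇒≤ s<d) (proj₁ (proj₂ (proj₂ F₂))) in
        either p₂ p₁ s (d 1st) (λ s≤d → clear₂₁ s s≤E₂ (ℕ.≤-trans s≤d (proj₁ (proj₂ (proj₂ F₁)))))
          (λ d≤s → subst (λ z → p₂ ⊕ π s ≉ p₁ ⊕ z) (sym (proj₁ home₁))
                     (clear₂₁′ s (ℕ.<-≤-trans (proj₁ (proj₂ F₁)) d≤s) s≤E₂))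
      clear 1st 3rd _ s s≤T _ = to-third p₁ boxp₁ s s≤T
      clear 2nd 3rd _ s s≤T _ = to-third p₂ boxp₂ s s≤T
      clear 3rd 1st _ s s≤T _ = either (p 3rd) p₁ s (d 1st) (λ _ → sync-to p₁ boxp₁ s s≤T)
        (λ _ → avoids _ (subst (λ z → ∀ a → ∣ (p₁ ⊕ z) ! a ∣ ≤ 2 * G) (sym (proj₁ home₁))
                          (add-boxes {p₁} {U₁} boxp₁ boxU₁)) s s≤T)
      clear 3rd 2nd _ s s≤T _ = either (p 3rd) p₂ s (d 2nd) (λ _ → sync-to p₂ boxp₂ s s≤T)
        (λ _ → avoids _ (subst (λ z → ∀ a → ∣ (p₂ ⊕ z) ! a ∣ ≤ 2 * G) (sym (proj₁ home₂))
                          (add-boxes {p₂} {U₂} boxp₂ boxU₂)) s s≤T)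

      open Fates T d before dies clear public

      d≤T₁ : d 1st ≤ T
      d≤T₁ = ℕ.≤-trans (proj₁ (proj₂ (proj₂ F₁))) E₁≤T
      d≤T₂ : d 2nd ≤ T
      d≤T₂ = ℕ.≤-trans (proj₁ (proj₂ (proj₂ F₂))) E₂≤T

      left : ∀ i U → d i ≤ T → u (d i) ≡ U × carried (cfg (d i)) ≡ false → ∀ v →
        tok (frozen T i) v ≡ (if ⌊ ι (p i ⊕ U) ≟ᵛ v ⌋ then t else 0)
      left i U d≤T (h , c) v = trans (cong (λ r → tok (sol i r) v) (ℕ.m≥n⇒m⊓n≡n d≤T))
        (trans (Represents.tok≡ (rep i (d i)) v)
          (cong₂ (λ z c → if ⌊ ι (p i ⊕ z) ≟ᵛ v ⌋ then load (not c) else 0) h c))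

      alone : Superposed (run t placement T) onlyThird (lone 0)
      alone = record
        { agents≡ = λ { 1st → trans (agents≡ 1st) (cong (if_then just (toAgent (frozen T 1st)) else nothing) (⌊⌋-false (T <? d 1st) (ℕ.≤⇒≯ d≤T₁)))
                      ; 2nd → trans (agents≡ 2nd) (cong (if_then just (toAgent (frozen T 2nd)) else nothing) (⌊⌋-false (T <? d 2nd) (ℕ.≤⇒≯ d≤T₂)))
                      ; 3rd → trans (agents≡ 3rd) (trans (cong (if_then just (toAgent (frozen T 3rd)) else nothing) (⌊⌋-true (T <? suc T) ℕ.≤-refl))
                                (cong (just ∘ toAgent) third)) }
        ; tokens≡ = λ v → trans (tokens≡ v) (trans
            (cong₂ _+_ (left 1st U₁ d≤T₁ home₁ v) (cong₂ _+_ (left 2nd U₂ d≤T₂ home₂ v) (cong (λ σ → tok σ v + 0) third)))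
            (sym (ℕ.+-identityʳ (tokens-left v))))
        ; marked≡ = marked≡
        ; outside = λ { 3rd _ e → avoids β (λ a → ℕ.≤-trans (boxβ a) G≤2G) T ℕ.≤-refl
                                   (trans (sym (Represents.pos≡ (rep 3rd T))) e) } }
        where
        open Superposed (superposed T ℕ.≤-refl (λ r r<T → quiet r (ℕ.<⇒≤ r<T)))
        third : frozen T 3rd ≡ sol 3rd T
        third = frozen-live T 3rd ℕ.≤-refl

      undisturbed-lone : ∀ s → Undisturbed onlyThird (lone s)
      undisturbed-lone s = record
        { unseen = λ { 3rd 1st _ _ → refl ; 3rd 2nd _ _ → refl ; 3rd 3rd _ h → ⊥-elim (h refl) }
        ; distinct = λ { 3rd 3rd _ _ h → ⊥-elim (h refl) } }

      lone-silent : ∀ s → Silent (witness s) → ∀ i → onlyThird i ≡ true → Silent (lone s i)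
      lone-silent s q 3rd _ = q

      lone-step : ∀ s → Superposed (run t placement (s + T)) onlyThird (lone s) → Silent (witness s) →
        pos (witness (suc s)) ≢ ι β → Superposed (run t placement (suc s + T)) onlyThird (lone (suc s))
      lone-step s sup q h = superposed-step sup (undisturbed-lone s) (lone-silent s q) advances
        where
        advances : ∀ i → Advances onlyThird onlyThird (lone s) (lone (suc s)) i
        advances 1st = inj₁ (refl , refl , refl)
        advances 2nd = inj₁ (refl , refl , refl)
        advances 3rd = inj₂ (refl , refl , inj₁ (refl , h))

      lone-dies : ∀ s → Superposed (run t placement (s + T)) onlyThird (lone s) → Silent (witness s) →
        pos (witness (suc s)) ≢ ι β
      lone-dies s sup q e = superposed-extinct {suc s + T} {λ _ → false} {lone (suc s)}
        (superposed-step sup (undisturbed-lone s) (lone-silent s q) advances) (λ _ → refl)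
        where
        advances : ∀ i → Advances onlyThird (λ _ → false) (lone s) (lone (suc s)) i
        advances 1st = inj₁ (refl , refl , refl)
        advances 2nd = inj₁ (refl , refl , refl)
        advances 3rd = inj₂ (refl , refl , inj₂ (refl , e))

      lone-danger : ∀ s e → Superposed (run t placement (s + T)) onlyThird (lone s) →
        Output.danger (response (witness s)) ≡ just e → Incident (ι β) (link (pos (witness s)) e)
      lone-danger s e sup eq = danger⇒incident {s + T} sup (undisturbed-lone s) 3rd e refl eq

    ambiguity : ∀ β β′ → (∀ a → ∣ β ! a ∣ ≤ G) → (∀ a → ∣ β′ ! a ∣ ≤ G) →
      Falls p₁ β E₁⁰ E₁ → Falls p₂ β E₂⁰ E₂ → Falls p₁ β′ E₁⁰ E₁ → Falls p₂ β′ E₂⁰ E₂ →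
      ∃[ a ] 2 < ∣ β ! a ℤ.- β′ ! a ∣ → ⊥
    ambiguity β β′ box box′ f₁ f₂ f₁′ f₂′ (a , distant) = W.not-unmarked T λ r T≤r →
        subst (λ r → ∀ l → W.Configuration.marked (W.run t W.placement r) l ≡ false) (ℕ.m∸n+n≡m T≤r)
          (W.Superposed.marked≡ (proj₁ (both (r ℕ.∸ T))))
      where
      module W = Case β box f₁ f₂
      module W′ = Case β′ box′ f₁′ f₂′
      Both : ℕ → Set
      Both s = W.Superposed (W.run t W.placement (s + T)) onlyThird (lone s)
             × W′.Superposed (W′.run t W′.placement (s + T)) onlyThird (lone s)
      silent : ∀ s → Both s → Silent (witness s)
      silent s (sup , sup′) = is-nothing λ danger → go (something danger)
        where
        go : ∃[ e ] Output.danger (response (witness s)) ≡ just e → ⊥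
        go (e , eq) = near (node-ι (pos (witness s)))
          where
          clash : ∀ z → ∃[ m ] β ≈ z ⊕ δ? m → ∃[ m ] β′ ≈ z ⊕ δ? m → ⊥
          clash z (m , x) (m′ , y) = ℕ.<⇒≱ distant (distance-bound {β} {β′} {z} {m} {m′} a (sym x) (sym y)
            (linear 6 (λ c g k x y n → c :+ 2 :* g :+ con 3 :≤ k ∷ x :≤ g ∷ y :≤ g ∷ 10 :* k :< n ∷ [] ⊢ x :+ y :+ con 2 :< n) refl
              C G K (∣ β ! a ∣) (∣ β′ ! a ∣) N large (box a) (box′ a) wide))
          near : ∃[ z ] pos (witness s) ≡ ι z → ⊥
          near (z , pos≡) = clash z
            (incident⇒≈ e (subst (λ v → Incident (ι β) (link v e)) pos≡ (W.lone-danger s e sup eq)))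
            (incident⇒≈ e (subst (λ v → Incident (ι β′) (link v e)) pos≡ (W′.lone-danger s e sup′ eq)))
      both : ∀ s → Both s
      both zero    = W.alone , W′.alone
      both (suc s) = let sup , sup′ = both s ; q = silent s (sup , sup′) in
        W.lone-step s sup q (W.lone-dies s sup q) , W′.lone-step s sup′ q (W′.lone-dies s sup′ q)

  -- Long tours and the scale of distances

  module Scale (oracle : ∀ x d → Dec (∃[ r ] path x d r ≈ 𝟎))
    (M : ℕ) (horizon≤M : minds * minds + minds ≤ M) (drift≤M : 2 * minds + 2 ≤ M) (turns≤M : 4 * minds ≤ M)
    (wide₄ : 10000 * (M * (M * (M * M))) < N) where

    m₂ m₃ m₄ : ℕ
    m₂ = M * M
    m₃ = M * m₂
    m₄ = M * m₃

    c≤M : minds ≤ M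
    c≤M = linear 2 (λ c m → 2 :* c :+ con 2 :≤ m ∷ [] ⊢ c :≤ m) refl minds M drift≤M

    2≤M : 2 ≤ M
    2≤M = linear 2 (λ c m → 2 :* c :+ con 2 :≤ m ∷ [] ⊢ con 2 :≤ m) refl minds M drift≤M

    M≤m₂ : M ≤ m₂
    M≤m₂ = subst (_≤ m₂) (ℕ.*-identityʳ M) (ℕ.*-monoʳ-≤ M (ℕ.≤-trans (s≤s z≤n) 2≤M))

    m₂≤m₃ : m₂ ≤ m₃
    m₂≤m₃ = subst (_≤ m₃) (ℕ.*-identityˡ m₂) (ℕ.*-monoˡ-≤ m₂ (ℕ.≤-trans (s≤s z≤n) 2≤M))

    m₃≤m₄ : m₃ ≤ m₄
    m₃≤m₄ = subst (_≤ m₄) (ℕ.*-identityˡ m₃) (ℕ.*-monoˡ-≤ m₃ (ℕ.≤-trans (s≤s z≤n) 2≤M))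

    wide : 10000 * m₃ < N
    wide = ℕ.≤-<-trans (ℕ.*-monoʳ-≤ 10000 m₃≤m₄) wide₄

    Straight : Coord → Mind → Direction → Set
    Straight a x d = v ! other a ≡ 0ℤ × ∀ r → h ≤ r → path x d r ! other a ≡ 0ℤ
      where open Walk (walk x d)

    Run : Coord → ℕ → Set
    Run a k = ∃[ x ] ∃[ d ] (Tour oracle k x d × Walk.Long (walk x d) × Walk.v (walk x d) ! other a ≡ 0ℤ)

    siteᵢ : ℕ → ℤ²
    siteᵢ = site oracle

    at-time : ℕ → ℕ
    at-time = moment oracle

    -- `tame` concerns offsets from the token and `aligned` the sites of the token. Together they
    -- put the late parts of all long tours so far into one row and one column.
    record History (i : ℕ) : Set where
      field
        i≤M     : i ≤ M
        reached : Reached oracle i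
        tame    : ∀ k x d → k < i → Tour oracle k x d → Walk.Long (walk x d) → ∃[ a ] Straight a x d
        aligned : ∀ a k l → k < i → l < i → Run a k → Run a l → siteᵢ k ! other a ≡ siteᵢ l ! other a

    h≤M : ∀ x d → Walk.h (walk x d) ≤ M
    h≤M x d = ℕ.≤-trans (ℕ.≤-trans (ℕ.m≤m+n h p) h+p≤c) c≤M
      where open Walk (walk x d)

    small-site : ∀ {i} → i ≤ M → ∀ a → ∣ siteᵢ i ! a ∣ ≤ M
    small-site {i} h a = ℕ.≤-trans (site-bound oracle i a) h

    -- After q steps the offset is at most q + 1 in each coordinate, too short to wind around the
    -- torus; a return would be a return in the plane.
    long-gone : ∀ {x d} → Walk.Long (walk x d) → ∀ q → suc q < N → path x d q ≉ 𝟎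
    long-gone {x} {d} long q q<N e = Walk.long-never-returns (walk x d) long q (vec≡ λ a →
      ≈-small a e (subst (λ z → ∣ path x d q ! a ∣ + ∣ z ∣ < N) (sym (𝟎! a))
        (subst (_< N) (sym (ℕ.+-identityʳ _)) (ℕ.≤-<-trans (Walk.bound (walk x d) q a) q<N))))

    -- The box contains the meetings, the short tours, and also the first steps of long tours,
    -- before these become periodic.
    Spot : ℕ → ℕ → Set
    Spot i s = ((∀ a → ∣ ω s ! a ∣ ≤ M) × (∀ a → ∣ π s ! a ∣ ≤ 2 * M))
             ⊎ (∃[ a ] ∃[ k ] (k < i × Run a k × ω s ! other a ≡ 0ℤ × π s ! other a ≡ siteᵢ k ! other a))

    module _ {i : ℕ} (H : History i) where
      open History H

      resting : ∀ {s k} → k ≤ M → cfg s ≡ met (meeting oracle k) (siteᵢ k) → Spot i s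
      resting {s} {k} k≤M e = inj₁
        ( (λ a → subst (λ z → ∣ z ! a ∣ ≤ M) (sym (cong offset e)) (subst (λ z → ∣ z ∣ ≤ M) (sym (𝟎! a)) z≤n))
        , (λ a → subst (λ z → ∣ z ! a ∣ ≤ 2 * M) (sym (trans (cong place e) (⊕-identityʳ (siteᵢ k))))
                   (ℕ.≤-trans (small-site k≤M a) (ℕ.m≤m+n M (M + 0)))) )

      roaming : ∀ {s k} x d q → k < i → Tour oracle k x d → Gone oracle x d q →
        ω s ≡ path x d q → π s ≡ siteᵢ k ⊕ path x d q → Spot i s
      roaming {s} {k} x d q k<i T absent ω≡ π≡ = go long?
        where
        open Walk (walk x d)
        near : (∀ a → ∣ path x d q ! a ∣ ≤ M) → Spot i s
        near small = inj₁
          ( (λ a → subst (λ z → ∣ z ! a ∣ ≤ M) (sym ω≡) (small a))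
          , (λ a → subst (λ z → ∣ z ! a ∣ ≤ 2 * M) (sym π≡)
              (linear 4 (λ m x y z → x :≤ m ∷ y :≤ m ∷ z :≤ x :+ y ∷ [] ⊢ z :≤ 2 :* m) refl M (∣ siteᵢ k ! a ∣)
                (∣ path x d q ! a ∣) (∣ (siteᵢ k ⊕ path x d q) ! a ∣) (small-site (ℕ.≤-trans (ℕ.<⇒≤ k<i) i≤M) a) (small a)
                (proj₁ (⊕-size (siteᵢ k) (path x d q) a)))) )
        go : Dec Long → Spot i s
        go (no short) = near (λ a → ℕ.≤-trans (short-bound short q (λ r r≤q e → absent r r≤q (cong ι e)) a) horizon≤M)
        go (yes long) with h ℕ.≤? q
        ... | no early = near (λ a → ℕ.≤-trans (bound q a) (ℕ.≤-trans (ℕ.≰⇒> early)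
                           (h≤M x d)))
        ... | yes late with tame k x d k<i T long
        ...   | a , v≡0 , flat = inj₂ (a , k , k<i , (x , d , T , long , v≡0)
                  , trans (cong (_! other a) ω≡) (flat q late)
                  , trans (cong (_! other a) π≡) (trans (!-⊕ (siteᵢ k) (path x d q) (other a))
                      (trans (cong (λ z → siteᵢ k ! other a ℤ.+ z) (flat q late)) (ℤ.+-identityʳ _))))

      spot : ∀ s → s ≤ at-time i → Spot i s
      spot s s≤ with ℕ.m≤n⇒m<n∨m≡n s≤
      ... | inj₂ refl = resting {s} {i} i≤M (visited oracle i reached)
      ... | inj₁ s< with phases oracle i reached s s<
      ...   | k , k<i , meets e = resting {s} {k} (ℕ.≤-trans (ℕ.<⇒≤ k<i) i≤M) e
      ...   | k , k<i , tours x d q T absent _ e = roaming {s} {k} x d q k<i T absent (cong offset e) (cong place e)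

    unlike : ∀ a {z w} → ∣ z ! a ∣ ≤ 2 * M → 5 * M < ∣ w ! a ∣ → ∣ w ! a ∣ ≤ 1000 * m₃ → z ≉ w
    unlike a {z} {w} z≤ w> w≤ e = ℕ.<-irrefl (cong ∣_∣ (≈-small a e
      (linear 6 (λ m m₂ m₃ n z w → z :≤ 2 :* m ∷ w :≤ 1000 :* m₃ ∷ m :≤ m₂ ∷ m₂ :≤ m₃ ∷ 10000 :* m₃ :< n ∷ [] ⊢ z :+ w :< n) refl
        M m₂ m₃ N (∣ z ! a ∣) (∣ w ! a ∣) z≤ w≤ M≤m₂ m₂≤m₃ wide)))
      (linear 3 (λ m z w → z :≤ 2 :* m ∷ 5 :* m :< w ∷ [] ⊢ z :< w) refl M (∣ z ! a ∣) (∣ w ! a ∣) z≤ w>)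

    ≈-move : ∀ {p z q} → p ⊕ z ≈ q → z ≈ q ⊖ p
    ≈-move {p} {z} {q} e = ≈-cancelˡ p (trans e (cong ι (sym (⊕-inverse q p))))

    -- The numerical factors only have to be far enough apart.
    R R′ G C K : ℕ
    R  = 104 * m₃
    R′ = 14 * m₂
    G  = 130 * m₃
    C  = 200 * m₃
    K  = 600 * m₃

    M≤G : M ≤ G
    M≤G = linear 3 (λ m m₂ m₃ → m :≤ m₂ ∷ m₂ :≤ m₃ ∷ [] ⊢ m :≤ 130 :* m₃) refl M m₂ m₃ M≤m₂ m₂≤m₃

    box𝟎 : ∀ a → ∣ 𝟎 ! a ∣ ≤ G
    box𝟎 a = subst (λ z → ∣ z ∣ ≤ G) (sym (𝟎! a)) z≤n

    ≤2M : ∀ {n} → n ≤ M → n ≤ 2 * M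
    ≤2M h = ℕ.≤-trans h (ℕ.m≤m+n M (M + 0))

    above : ∀ {n} → 80 * m₂ ≤ n → 5 * M < n
    above {n} = linear 3 (λ m m₂ n → con 2 :≤ m ∷ m :≤ m₂ ∷ 80 :* m₂ :≤ n ∷ [] ⊢ 5 :* m :< n) refl M m₂ n 2≤M M≤m₂

    below : ∀ {n} → n ≤ 125 * m₃ → n ≤ 1000 * m₃
    below h = ℕ.≤-trans h (ℕ.*-monoˡ-≤ m₃ (ℕ.m≤m+n 125 875))

    shifted : ∀ z w a → ∣ z ! a ∣ ≤ M → ∣ (z ⊕ w) ! a ∣ ≤ M + ∣ w ! a ∣ × ∣ w ! a ∣ ≤ ∣ (z ⊕ w) ! a ∣ + M
    shifted z w a h = ℕ.≤-trans (proj₁ (⊕-size z w a)) (ℕ.+-monoˡ-≤ ∣ w ! a ∣ h)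
                    , ℕ.≤-trans (proj₂ (proj₂ (⊕-size z w a))) (ℕ.+-monoʳ-≤ ∣ (z ⊕ w) ! a ∣ h)

    shifted-above : ∀ z w a → ∣ z ! a ∣ ≤ M → 10 * M ≤ ∣ w ! a ∣ + M → 5 * M < ∣ (z ⊕ w) ! a ∣
    shifted-above z w a h far = linear 3 (λ m x y → 10 :* m :≤ x :+ m ∷ x :≤ y :+ m ∷ con 2 :≤ m ∷ [] ⊢ 5 :* m :< y) refl
      M (∣ w ! a ∣) (∣ (z ⊕ w) ! a ∣) far (proj₂ (shifted z w a h)) 2≤M

    shifted-below : ∀ z w a → ∣ z ! a ∣ ≤ M → ∣ w ! a ∣ ≤ 120 * m₃ → ∣ (z ⊕ w) ! a ∣ ≤ 1000 * m₃
    shifted-below z w a h near = linear 5 (λ m m₂ m₃ x y → x :≤ 120 :* m₃ ∷ y :≤ m :+ x ∷ m :≤ m₂ ∷ m₂ :≤ m₃ ∷ [] ⊢ y :≤ 1000 :* m₃) refl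
      M m₂ m₃ (∣ w ! a ∣) (∣ (z ⊕ w) ! a ∣) near (proj₁ (shifted z w a h)) M≤m₂ m₂≤m₃

    shifted-box : ∀ z w a → ∣ z ! a ∣ ≤ M → ∣ w ! a ∣ ≤ 15 * m₂ → ∣ (z ⊕ w) ! a ∣ ≤ G
    shifted-box z w a h near = linear 5 (λ m m₂ m₃ x y → x :≤ 15 :* m₂ ∷ y :≤ m :+ x ∷ m :≤ m₂ ∷ m₂ :≤ m₃ ∷ [] ⊢ y :≤ 130 :* m₃) refl
      M m₂ m₃ (∣ w ! a ∣) (∣ (z ⊕ w) ! a ∣) near (proj₁ (shifted z w a h)) M≤m₂ m₂≤m₃

    far-enough : ∀ {n} → 100 * m₂ ≤ n + M → 10 * M ≤ n + M
    far-enough h = ℕ.≤-trans (ℕ.*-mono-≤ (ℕ.m≤m+n 10 90) M≤m₂) h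

    short-of : ∀ a {z w} → ∣ z ! a ∣ ≤ 15 * m₂ → 80 * m₂ ≤ ∣ w ! a ∣ → ∣ w ! a ∣ ≤ 125 * m₃ → z ≉ w
    short-of a {z} {w} z≤ w≥ w≤ e = ℕ.<-irrefl (cong ∣_∣ (≈-small a e
      (linear 5 (λ m₂ m₃ n x y → x :≤ 15 :* m₂ ∷ m₂ :≤ m₃ ∷ y :≤ 125 :* m₃ ∷ 10000 :* m₃ :< n ∷ [] ⊢ x :+ y :< n) refl
        m₂ m₃ N (∣ z ! a ∣) (∣ w ! a ∣) z≤ m₂≤m₃ w≤ wide)))
      (linear 4 (λ m m₂ x y → x :≤ 15 :* m₂ ∷ 80 :* m₂ :≤ y ∷ con 2 :≤ m ∷ m :≤ m₂ ∷ [] ⊢ x :< y) refl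
        M m₂ (∣ z ! a ∣) (∣ w ! a ∣) z≤ w≥ 2≤M M≤m₂)

    large : C + 2 * G + 3 ≤ K
    large = linear 3 (λ m m₂ m₃ → con 2 :≤ m ∷ m :≤ m₂ ∷ m₂ :≤ m₃ ∷ [] ⊢ 200 :* m₃ :+ 2 :* (130 :* m₃) :+ con 3 :≤ 600 :* m₃) refl
      M m₂ m₃ 2≤M M≤m₂ m₂≤m₃

    wideK : 10 * K < N
    wideK = linear 2 (λ m₃ n → 10000 :* m₃ :< n ∷ [] ⊢ 10 :* (600 :* m₃) :< n) refl m₃ N wide

    module Trip (j : ℕ) (H : History j) (x : Mind) (d : Direction) (T : Tour oracle j x d)
                (long : Walk.Long (walk x d)) where

      open Walk (walk x d) public

      still-gone : Gone oracle x d R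
      still-gone r r≤R = long-gone {x} {d} long r
        (linear 5 (λ m m₂ m₃ n r → r :≤ 104 :* m₃ ∷ con 2 :≤ m ∷ m :≤ m₂ ∷ m₂ :≤ m₃ ∷ 10000 :* m₃ :< n ∷ [] ⊢ con 1 :+ r :< n) refl
          M m₂ m₃ N r r≤R 2≤M M≤m₂ m₂≤m₃ wide)

      during : ∀ q → q ≤ R → cfg (q + suc (at-time j)) ≡ away (freely x q) (siteᵢ j) (path x d q)
      during q q≤R = touring oracle j x d T (visited oracle j (History.reached H)) q
        (λ r r≤q → still-gone r (ℕ.≤-trans r≤q q≤R))

      After : ℕ → ℕ → Set
      After s q = s ≡ q + suc (at-time j) × cfg s ≡ away (freely x q) (siteᵢ j) (path x d q)

      later : ∀ s E → E ≤ R → at-time j < s → s ≤ E + suc (at-time j) → ∃[ q ] (q ≤ E × After s q)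
      later s E E≤R before s≤ = q , q≤E , s≡ , trans (cong cfg s≡) (during q (ℕ.≤-trans q≤E E≤R))
        where
        q : ℕ
        q = s ℕ.∸ suc (at-time j)
        s≡ : s ≡ q + suc (at-time j)
        s≡ = sym (ℕ.m∸n+n≡m before)
        q≤E : q ≤ E
        q≤E = ℕ.+-cancelʳ-≤ (suc (at-time j)) q E (subst (_≤ E + suc (at-time j)) s≡ s≤)

      lost : ∀ E → E ≤ R → LeavesToken (siteᵢ j) (at-time j) (E + suc (at-time j))
      lost E E≤R s before s≤ = let _ , _ , _ , e = later s E E≤R before s≤ in cong home e , cong carried e

      index-bound : ∀ k q b → q < h + p → k ≤ b → k * p + q ≤ b * M + M
      index-bound k q b q< k≤ = ℕ.+-mono-≤ (ℕ.*-mono-≤ k≤ (ℕ.≤-trans (ℕ.≤-trans (ℕ.m≤n+m p h) h+p≤c) c≤M))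
        (ℕ.≤-trans (ℕ.<⇒≤ q<) (ℕ.≤-trans h+p≤c c≤M))

      lap-index≤R : ∀ k q → q < h + p → k ≤ 103 * m₂ → k * p + q ≤ R
      lap-index≤R k q q< k≤ = ℕ.≤-trans (index-bound k q (103 * m₂) q< k≤)
        (linear 4 (λ m m₂ m₃ x → x :≡ 103 :* m₃ ∷ m :≤ m₂ ∷ m₂ :≤ m₃ ∷ [] ⊢ x :+ m :≤ 104 :* m₃) refl M m₂ m₃ (103 * m₂ * M)
          (trans (ℕ.*-assoc 103 m₂ M) (cong (103 *_) (ℕ.*-comm m₂ M))) M≤m₂ m₂≤m₃)

      lap-index≤R′ : ∀ k q → q < h + p → k ≤ 13 * M → k * p + q ≤ R′
      lap-index≤R′ k q q< k≤ = ℕ.≤-trans (index-bound k q (13 * M) q< k≤)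
        (linear 3 (λ m m₂ x → x :≡ 13 :* m₂ ∷ m :≤ m₂ ∷ [] ⊢ x :+ m :≤ 14 :* m₂) refl M m₂ (13 * M * M) (ℕ.*-assoc 13 M M) M≤m₂)

      R′≤R : R′ ≤ R
      R′≤R = linear 2 (λ m₂ m₃ → m₂ :≤ m₃ ∷ [] ⊢ 14 :* m₂ :≤ 104 :* m₃) refl m₂ m₃ m₂≤m₃

      path≤R : ∀ q a → q ≤ R → ∣ path x d q ! a ∣ ≤ 105 * m₃
      path≤R q a q≤R = linear 5 (λ m m₂ m₃ q z → q :≤ 104 :* m₃ ∷ z :≤ con 1 :+ q ∷ con 2 :≤ m ∷ m :≤ m₂ ∷ m₂ :≤ m₃ ∷ [] ⊢ z :≤ 105 :* m₃) refl
        M m₂ m₃ q (∣ path x d q ! a ∣) q≤R (bound q a) 2≤M M≤m₂ m₂≤m₃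

      path≤R′ : ∀ q a → q ≤ R′ → ∣ path x d q ! a ∣ ≤ 15 * m₂
      path≤R′ q a q≤R = linear 4 (λ m m₂ q z → q :≤ 14 :* m₂ ∷ z :≤ con 1 :+ q ∷ con 2 :≤ m ∷ m :≤ m₂ ∷ [] ⊢ z :≤ 15 :* m₂) refl
        M m₂ q (∣ path x d q ! a ∣) q≤R (bound q a) 2≤M M≤m₂

      early-small : ∀ q a → q < h → ∣ path x d q ! a ∣ ≤ M
      early-small q a q<h = ℕ.≤-trans (bound q a) (ℕ.≤-trans q<h (h≤M x d))

      far-out : ∀ a → v ! a ≢ 0ℤ → ∀ k q → h ≤ q → q < h + p → k ≤ ∣ path x d (k * p + q) ! a ∣ + M
      far-out a va≢0 k q h≤q q< = ℕ.≤-trans (growth a va≢0 k q h≤q q<) (ℕ.+-monoʳ-≤ _ c≤M)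

      bandsω : ∀ s → s ≤ R + suc (at-time j) → ∃[ a ] ∣ ω s ! a ∣ ≤ C
      bandsω s s≤ = go (s ℕ.≤? at-time j)
        where
        rest : Spot j s → ∃[ a ] ∣ ω s ! a ∣ ≤ C
        rest (inj₁ (box , _)) = X , ℕ.≤-trans (box X)
          (linear 3 (λ m m₂ m₃ → m :≤ m₂ ∷ m₂ :≤ m₃ ∷ [] ⊢ m :≤ 200 :* m₃) refl M m₂ m₃ M≤m₂ m₂≤m₃)
        rest (inj₂ (a , k , _ , _ , e , _)) = other a , subst (λ z → ∣ z ∣ ≤ C) (sym e) z≤n
        go : Dec (s ≤ at-time j) → ∃[ a ] ∣ ω s ! a ∣ ≤ C
        go (yes before) = rest (spot H s before)
        go (no after)   = let q , q≤R , _ , e = later s R ℕ.≤-refl (ℕ.≰⇒> after) s≤ in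
          X , subst (λ z → ∣ z ! X ∣ ≤ C) (sym (cong offset e))
            (ℕ.≤-trans (path≤R q X q≤R) (ℕ.*-monoˡ-≤ m₃ (ℕ.m≤m+n 105 95)))

      bandsπ : ∀ s → s ≤ R + suc (at-time j) → ∃[ a ] ∣ π s ! a ∣ ≤ C
      bandsπ s s≤ = go (s ℕ.≤? at-time j)
        where
        rest : Spot j s → ∃[ a ] ∣ π s ! a ∣ ≤ C
        rest (inj₁ (_ , box)) = X , ℕ.≤-trans (box X)
          (linear 3 (λ m m₂ m₃ → m :≤ m₂ ∷ m₂ :≤ m₃ ∷ [] ⊢ 2 :* m :≤ 200 :* m₃) refl M m₂ m₃ M≤m₂ m₂≤m₃)
        rest (inj₂ (a , k , k<j , _ , _ , e)) = other a , subst (λ z → ∣ z ∣ ≤ C) (sym e)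
          (ℕ.≤-trans (small-site (ℕ.≤-trans (ℕ.<⇒≤ k<j) (History.i≤M H)) (other a))
            (linear 3 (λ m m₂ m₃ → m :≤ m₂ ∷ m₂ :≤ m₃ ∷ [] ⊢ m :≤ 200 :* m₃) refl M m₂ m₃ M≤m₂ m₂≤m₃))
        go : Dec (s ≤ at-time j) → ∃[ a ] ∣ π s ! a ∣ ≤ C
        go (yes before) = rest (spot H s before)
        go (no after)   = let q , q≤R , _ , e = later s R ℕ.≤-refl (ℕ.≰⇒> after) s≤ in
          X , subst (λ z → ∣ z ! X ∣ ≤ C) (sym (cong place e))
            (linear 6 (λ m m₂ m₃ x y z → x :≤ m ∷ y :≤ 105 :* m₃ ∷ z :≤ x :+ y ∷ m :≤ m₂ ∷ m₂ :≤ m₃ ∷ [] ⊢ z :≤ 200 :* m₃) refl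
              M m₂ m₃ (∣ siteᵢ j ! X ∣) (∣ path x d q ! X ∣) (∣ (siteᵢ j ⊕ path x d q) ! X ∣)
              (small-site (History.i≤M H) X) (path≤R q X q≤R) (proj₁ (⊕-size (siteᵢ j) (path x d q) X)) M≤m₂ m₂≤m₃)

    -- Two deaths on a skew tour

    -- Two agents die on the j-th tour, the first of its direction, in two of its phases.
    module SkewKill (j : ℕ) (H : History j) (x : Mind) (d : Direction) (T : Tour oracle j x d)
                (long : Walk.Long (walk x d))
                (fresh : ∀ a k → k < j → Run a k → Walk.v (walk x d) ! other a ≢ 0ℤ)
                (r₁ r₂ : ℕ) (h≤r₁ : Walk.h (walk x d) ≤ r₁) (r₁< : r₁ < Walk.h (walk x d) + Walk.p (walk x d))
                (h≤r₂ : Walk.h (walk x d) ≤ r₂) (r₂< : r₂ < Walk.h (walk x d) + Walk.p (walk x d))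
                (skew : ∀ r → Walk.h (walk x d) ≤ r →
                   Walk.D (walk x d) (path x d r) ≢ Walk.D (walk x d) (path x d r₁) ℤ.- Walk.D (walk x d) (path x d r₂)) where

      open Trip j H x d T long

      site≤ : ∀ a → ∣ siteᵢ j ! a ∣ ≤ M
      site≤ = small-site (History.i≤M H)

      -- Agent 1 makes of the order of M² laps, agent 2 only of the order of M. Agent 2 therefore
      -- dies too early to come near the token of agent 1.
      index₁ index₂ : ℕ → ℕ
      index₁ e = (100 * m₂ + e) * p + r₁
      index₂ e = (10 * M + e) * p + r₂

      f₁ f₂ β : ℕ → ℤ²
      f₁ e = path x d (index₁ e)
      f₂ e = path x d (index₂ e)
      β e  = siteᵢ j ⊕ f₂ e

      -- The difference makes phase `r₁` of agent 1 and phase `r₂` of agent 2 end at the same node;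
      -- e further laps of both shift this node by e times the common drift.
      p₁ p₂ : ℤ²
      p₁ = f₂ 0 ⊖ f₁ 0
      p₂ = 𝟎

      index₁≤ : ∀ e → e ≤ 3 → index₁ e ≤ R
      index₁≤ e e≤3 = lap-index≤R _ r₁ r₁< (linear 3 (λ m m₂ e → e :≤ con 3 ∷ con 2 :≤ m ∷ m :≤ m₂ ∷ [] ⊢ 100 :* m₂ :+ e :≤ 103 :* m₂) refl
        M m₂ e e≤3 2≤M M≤m₂)

      index₂≤ : ∀ e → e ≤ 3 → index₂ e ≤ R′
      index₂≤ e e≤3 = lap-index≤R′ _ r₂ r₂< (linear 2 (λ m e → e :≤ con 3 ∷ con 2 :≤ m ∷ [] ⊢ 10 :* m :+ e :≤ 13 :* m) refl
        M e e≤3 2≤M)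

      f₁≤ : ∀ e → e ≤ 3 → ∀ a → ∣ f₁ e ! a ∣ ≤ 105 * m₃
      f₁≤ e e≤3 a = path≤R (index₁ e) a (index₁≤ e e≤3)

      f₂≤ : ∀ e → e ≤ 3 → ∀ a → ∣ f₂ e ! a ∣ ≤ 15 * m₂
      f₂≤ e e≤3 a = path≤R′ (index₂ e) a (index₂≤ e e≤3)

      f₁≥ : ∀ e a → v ! a ≢ 0ℤ → 100 * m₂ ≤ ∣ f₁ e ! a ∣ + M
      f₁≥ e a va = ℕ.≤-trans (ℕ.m≤m+n (100 * m₂) e) (far-out a va (100 * m₂ + e) r₁ h≤r₁ r₁<)

      f₂≥ : ∀ e a → v ! a ≢ 0ℤ → 10 * M ≤ ∣ f₂ e ! a ∣ + M
      f₂≥ e a va = ℕ.≤-trans (ℕ.m≤m+n (10 * M) e) (far-out a va (10 * M + e) r₂ h≤r₂ r₂<)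

      target₁ : ∀ e → p₁ ⊕ (siteᵢ j ⊕ f₁ e) ≡ β e
      target₁ e = begin
        f₂ 0 ⊖ f₁ 0 ⊕ (siteᵢ j ⊕ f₁ e)
          ≡⟨ cong₂ (λ z w → f₂ 0 ⊖ z ⊕ (siteᵢ j ⊕ w)) (laps (100 * m₂ + 0) r₁ h≤r₁) (laps (100 * m₂ + e) r₁ h≤r₁) ⟩
        f₂ 0 ⊖ (path x d r₁ ⊕ + (100 * m₂ + 0) ⊛ v) ⊕ (siteᵢ j ⊕ (path x d r₁ ⊕ + (100 * m₂ + e) ⊛ v))
          ≡⟨ cong (λ z → z ⊖ (path x d r₁ ⊕ + (100 * m₂ + 0) ⊛ v) ⊕ (siteᵢ j ⊕ (path x d r₁ ⊕ + (100 * m₂ + e) ⊛ v)))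
               (laps (10 * M + 0) r₂ h≤r₂) ⟩
        path x d r₂ ⊕ + (10 * M + 0) ⊛ v ⊖ (path x d r₁ ⊕ + (100 * m₂ + 0) ⊛ v) ⊕ (siteᵢ j ⊕ (path x d r₁ ⊕ + (100 * m₂ + e) ⊛ v))
          ≡⟨ cong₂ _,_ (scalar (path x d r₂ ! X) (path x d r₁ ! X) (siteᵢ j ! X) (+ (10 * M)) (+ (100 * m₂)) (+ e) (v ! X))
                       (scalar (path x d r₂ ! Y) (path x d r₁ ! Y) (siteᵢ j ! Y) (+ (10 * M)) (+ (100 * m₂)) (+ e) (v ! Y)) ⟩
        siteᵢ j ⊕ (path x d r₂ ⊕ + (10 * M + e) ⊛ v)
          ≡⟨ cong (siteᵢ j ⊕_) (laps (10 * M + e) r₂ h≤r₂) ⟨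
        β e ∎
        where
        open ≡-Reasoning
        scalar : ∀ b a u k₂ k₁ e v → b ℤ.+ (k₂ ℤ.+ 0ℤ) ℤ.* v ℤ.- (a ℤ.+ (k₁ ℤ.+ 0ℤ) ℤ.* v) ℤ.+ (u ℤ.+ (a ℤ.+ (k₁ ℤ.+ e) ℤ.* v))
                 ≡ u ℤ.+ (b ℤ.+ (k₂ ℤ.+ e) ℤ.* v)
        scalar = solve-∀

      p₁≤ : ∀ a → ∣ p₁ ! a ∣ ≤ 125 * m₃
      p₁≤ a = subst (λ z → ∣ z ∣ ≤ 125 * m₃) (sym (!-⊖ (f₂ 0) (f₁ 0) a))
        (linear 5 (λ m₂ m₃ x y z → x :≤ 15 :* m₂ ∷ y :≤ 105 :* m₃ ∷ m₂ :≤ m₃ ∷ z :≤ x :+ y ∷ [] ⊢ z :≤ 125 :* m₃) refl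
          m₂ m₃ (∣ f₂ 0 ! a ∣) (∣ f₁ 0 ! a ∣) (∣ f₂ 0 ! a ℤ.- f₁ 0 ! a ∣) (f₂≤ 0 z≤n a) (f₁≤ 0 z≤n a) m₂≤m₃
          (ℤ.∣i-j∣≤∣i∣+∣j∣ (f₂ 0 ! a) (f₁ 0 ! a)))

      p₁≥ : ∀ a → v ! a ≢ 0ℤ → 80 * m₂ ≤ ∣ p₁ ! a ∣
      p₁≥ a va = subst (λ z → 80 * m₂ ≤ ∣ z ∣) (sym (!-⊖ (f₂ 0) (f₁ 0) a))
        (linear 5 (λ m m₂ x y z → x :≤ 15 :* m₂ ∷ 100 :* m₂ :≤ y :+ m ∷ m :≤ m₂ ∷ y :≤ x :+ z ∷ [] ⊢ 80 :* m₂ :≤ z) refl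
          M m₂ (∣ f₂ 0 ! a ∣) (∣ f₁ 0 ! a ∣) (∣ f₂ 0 ! a ℤ.- f₁ 0 ! a ∣) (f₂≤ 0 z≤n a) (f₁≥ 0 a va) M≤m₂
          (subst (λ w → ∣ w ∣ ≤ ∣ f₂ 0 ! a ∣ + ∣ f₂ 0 ! a ℤ.- f₁ 0 ! a ∣) (lemma (f₂ 0 ! a) (f₁ 0 ! a))
            (ℤ.∣i-j∣≤∣i∣+∣j∣ (f₂ 0 ! a) (f₂ 0 ! a ℤ.- f₁ 0 ! a))))
        where
        lemma : ∀ x y → x ℤ.- (x ℤ.- y) ≡ y
        lemma = solve-∀

      -- Far out in each coordinate in which v drifts, yet too close to wrap around. By `fresh`, v
      -- drifts across the line of every earlier long tour, so such a vector is on none of these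
      -- lines.
      Remote : ℤ² → Set
      Remote w = (∀ a → v ! a ≢ 0ℤ → 5 * M < ∣ w ! a ∣) × (∀ a → ∣ w ! a ∣ ≤ 1000 * m₃)

      remote-unlike : ∀ w → Remote w → ∀ s → s ≤ at-time j → ω s ≉ w × π s ≉ w
      remote-unlike w (low , high) s before = go (spot H s before)
        where
        b : Coord
        b = proj₁ (nonzero-coordinate (proj₁ long))
        vb≢0 : v ! b ≢ 0ℤ
        vb≢0 = proj₂ (nonzero-coordinate (proj₁ long))
        go : Spot j s → ω s ≉ w × π s ≉ w
        go (inj₁ (boxω , boxπ)) = unlike b (≤2M (boxω b)) (low b vb≢0) (high b) , unlike b (boxπ b) (low b vb≢0) (high b)
        go (inj₂ (a , k , k<j , run , ω≡ , π≡)) =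
            unlike (other a) (subst (λ z → ∣ z ∣ ≤ 2 * M) (sym ω≡) z≤n) (low (other a) (fresh a k k<j run)) (high (other a))
          , unlike (other a) (subst (λ z → ∣ z ∣ ≤ 2 * M) (sym π≡)
              (≤2M (small-site (ℕ.≤-trans (ℕ.<⇒≤ k<j) (History.i≤M H)) (other a))))
              (low (other a) (fresh a k k<j run)) (high (other a))

      -p₁ : ℤ²
      -p₁ = 𝟎 ⊖ p₁

      remote-p₁ : Remote p₁
      remote-p₁ = (λ a va → above (p₁≥ a va)) , (λ a → below (p₁≤ a))

      remote-minus : Remote -p₁
      remote-minus = (λ a va → subst (5 * M <_) (sym (∣negated∣ p₁ a)) (above (p₁≥ a va)))
                   , (λ a → subst (_≤ 1000 * m₃) (sym (∣negated∣ p₁ a)) (below (p₁≤ a)))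

      remote-f₁ : ∀ e → e ≤ 3 → Remote (siteᵢ j ⊕ f₁ e)
      remote-f₁ e e≤3 = (λ a va → shifted-above (siteᵢ j) (f₁ e) a (site≤ a) (far-enough (f₁≥ e a va)))
                      , (λ a → shifted-below (siteᵢ j) (f₁ e) a (site≤ a) (ℕ.≤-trans (f₁≤ e e≤3 a) (ℕ.*-monoˡ-≤ m₃ (ℕ.m≤m+n 105 15))))

      remote-β : ∀ e → e ≤ 3 → Remote (β e)
      remote-β e e≤3 = (λ a va → shifted-above (siteᵢ j) (f₂ e) a (site≤ a) (f₂≥ e a va))
                     , (λ a → shifted-below (siteᵢ j) (f₂ e) a (site≤ a) (ℕ.≤-trans (f₂≤ e e≤3 a) (ℕ.*-mono-≤ (ℕ.m≤m+n 15 105) m₂≤m₃)))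

      E₁ E₂ : ℕ
      E₁ = R + suc (at-time j)
      E₂ = R′ + suc (at-time j)

      falls₁ : ∀ e → e ≤ 3 → Falls p₁ (β e) (at-time j) E₁
      falls₁ e e≤3 = record
        { time = index₁ e + suc (at-time j) ; time≤ = ℕ.+-monoˡ-≤ (suc (at-time j)) (index₁≤ e e≤3)
        ; visit = cong ι (trans (cong (λ α → p₁ ⊕ place α) (during (index₁ e) (index₁≤ e e≤3))) (target₁ e))
        ; unseen = λ s before h → proj₂ (remote-unlike (siteᵢ j ⊕ f₁ e) (remote-f₁ e e≤3) s before)
            (≈-cancelˡ p₁ (trans h (cong ι (sym (target₁ e))))) }

      falls₂ : ∀ e → e ≤ 3 → Falls p₂ (β e) (at-time j) E₂
      falls₂ e e≤3 = record
        { time = index₂ e + suc (at-time j) ; time≤ = ℕ.+-monoˡ-≤ (suc (at-time j)) (index₂≤ e e≤3)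
        ; visit = cong ι (trans (⊕-identityˡ _) (cong place (during (index₂ e) (ℕ.≤-trans (index₂≤ e e≤3) R′≤R))))
        ; unseen = λ s before h → proj₂ (remote-unlike (β e) (remote-β e e≤3) s before)
            (trans (cong ι (sym (⊕-identityˡ (π s)))) h) }

      -- To meet the token of agent 2, agent 1 needs the offset `-p₁`. Its level is the difference
      -- of the levels of the two phases, which `skew` excludes at all late times; before, the
      -- offset is too small or lies on an old line.
      offset₁₂ : ∀ s → s ≤ E₁ → ω s ≉ -p₁
      offset₁₂ s s≤ h = go (s ℕ.≤? at-time j)
        where
        contradiction : ∃[ q ] (q ≤ R × After s q) → ⊥
        contradiction (q , q≤R , _ , e) = decide (Walk.h (walk x d) ℕ.≤? q)
          where
          path≈ : path x d q ≈ -p₁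
          path≈ = subst (_≈ -p₁) (cong offset e) h
          path≡ : path x d q ≡ -p₁
          path≡ = vec≡ λ a → ≈-small a path≈ (linear 4 (λ m₃ n x y → x :≤ 105 :* m₃ ∷ y :≤ 125 :* m₃ ∷ 10000 :* m₃ :< n ∷ [] ⊢ x :+ y :< n) refl
            m₃ N (∣ path x d q ! a ∣) (∣ -p₁ ! a ∣) (path≤R q a q≤R) (subst (_≤ 125 * m₃) (sym (∣negated∣ p₁ a)) (p₁≤ a)) wide)
          decide : Dec (Walk.h (walk x d) ≤ q) → ⊥
          decide (yes late) = skew q late (trans (cong D (trans path≡ (vec≡ λ a → flip a)))
            (trans (level-⊖ v (f₁ 0) (f₂ 0)) (cong₂ ℤ._-_ (D-laps (100 * m₂ + 0) r₁ h≤r₁) (D-laps (10 * M + 0) r₂ h≤r₂))))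
            where
            lemma : ∀ x y → 0ℤ ℤ.- (x ℤ.- y) ≡ y ℤ.- x
            lemma = solve-∀
            flip : ∀ a → -p₁ ! a ≡ (f₁ 0 ⊖ f₂ 0) ! a
            flip X = lemma (f₂ 0 ! X) (f₁ 0 ! X)
            flip Y = lemma (f₂ 0 ! Y) (f₁ 0 ! Y)
          decide (no early) = let a , va = nonzero-coordinate (proj₁ long) in
            ℕ.<⇒≱ (above (subst (80 * m₂ ≤_) (sym (trans (cong (λ z → ∣ z ! a ∣) path≡) (∣negated∣ p₁ a))) (p₁≥ a va)))
              (ℕ.≤-trans (early-small q a (ℕ.≰⇒> early)) (ℕ.m≤m+n M (4 * M)))
        go : Dec (s ≤ at-time j) → ⊥
        go (yes before) = proj₁ (remote-unlike -p₁ remote-minus s before) h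
        go (no after)   = contradiction (later s R ℕ.≤-refl (ℕ.≰⇒> after) s≤)

      offset₂₁ : ∀ s → s ≤ E₂ → ω s ≉ p₁
      offset₂₁ s s≤ h = go (s ℕ.≤? at-time j)
        where
        contradiction : ∃[ q ] (q ≤ R′ × After s q) → ⊥
        contradiction (q , q≤R′ , _ , e) = let a , va = nonzero-coordinate (proj₁ long) in
          short-of a (path≤R′ q a q≤R′) (p₁≥ a va) (p₁≤ a) (subst (_≈ p₁) (cong offset e) h)
        go : Dec (s ≤ at-time j) → ⊥
        go (yes before) = proj₁ (remote-unlike p₁ remote-p₁ s before) h
        go (no after)   = contradiction (later s R′ R′≤R (ℕ.≰⇒> after) s≤)

      E₂≤E₁ : E₂ ≤ E₁
      E₂≤E₁ = ℕ.+-monoˡ-≤ (suc (at-time j)) R′≤R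

      sync₁₂ : ∀ s → s ≤ E₁ → p₁ ⊕ π s ≉ p₂ ⊕ u s
      sync₁₂ s s≤ e = offset₁₂ s s≤ (≈-move {p₁} (relative {p₁} {p₂} s e))

      sync₂₁ : ∀ s → s ≤ E₂ → p₂ ⊕ π s ≉ p₁ ⊕ u s
      sync₂₁ s s≤ e = offset₂₁ s s≤ (trans (cong ι (sym (⊕-identityˡ (ω s)))) (relative {p₂} {p₁} s e))

      u-after : ∀ s → at-time j < s → s ≤ E₁ → u s ≡ siteᵢ j
      u-after s before s≤ = let _ , _ , _ , e = later s R ℕ.≤-refl before s≤ in cong home e

      boxβ : ∀ e → e ≤ 3 → ∀ a → ∣ β e ! a ∣ ≤ G
      boxβ e e≤3 a = shifted-box (siteᵢ j) (f₂ e) a (site≤ a) (f₂≤ e e≤3 a)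

      boxU : ∀ a → ∣ siteᵢ j ! a ∣ ≤ G
      boxU a = ℕ.≤-trans (site≤ a) M≤G

      boxp₁ : ∀ a → ∣ p₁ ! a ∣ ≤ G
      boxp₁ a = ℕ.≤-trans (p₁≤ a) (ℕ.*-monoˡ-≤ m₃ (ℕ.m≤m+n 125 5))

      -- Three laps, because the drift may be 1 and the distance between the candidates has to
      -- exceed 2.
      apart : ∃[ a ] 2 < ∣ β 0 ! a ℤ.- β 3 ! a ∣
      apart = let a , va = nonzero-coordinate (proj₁ long) in a ,
        subst (λ z → 2 < ∣ z ∣) (sym (gap a))
          (subst (2 <_) (sym (trans (ℤ.∣-i∣≡∣i∣ (+ 3 ℤ.* v ! a)) (ℤ.abs-* (+ 3) (v ! a))))
            (ℕ.*-monoʳ-≤ 3 (∣∣-positive va)))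
        where
        scalar : ∀ u b k v → u ℤ.+ (b ℤ.+ (k ℤ.+ 0ℤ) ℤ.* v) ℤ.- (u ℤ.+ (b ℤ.+ (k ℤ.+ + 3) ℤ.* v)) ≡ ℤ.- (+ 3 ℤ.* v)
        scalar = solve-∀
        β! : ∀ e a → β e ! a ≡ siteᵢ j ! a ℤ.+ (path x d r₂ ! a ℤ.+ + (10 * M + e) ℤ.* v ! a)
        β! e X = cong (λ z → (siteᵢ j ⊕ z) ! X) (laps (10 * M + e) r₂ h≤r₂)
        β! e Y = cong (λ z → (siteᵢ j ⊕ z) ! Y) (laps (10 * M + e) r₂ h≤r₂)
        gap : ∀ a → β 0 ! a ℤ.- β 3 ! a ≡ ℤ.- (+ 3 ℤ.* v ! a)
        gap a = trans (cong₂ ℤ._-_ (β! 0 a) (β! 3 a)) (scalar (siteᵢ j ! a) (path x d r₂ ! a) (+ (10 * M)) (v ! a))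

      contradiction : ⊥
      contradiction = Ambiguity.ambiguity C G K large wideK E₁ bandsω bandsπ p₁ p₂ (siteᵢ j) (siteᵢ j)
        (at-time j) E₁ (at-time j) E₂ ℕ.≤-refl E₂≤E₁ boxp₁ box𝟎 boxU boxU (lost R ℕ.≤-refl) (lost R′ R′≤R)
        sync₁₂ (λ s before s≤ → subst (λ z → p₁ ⊕ π s ≉ p₂ ⊕ z) (u-after s before s≤) (sync₁₂ s s≤))
        (λ s s≤E₂ _ → sync₂₁ s s≤E₂)
        (λ s before s≤ → subst (λ z → p₂ ⊕ π s ≉ p₁ ⊕ z) (u-after s before (ℕ.≤-trans s≤ E₂≤E₁)) (sync₂₁ s s≤))
        (β 0) (β 3) (boxβ 0 z≤n) (boxβ 3 ℕ.≤-refl) (falls₁ 0 z≤n) (falls₂ 0 z≤n) (falls₁ 3 ℕ.≤-refl) (falls₂ 3 ℕ.≤-refl) apart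

    flat : ∀ j → History j → ∀ x d → Tour oracle j x d → (long : Walk.Long (walk x d)) →
      (∀ a k → k < j → Run a k → Walk.v (walk x d) ! other a ≢ 0ℤ) →
      ∀ r → Walk.h (walk x d) ≤ r → Walk.D (walk x d) (path x d r) ≡ 0ℤ
    flat j H x d T long fresh r h≤r = decide (Walk.D (walk x d) (path x d r) ℤ.≟ 0ℤ)
      where
      decide : Dec (Walk.D (walk x d) (path x d r) ≡ 0ℤ) → Walk.D (walk x d) (path x d r) ≡ 0ℤ
      decide (yes e) = e
      decide (no ne) = let r₁ , r₂ , h≤r₁ , r₁< , h≤r₂ , r₂< , skew = Walk.skew-phases (walk x d) r h≤r ne in
        ⊥-elim (SkewKill.contradiction j H x d T long fresh r₁ r₂ h≤r₁ r₁< h≤r₂ r₂< skew)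

    earlier : ∀ {i j} → i ≤ j → History j → History i
    earlier i≤j H = record
      { i≤M = ℕ.≤-trans i≤j i≤M ; reached = λ k k<i → reached k (ℕ.<-≤-trans k<i i≤j)
      ; tame = λ k x d k<i → tame k x d (ℕ.<-≤-trans k<i i≤j)
      ; aligned = λ a k l k<i l<i → aligned a k l (ℕ.<-≤-trans k<i i≤j) (ℕ.<-≤-trans l<i i≤j) }
      where open History H

    moment-suc : ∀ k → ¬ Lost oracle k → at-time k < at-time (suc k)
    moment-suc k found = go (stretch oracle k)
      where
      go : Stretch oracle k → at-time k < at-time (suc k)
      go (direct _ _ _ _ _ t≡)       = ℕ.≤-reflexive (sym t≡)
      go (trip _ _ r _ _ _ _ _ t≡)   = ℕ.≤-trans (ℕ.m≤n+m (suc (at-time k)) r) (ℕ.≤-reflexive (sym t≡))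
      go (gone l)                    = ⊥-elim (found l)

    moment-mono : ∀ {i j} → Reached oracle j → i < j → at-time i < at-time j
    moment-mono {i} {suc j} reached i<sj = go (ℕ.m≤n⇒m<n∨m≡n (ℕ.≤-pred i<sj))
      where
      go : i < j ⊎ i ≡ j → at-time i < at-time (suc j)
      go (inj₁ i<j) = ℕ.<-trans (moment-mono (λ k k<j → reached k (ℕ.m≤n⇒m≤1+n k<j)) i<j)
                                (moment-suc j (reached j ℕ.≤-refl))
      go (inj₂ i≡j) = subst (λ k → at-time k < at-time (suc j)) (sym i≡j) (moment-suc j (reached j ℕ.≤-refl))

    straight-along : ∀ {a x d} → Walk.v (walk x d) ≢ 𝟎 → Walk.v (walk x d) ! other a ≡ 0ℤ →
      ∃[ b ] Straight b x d → Straight a x d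
    straight-along {a} {x} {d} v≢𝟎 va′ (b , s) = go (same-or-other a b)
      where
      go : b ≡ a ⊎ b ≡ other a → Straight a x d
      go (inj₁ e) = subst (λ b → Straight b x d) e s
      go (inj₂ e) = ⊥-elim (nonzero-along a v≢𝟎 va′
        (trans (cong (Walk.v (walk x d) !_) (sym (trans (cong other e) (other-other a)))) (proj₁ s)))

    -- Two deaths on parallel lines

    -- One agent dies on the i-th tour, the first one along axis a, and another one on the j-th tour,
    -- along the same axis but on another line.
    module ParallelKill (j : ℕ) (H : History j) (x : Mind) (d : Direction) (T : Tour oracle j x d)
                (long : Walk.Long (walk x d)) (a : Coord) (along : Walk.v (walk x d) ! other a ≡ 0ℤ)
                (i : ℕ) (i<j : i < j) (xᵢ : Mind) (dᵢ : Direction) (Tᵢ : Tour oracle i xᵢ dᵢ)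
                (longᵢ : Walk.Long (walk xᵢ dᵢ)) (alongᵢ : Walk.v (walk xᵢ dᵢ) ! other a ≡ 0ℤ)
                (first : ∀ k → k < i → ¬ Run a k)
                (r₂ : ℕ) (h≤r₂ : Walk.h (walk x d) ≤ r₂) (r₂< : r₂ < Walk.h (walk x d) + Walk.p (walk x d))
                (elsewhere : (siteᵢ j ⊕ path x d r₂) ! other a ≢ siteᵢ i ! other a) where

      a′ : Coord
      a′ = other a

      Hᵢ : History i
      Hᵢ = earlier (ℕ.<⇒≤ i<j) H

      module TI = Trip i Hᵢ xᵢ dᵢ Tᵢ longᵢ
      module TJ = Trip j H x d T long

      w v : ℤ²
      w = TI.v
      v = TJ.v

      pure : ∀ r → TI.h ≤ r → path xᵢ dᵢ r ! a′ ≡ 0ℤ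
      pure = proj₂ (straight-along {a} {xᵢ} {dᵢ} (proj₁ longᵢ) alongᵢ (History.tame H i xᵢ dᵢ i<j Tᵢ longᵢ))

      wa≢0 : w ! a ≢ 0ℤ
      wa≢0 = nonzero-along a (proj₁ longᵢ) alongᵢ

      va≢0 : v ! a ≢ 0ℤ
      va≢0 = nonzero-along a (proj₁ long) along

      -- The extra laps that move the black hole: `e₂` laps with drift v are as long as `e₁` laps
      -- with drift w. The factor 3 again makes the distance exceed 2.
      e₂ e₁ : ℕ
      e₂ = 3 * ∣ w ! a ∣
      e₁ = 3 * ∣ v ! a ∣

      drift : ∀ {y d} b → ∣ Walk.v (walk y d) ! b ∣ ≤ M
      drift {y} {d} b = ℕ.≤-trans (Walk.v-bound (walk y d) b) drift≤M

      -- `ε` and `ε′` are the extra laps of agent 1 before its death at `β 0` and at `β e₂`. When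
      -- the drifts are opposite, agent 1 needs more laps for the candidate that agent 2 reaches
      -- with fewer.
      Shifts : ℕ → ℕ → Set
      Shifts ε ε′ = ε ≤ e₁ × ε′ ≤ e₁ × ∀ b → + ε′ ℤ.* w ! b ≡ + e₂ ℤ.* v ! b ℤ.+ + ε ℤ.* w ! b

      shifts : ∃[ ε ] ∃[ ε′ ] Shifts ε ε′
      shifts = go (same-length (w ! a) (v ! a))
        where
        triple : ∀ k → + (3 * k) ≡ + 3 ℤ.* + k
        triple k = ℤ.pos-* 3 k
        zeros : ∀ {p q r s t} → s ≡ 0ℤ → t ≡ 0ℤ → p ℤ.* s ≡ q ℤ.* t ℤ.+ r ℤ.* s
        zeros {p} {q} {r} refl refl = lemma p q r
          where
          lemma : ∀ p q r → p ℤ.* 0ℤ ≡ q ℤ.* 0ℤ ℤ.+ r ℤ.* 0ℤ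
          lemma = solve-∀
        go : (+ ∣ v ! a ∣ ℤ.* w ! a ≡ + ∣ w ! a ∣ ℤ.* v ! a) ⊎ (+ ∣ w ! a ∣ ℤ.* v ! a ℤ.+ + ∣ v ! a ∣ ℤ.* w ! a ≡ 0ℤ) →
             ∃[ ε ] ∃[ ε′ ] Shifts ε ε′
        go (inj₁ e) = 0 , e₁ , z≤n , ℕ.≤-refl , two-coordinates _ a
          (trans (cong (ℤ._* w ! a) (triple ∣ v ! a ∣)) (trans (ℤ.*-assoc (+ 3) (+ ∣ v ! a ∣) (w ! a))
            (trans (cong (λ z → + 3 ℤ.* z) e) (trans (sym (ℤ.*-assoc (+ 3) (+ ∣ w ! a ∣) (v ! a)))
              (trans (cong (ℤ._* v ! a) (sym (triple ∣ w ! a ∣))) (sym (ℤ.+-identityʳ _)))))))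
          (zeros {+ e₁} {+ e₂} {+ 0} alongᵢ along)
        go (inj₂ e) = e₁ , 0 , ℕ.≤-refl , z≤n , two-coordinates _ a
          (sym (trans (cong₂ ℤ._+_ (cong (ℤ._* v ! a) (triple ∣ w ! a ∣)) (cong (ℤ._* w ! a) (triple ∣ v ! a ∣)))
            (trans (lemma (+ ∣ w ! a ∣) (v ! a) (+ ∣ v ! a ∣) (w ! a)) (cong (λ z → + 3 ℤ.* z) e))))
          (zeros {+ 0} {+ e₂} {+ e₁} alongᵢ along)
          where
          lemma : ∀ k x l y → (+ 3 ℤ.* k) ℤ.* x ℤ.+ (+ 3 ℤ.* l) ℤ.* y ≡ + 3 ℤ.* (k ℤ.* x ℤ.+ l ℤ.* y)
          lemma = solve-∀

      module Shifted (ε ε′ : ℕ) (ε≤ : ε ≤ e₁) (ε′≤ : ε′ ≤ e₁)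
                     (key : ∀ b → + ε′ ℤ.* w ! b ≡ + e₂ ℤ.* v ! b ℤ.+ + ε ℤ.* w ! b) where

        index₁ index₂ : ℕ → ℕ
        index₁ e = (100 * m₂ + e) * TI.p + TI.h
        index₂ e = (10 * M + e) * TJ.p + r₂

        f₁ f₂ β : ℕ → ℤ²
        f₁ e = path xᵢ dᵢ (index₁ e)
        f₂ e = path x d (index₂ e)
        β e  = siteᵢ j ⊕ f₂ e

        p₁ p₂ : ℤ²
        p₁ = β 0 ⊖ (siteᵢ i ⊕ f₁ ε)
        p₂ = 𝟎

        h< : TI.h < TI.h + TI.p
        h< = subst (_< TI.h + TI.p) (ℕ.+-identityʳ TI.h) (ℕ.+-monoʳ-< TI.h TI.p>0)

        index₁≤ : ∀ e → e ≤ e₁ → index₁ e ≤ R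
        index₁≤ e e≤ = TI.lap-index≤R _ TI.h h< (linear 4 (λ m m₂ e k → e :≤ 3 :* k ∷ k :≤ m ∷ m :≤ m₂ ∷ [] ⊢ 100 :* m₂ :+ e :≤ 103 :* m₂) refl
          M m₂ e (∣ v ! a ∣) e≤ (drift {x} {d} a) M≤m₂)

        index₂≤ : ∀ e → e ≤ e₂ → index₂ e ≤ R′
        index₂≤ e e≤ = TJ.lap-index≤R′ _ r₂ r₂< (linear 3 (λ m e k → e :≤ 3 :* k ∷ k :≤ m ∷ [] ⊢ 10 :* m :+ e :≤ 13 :* m) refl
          M e (∣ w ! a ∣) e≤ (drift {xᵢ} {dᵢ} a))

        f₁≤ : ∀ e → e ≤ e₁ → ∀ b → ∣ f₁ e ! b ∣ ≤ 105 * m₃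
        f₁≤ e e≤ b = TI.path≤R (index₁ e) b (index₁≤ e e≤)

        f₂≤ : ∀ e → e ≤ e₂ → ∀ b → ∣ f₂ e ! b ∣ ≤ 15 * m₂
        f₂≤ e e≤ b = TJ.path≤R′ (index₂ e) b (index₂≤ e e≤)

        f₁≥ : ∀ e → 100 * m₂ ≤ ∣ f₁ e ! a ∣ + M
        f₁≥ e = ℕ.≤-trans (ℕ.m≤m+n (100 * m₂) e) (TI.far-out a wa≢0 (100 * m₂ + e) TI.h ℕ.≤-refl h<)

        f₂≥ : ∀ e → 10 * M ≤ ∣ f₂ e ! a ∣ + M
        f₂≥ e = ℕ.≤-trans (ℕ.m≤m+n (10 * M) e) (TJ.far-out a va≢0 (10 * M + e) r₂ h≤r₂ r₂<)

        f₁′ : ∀ e → f₁ e ! a′ ≡ 0ℤ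
        f₁′ e = pure (index₁ e) (ℕ.m≤n+m TI.h _)

        f₂! : ∀ e b → f₂ e ! b ≡ path x d r₂ ! b ℤ.+ + (10 * M + e) ℤ.* v ! b
        f₂! e b = trans (cong (_! b) (TJ.laps (10 * M + e) r₂ h≤r₂))
          (trans (!-⊕ (path x d r₂) (+ (10 * M + e) ⊛ v) b) (cong (λ z → path x d r₂ ! b ℤ.+ z) (!-⊛ (+ (10 * M + e)) v b)))

        f₁! : ∀ e b → f₁ e ! b ≡ path xᵢ dᵢ TI.h ! b ℤ.+ + (100 * m₂ + e) ℤ.* w ! b
        f₁! e b = trans (cong (_! b) (TI.laps (100 * m₂ + e) TI.h ℕ.≤-refl))
          (trans (!-⊕ (path xᵢ dᵢ TI.h) (+ (100 * m₂ + e) ⊛ w) b)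
                 (cong (λ z → path xᵢ dᵢ TI.h ! b ℤ.+ z) (!-⊛ (+ (100 * m₂ + e)) w b)))

        β′ : ∀ e → β e ! a′ ≡ (siteᵢ j ⊕ path x d r₂) ! a′
        β′ e = trans (!-⊕ (siteᵢ j) (f₂ e) a′) (trans (cong (λ z → siteᵢ j ! a′ ℤ.+ z)
          (trans (f₂! e a′) (trans (cong (λ z → path x d r₂ ! a′ ℤ.+ + (10 * M + e) ℤ.* z) along)
            (trans (cong (λ z → path x d r₂ ! a′ ℤ.+ z) (ℤ.*-zeroʳ (+ (10 * M + e)))) (ℤ.+-identityʳ _)))))
          (sym (!-⊕ (siteᵢ j) (path x d r₂) a′)))

        line≤ : ∣ (siteᵢ j ⊕ path x d r₂) ! a′ ∣ ≤ 2 * M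
        line≤ = linear 4 (λ m x y z → x :≤ m ∷ y :≤ m ∷ z :≤ x :+ y ∷ [] ⊢ z :≤ 2 :* m) refl M (∣ siteᵢ j ! a′ ∣) (∣ path x d r₂ ! a′ ∣)
          (∣ (siteᵢ j ⊕ path x d r₂) ! a′ ∣) (small-site (History.i≤M H) a′)
          (ℕ.≤-trans (TJ.bound r₂ a′) (ℕ.≤-trans r₂< (ℕ.≤-trans TJ.h+p≤c c≤M))) (proj₁ (⊕-size (siteᵢ j) (path x d r₂) a′))

        back : ∀ z q → z ⊖ q ⊕ q ≡ z
        back z q = trans (⊕-comm (z ⊖ q) q) (⊕-inverse z q)

        target : p₁ ⊕ (siteᵢ i ⊕ f₁ ε) ≡ β 0
        target = back (β 0) (siteᵢ i ⊕ f₁ ε)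

        target′ : p₁ ⊕ (siteᵢ i ⊕ f₁ ε′) ≡ β e₂
        target′ = vec≡ coordinate
          where
          scalar : ∀ u s b v c w m k ε ε′ e → ε′ ℤ.* w ≡ e ℤ.* v ℤ.+ ε ℤ.* w →
            u ℤ.+ (b ℤ.+ (m ℤ.+ 0ℤ) ℤ.* v) ℤ.- (s ℤ.+ (c ℤ.+ (k ℤ.+ ε) ℤ.* w)) ℤ.+ (s ℤ.+ (c ℤ.+ (k ℤ.+ ε′) ℤ.* w))
            ≡ u ℤ.+ (b ℤ.+ (m ℤ.+ e) ℤ.* v)
          scalar u s b v c w m k ε ε′ e h = trans (expand u s b v c w m k ε ε′)
            (trans (cong (λ z → u ℤ.+ b ℤ.+ m ℤ.* v ℤ.- ε ℤ.* w ℤ.+ z) h) (collect u b v w m ε e))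
            where
            expand : ∀ u s b v c w m k ε ε′ →
              u ℤ.+ (b ℤ.+ (m ℤ.+ 0ℤ) ℤ.* v) ℤ.- (s ℤ.+ (c ℤ.+ (k ℤ.+ ε) ℤ.* w)) ℤ.+ (s ℤ.+ (c ℤ.+ (k ℤ.+ ε′) ℤ.* w))
              ≡ u ℤ.+ b ℤ.+ m ℤ.* v ℤ.- ε ℤ.* w ℤ.+ ε′ ℤ.* w
            expand = solve-∀
            collect : ∀ u b v w m ε e → u ℤ.+ b ℤ.+ m ℤ.* v ℤ.- ε ℤ.* w ℤ.+ (e ℤ.* v ℤ.+ ε ℤ.* w) ≡ u ℤ.+ (b ℤ.+ (m ℤ.+ e) ℤ.* v)
            collect = solve-∀
          coordinate : ∀ b → (p₁ ⊕ (siteᵢ i ⊕ f₁ ε′)) ! b ≡ β e₂ ! b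
          coordinate b = begin
            (p₁ ⊕ (siteᵢ i ⊕ f₁ ε′)) ! b
              ≡⟨ trans (!-⊕ p₁ (siteᵢ i ⊕ f₁ ε′) b) (cong₂ ℤ._+_ (!-⊖ (β 0) (siteᵢ i ⊕ f₁ ε) b) (!-⊕ (siteᵢ i) (f₁ ε′) b)) ⟩
            β 0 ! b ℤ.- (siteᵢ i ⊕ f₁ ε) ! b ℤ.+ (siteᵢ i ! b ℤ.+ f₁ ε′ ! b)
              ≡⟨ cong₂ (λ z q → z ℤ.- q ℤ.+ (siteᵢ i ! b ℤ.+ f₁ ε′ ! b)) (!-⊕ (siteᵢ j) (f₂ 0) b) (!-⊕ (siteᵢ i) (f₁ ε) b) ⟩
            siteᵢ j ! b ℤ.+ f₂ 0 ! b ℤ.- (siteᵢ i ! b ℤ.+ f₁ ε ! b) ℤ.+ (siteᵢ i ! b ℤ.+ f₁ ε′ ! b)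
              ≡⟨ cong₂ (λ z q → siteᵢ j ! b ℤ.+ f₂ 0 ! b ℤ.- (siteᵢ i ! b ℤ.+ z) ℤ.+ (siteᵢ i ! b ℤ.+ q)) (f₁! ε b) (f₁! ε′ b) ⟩
            _ ≡⟨ cong (λ z → siteᵢ j ! b ℤ.+ z ℤ.- (siteᵢ i ! b ℤ.+ (path xᵢ dᵢ TI.h ! b ℤ.+ + (100 * m₂ + ε) ℤ.* w ! b))
                   ℤ.+ (siteᵢ i ! b ℤ.+ (path xᵢ dᵢ TI.h ! b ℤ.+ + (100 * m₂ + ε′) ℤ.* w ! b))) (f₂! 0 b) ⟩
            _ ≡⟨ scalar (siteᵢ j ! b) (siteᵢ i ! b) (path x d r₂ ! b) (v ! b) (path xᵢ dᵢ TI.h ! b) (w ! b) (+ (10 * M))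
                   (+ (100 * m₂)) (+ ε) (+ ε′) (+ e₂) (key b) ⟩
            siteᵢ j ! b ℤ.+ (path x d r₂ ! b ℤ.+ + (10 * M + e₂) ℤ.* v ! b)
              ≡⟨ cong (λ z → siteᵢ j ! b ℤ.+ z) (f₂! e₂ b) ⟨
            siteᵢ j ! b ℤ.+ f₂ e₂ ! b
              ≡⟨ !-⊕ (siteᵢ j) (f₂ e₂) b ⟨
            β e₂ ! b ∎
            where open ≡-Reasoning

        site-iM : ∀ b → ∣ siteᵢ i ! b ∣ ≤ M
        site-iM = small-site (History.i≤M Hᵢ)

        site-jM : ∀ b → ∣ siteᵢ j ! b ∣ ≤ M
        site-jM = small-site (History.i≤M H)

        p₁≤ : ∀ b → ∣ p₁ ! b ∣ ≤ 125 * m₃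
        p₁≤ b = linear 8 (λ m m₂ m₃ f g y z p → f :≤ 15 :* m₂ ∷ g :≤ 105 :* m₃ ∷ y :≤ m :+ f ∷ z :≤ m :+ g ∷ p :≤ y :+ z ∷ m :≤ m₂ ∷ m₂ :≤ m₃ ∷ [] ⊢ p :≤ 125 :* m₃) refl
          M m₂ m₃ (∣ f₂ 0 ! b ∣) (∣ f₁ ε ! b ∣) (∣ β 0 ! b ∣) (∣ (siteᵢ i ⊕ f₁ ε) ! b ∣) (∣ p₁ ! b ∣)
          (f₂≤ 0 z≤n b) (f₁≤ ε ε≤ b) (proj₁ (shifted (siteᵢ j) (f₂ 0) b (site-jM b))) (proj₁ (shifted (siteᵢ i) (f₁ ε) b (site-iM b)))
          (subst (λ z → ∣ z ∣ ≤ ∣ β 0 ! b ∣ + ∣ (siteᵢ i ⊕ f₁ ε) ! b ∣) (sym (!-⊖ (β 0) (siteᵢ i ⊕ f₁ ε) b)) (ℤ.∣i-j∣≤∣i∣+∣j∣ (β 0 ! b) ((siteᵢ i ⊕ f₁ ε) ! b)))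
          M≤m₂ m₂≤m₃

        p₁≥ : 80 * m₂ ≤ ∣ p₁ ! a ∣
        p₁≥ = linear 7 (λ m m₂ f g y z p → f :≤ 15 :* m₂ ∷ 100 :* m₂ :≤ g :+ m ∷ y :≤ m :+ f ∷ g :≤ z :+ m ∷ z :≤ y :+ p ∷ m :≤ m₂ ∷ [] ⊢ 80 :* m₂ :≤ p) refl
          M m₂ (∣ f₂ 0 ! a ∣) (∣ f₁ ε ! a ∣) (∣ β 0 ! a ∣) (∣ (siteᵢ i ⊕ f₁ ε) ! a ∣) (∣ p₁ ! a ∣)
          (f₂≤ 0 z≤n a) (f₁≥ ε) (proj₁ (shifted (siteᵢ j) (f₂ 0) a (site-jM a))) (proj₂ (shifted (siteᵢ i) (f₁ ε) a (site-iM a)))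
          (subst (λ z → ∣ (siteᵢ i ⊕ f₁ ε) ! a ∣ ≤ ∣ z ! a ∣ + ∣ p₁ ! a ∣) target (proj₂ (proj₂ (⊕-size p₁ (siteᵢ i ⊕ f₁ ε) a))))
          M≤m₂

        p₁′ : p₁ ! a′ ≡ (siteᵢ j ⊕ path x d r₂) ! a′ ℤ.- siteᵢ i ! a′
        p₁′ = trans (!-⊖ (β 0) (siteᵢ i ⊕ f₁ ε) a′) (cong₂ ℤ._-_ (β′ 0)
          (trans (!-⊕ (siteᵢ i) (f₁ ε) a′) (trans (cong (λ z → siteᵢ i ! a′ ℤ.+ z) (f₁′ ε)) (ℤ.+-identityʳ _))))

        p₁′≢0 : p₁ ! a′ ≢ 0ℤ
        p₁′≢0 e = elsewhere (ℤ.i-j≡0⇒i≡j _ _ (trans (sym p₁′) e))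

        p₁′≤ : ∣ p₁ ! a′ ∣ ≤ 3 * M
        p₁′≤ = subst (λ z → ∣ z ∣ ≤ 3 * M) (sym p₁′)
          (linear 4 (λ m x y z → x :≤ 2 :* m ∷ y :≤ m ∷ z :≤ x :+ y ∷ [] ⊢ z :≤ 3 :* m) refl M (∣ (siteᵢ j ⊕ path x d r₂) ! a′ ∣) (∣ siteᵢ i ! a′ ∣)
            (∣ (siteᵢ j ⊕ path x d r₂) ! a′ ℤ.- siteᵢ i ! a′ ∣) line≤ (site-iM a′) (ℤ.∣i-j∣≤∣i∣+∣j∣ ((siteᵢ j ⊕ path x d r₂) ! a′) (siteᵢ i ! a′)))

        tiny : ∀ {y z} → ∣ y ∣ ≤ M → ∣ z ∣ ≤ 3 * M → ∣ y ∣ + ∣ z ∣ < N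
        tiny {y} {z} h h′ = linear 6 (λ m m₂ m₃ n y z → y :≤ m ∷ z :≤ 3 :* m ∷ m :≤ m₂ ∷ m₂ :≤ m₃ ∷ 10000 :* m₃ :< n ∷ [] ⊢ y :+ z :< n) refl
          M m₂ m₃ N (∣ y ∣) (∣ z ∣) h h′ M≤m₂ m₂≤m₃ wide

        off-axis : ∀ {k} z b → z ! b ≡ k → ∣ k ∣ ≤ M → b ≡ a → ∣ z ! a ∣ ≤ 2 * M
        off-axis z b e h refl = ≤2M (subst (λ k → ∣ k ∣ ≤ M) (sym e) h)

        -- Such a q lies far out on the line of the j-th tour. Earlier long tours along a follow the
        -- line of the i-th one by `aligned`, and this is a different line; all other earlier
        -- positions have a small coordinate a.
        avoided : ∀ q → 5 * M < ∣ q ! a ∣ → ∣ q ! a ∣ ≤ 1000 * m₃ → q ! a′ ≡ (siteᵢ j ⊕ path x d r₂) ! a′ →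
          ∀ s → s ≤ at-time j → π s ≉ q
        avoided q low high line s before e = go (spot H s before)
          where
          go : Spot j s → ⊥
          go (inj₁ (_ , box)) = unlike a (box a) low high e
          go (inj₂ (b , k , k<j , run , _ , π≡)) = side (same-or-other a b)
            where
            side : b ≡ a ⊎ b ≡ other a → ⊥
            side (inj₂ b≡) = unlike a (off-axis (π s) (other b) π≡ (small-site (ℕ.≤-trans (ℕ.<⇒≤ k<j) (History.i≤M H)) (other b))
                               (trans (cong other b≡) (other-other a))) low high e
            side (inj₁ refl) = elsewhere (trans (sym line) (trans (sym (≈-small a′ e (tiny {π s ! a′} {q ! a′}
                (subst (λ z → ∣ z ∣ ≤ M) (sym on-line) (site-iM a′))
                (subst (λ z → ∣ z ∣ ≤ 3 * M) (sym line) (ℕ.≤-trans line≤ (ℕ.*-monoˡ-≤ M (ℕ.m≤m+n 2 1))))))) on-line))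
              where
              on-line : π s ! a′ ≡ siteᵢ i ! a′
              on-line = trans π≡ (History.aligned H a k i k<j i<j run (xᵢ , dᵢ , Tᵢ , longᵢ , alongᵢ))

        -- As the i-th tour is the first long one along a, coordinate a stays small until it begins.
        early : ∀ q → 5 * M < ∣ q ! a ∣ → ∣ q ! a ∣ ≤ 1000 * m₃ → ∀ s → s ≤ at-time i → ω s ≉ q × π s ≉ q
        early q low high s before = go (spot Hᵢ s before)
          where
          go : Spot i s → ω s ≉ q × π s ≉ q
          go (inj₁ (boxω , boxπ)) = unlike a (≤2M (boxω a)) low high , unlike a (boxπ a) low high
          go (inj₂ (b , k , k<i , run , ω≡ , π≡)) = side (same-or-other a b)
            where
            side : b ≡ a ⊎ b ≡ other a → ω s ≉ q × π s ≉ q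
            side (inj₁ refl) = ⊥-elim (first k k<i run)
            side (inj₂ b≡) = let ob≡a = trans (cong other b≡) (other-other a) in
                unlike a (off-axis (ω s) (other b) ω≡ z≤n ob≡a) low high
              , unlike a (off-axis (π s) (other b) π≡ (small-site (ℕ.≤-trans (ℕ.<⇒≤ k<i) (History.i≤M Hᵢ)) (other b)) ob≡a) low high

        E₁ E₂ : ℕ
        E₁ = R + suc (at-time i)
        E₂ = R′ + suc (at-time j)

        -- Late in the i-th tour the offset is zero across the axis, whereas q is nonzero there and
        -- too small to be a multiple of N. Until then coordinate a distinguishes them.
        offsets : ∀ q → 5 * M < ∣ q ! a ∣ → ∣ q ! a ∣ ≤ 1000 * m₃ → q ! a′ ≢ 0ℤ → ∣ q ! a′ ∣ ≤ 3 * M →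
          ∀ s → s ≤ E₁ → ω s ≉ q
        offsets q low high line small s s≤ e = go (s ℕ.≤? at-time i)
          where
          on-tour : ∃[ r ] (r ≤ R × TI.After s r) → ⊥
          on-tour (r , _ , _ , s≡) = decide (TI.h ℕ.≤? r)
            where
            path≈ : path xᵢ dᵢ r ≈ q
            path≈ = subst (_≈ q) (cong offset s≡) e
            decide : Dec (TI.h ≤ r) → ⊥
            decide (no before) = unlike a (≤2M (TI.early-small r a (ℕ.≰⇒> before))) low high path≈
            decide (yes late) = line (trans (sym (≈-small a′ path≈ (tiny {path xᵢ dᵢ r ! a′} {q ! a′}
              (subst (λ z → ∣ z ∣ ≤ M) (sym (pure r late)) z≤n) small))) (pure r late))
          go : Dec (s ≤ at-time i) → ⊥
          go (yes before) = proj₁ (early q low high s before) e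
          go (no after)   = on-tour (TI.later s R ℕ.≤-refl (ℕ.≰⇒> after) s≤)

        -p₁ : ℤ²
        -p₁ = 𝟎 ⊖ p₁

        sync₁₂ : ∀ s → s ≤ E₁ → p₁ ⊕ π s ≉ p₂ ⊕ u s
        sync₁₂ s s≤ e = offsets -p₁ (subst (5 * M <_) (sym (∣negated∣ p₁ a)) (above p₁≥)) (subst (_≤ 1000 * m₃) (sym (∣negated∣ p₁ a)) (below (p₁≤ a)))
          (λ z → p₁′≢0 (ℤ.∣i∣≡0⇒i≡0 (trans (sym (∣negated∣ p₁ a′)) (cong ∣_∣ z)))) (subst (_≤ 3 * M) (sym (∣negated∣ p₁ a′)) p₁′≤) s s≤
          (≈-move {p₁} (relative {p₁} {p₂} s e))

        sync₂₁ : ∀ s → s ≤ E₁ → p₂ ⊕ π s ≉ p₁ ⊕ u s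
        sync₂₁ s s≤ e = offsets p₁ (above p₁≥) (below (p₁≤ a)) p₁′≢0 p₁′≤ s s≤
          (trans (cong ι (sym (⊕-identityˡ (ω s)))) (relative {p₂} {p₁} s e))

        moment<moment : at-time i < at-time j
        moment<moment = moment-mono (History.reached H) i<j

        -- At time at-time j the agent is with its token, unlike in the i-th tour up to time E₁.
        E₁≤moment : E₁ ≤ at-time j
        E₁≤moment = go (E₁ ℕ.≤? at-time j)
          where
          not-met : ∀ {y u x u′ o} → met y u ≢ away x u′ o
          not-met ()
          go : Dec (E₁ ≤ at-time j) → E₁ ≤ at-time j
          go (yes h) = h
          go (no ¬h) = let _ , _ , _ , e = TI.later (at-time j) R ℕ.≤-refl moment<moment (ℕ.<⇒≤ (ℕ.≰⇒> ¬h)) in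
            ⊥-elim (not-met (trans (sym (visited oracle j (History.reached H))) e))

        f : ℤ²
        f = f₂ 0 ⊖ f₁ ε

        left-token : p₁ ⊕ siteᵢ i ≡ siteᵢ j ⊕ f
        left-token = cong₂ _,_ (lemma (siteᵢ j ! X) (f₂ 0 ! X) (siteᵢ i ! X) (f₁ ε ! X)) (lemma (siteᵢ j ! Y) (f₂ 0 ! Y) (siteᵢ i ! Y) (f₁ ε ! Y))
          where
          lemma : ∀ u f s g → u ℤ.+ f ℤ.- (s ℤ.+ g) ℤ.+ s ≡ u ℤ.+ (f ℤ.- g)
          lemma = solve-∀

        f≤ : ∀ b → ∣ f ! b ∣ ≤ 120 * m₃
        f≤ b = subst (λ z → ∣ z ∣ ≤ 120 * m₃) (sym (!-⊖ (f₂ 0) (f₁ ε) b))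
          (linear 5 (λ m₂ m₃ x y z → x :≤ 15 :* m₂ ∷ y :≤ 105 :* m₃ ∷ m₂ :≤ m₃ ∷ z :≤ x :+ y ∷ [] ⊢ z :≤ 120 :* m₃) refl
            m₂ m₃ (∣ f₂ 0 ! b ∣) (∣ f₁ ε ! b ∣) (∣ f₂ 0 ! b ℤ.- f₁ ε ! b ∣) (f₂≤ 0 z≤n b) (f₁≤ ε ε≤ b) m₂≤m₃
            (ℤ.∣i-j∣≤∣i∣+∣j∣ (f₂ 0 ! b) (f₁ ε ! b)))

        f≥ : 83 * m₂ ≤ ∣ f ! a ∣
        f≥ = linear 5 (λ m m₂ x y z → x :≤ 15 :* m₂ ∷ 100 :* m₂ :≤ y :+ m ∷ m :≤ m₂ ∷ y :≤ x :+ z ∷ [] ⊢ 83 :* m₂ :≤ z) refl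
          M m₂ (∣ f₂ 0 ! a ∣) (∣ f₁ ε ! a ∣) (∣ f ! a ∣) (f₂≤ 0 z≤n a) (f₁≥ ε) M≤m₂
          (subst (λ q → ∣ q ∣ ≤ ∣ f₂ 0 ! a ∣ + ∣ f ! a ∣) (trans (cong (λ z → f₂ 0 ! a ℤ.- z) (!-⊖ (f₂ 0) (f₁ ε) a)) (lemma (f₂ 0 ! a) (f₁ ε ! a)))
            (ℤ.∣i-j∣≤∣i∣+∣j∣ (f₂ 0 ! a) (f ! a)))
          where
          lemma : ∀ x y → x ℤ.- (x ℤ.- y) ≡ y
          lemma = solve-∀

        token-line : (siteᵢ j ⊕ f) ! a′ ≡ (siteᵢ j ⊕ path x d r₂) ! a′
        token-line = trans (!-⊕ (siteᵢ j) f a′) (trans (cong (λ z → siteᵢ j ! a′ ℤ.+ z)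
          (trans (!-⊖ (f₂ 0) (f₁ ε) a′) (trans (cong (λ z → f₂ 0 ! a′ ℤ.- z) (f₁′ ε)) (ℤ.+-identityʳ _))))
          (trans (sym (!-⊕ (siteᵢ j) (f₂ 0) a′)) (β′ 0)))

        -- The abandoned token of agent 1 lies on the line of the tour on which agent 2 dies, but
        -- too far out to be reached within `R′` steps; before this tour `avoided` applies.
        token-clear : ∀ s → at-time i < s → s ≤ E₂ → p₂ ⊕ π s ≉ p₁ ⊕ siteᵢ i
        token-clear s _ s≤ e = go (s ℕ.≤? at-time j)
          where
          at-token : π s ≈ siteᵢ j ⊕ f
          at-token = trans (cong ι (sym (⊕-identityˡ (π s)))) (trans e (cong ι left-token))
          on-tour : ∃[ r ] (r ≤ R′ × TJ.After s r) → ⊥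
          on-tour (r , r≤ , _ , s≡) = short-of a (TJ.path≤R′ r a r≤) (ℕ.≤-trans (ℕ.*-monoˡ-≤ m₂ (ℕ.m≤m+n 80 3)) f≥)
            (ℕ.≤-trans (f≤ a) (ℕ.*-monoˡ-≤ m₃ (ℕ.m≤m+n 120 5)))
            (≈-cancelˡ (siteᵢ j) (subst (_≈ siteᵢ j ⊕ f) (cong place s≡) at-token))
          go : Dec (s ≤ at-time j) → ⊥
          go (yes before) = avoided (siteᵢ j ⊕ f)
            (shifted-above (siteᵢ j) f a (site-jM a) (ℕ.≤-trans (ℕ.*-mono-≤ (ℕ.m≤m+n 10 73) M≤m₂) (ℕ.≤-trans f≥ (ℕ.m≤m+n _ M))))
            (shifted-below (siteᵢ j) f a (site-jM a) (f≤ a)) token-line s before at-token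
          go (no after) = on-tour (TJ.later s R′ TJ.R′≤R (ℕ.≰⇒> after) s≤)

        falls₁ : ∀ e q → e ≤ e₁ → p₁ ⊕ (siteᵢ i ⊕ f₁ e) ≡ q → Falls p₁ q (at-time i) E₁
        falls₁ e q e≤ hit = record
          { time = index₁ e + suc (at-time i) ; time≤ = ℕ.+-monoˡ-≤ (suc (at-time i)) (index₁≤ e e≤)
          ; visit = cong ι (trans (cong (λ α → p₁ ⊕ place α) (TI.during (index₁ e) (index₁≤ e e≤))) hit)
          ; unseen = λ s before h → proj₂ (early (siteᵢ i ⊕ f₁ e)
              (shifted-above (siteᵢ i) (f₁ e) a (site-iM a) (far-enough (f₁≥ e)))
              (shifted-below (siteᵢ i) (f₁ e) a (site-iM a) (ℕ.≤-trans (f₁≤ e e≤ a) (ℕ.*-monoˡ-≤ m₃ (ℕ.m≤m+n 105 15))))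
              s before) (≈-cancelˡ p₁ (trans h (cong ι (sym hit)))) }

        falls₂ : ∀ e → e ≤ e₂ → Falls p₂ (β e) (at-time j) E₂
        falls₂ e e≤ = record
          { time = index₂ e + suc (at-time j) ; time≤ = ℕ.+-monoˡ-≤ (suc (at-time j)) (index₂≤ e e≤)
          ; visit = cong ι (trans (⊕-identityˡ _) (cong place (TJ.during (index₂ e) (ℕ.≤-trans (index₂≤ e e≤) TJ.R′≤R))))
          ; unseen = λ s before h → avoided (β e)
              (shifted-above (siteᵢ j) (f₂ e) a (site-jM a) (f₂≥ e))
              (shifted-below (siteᵢ j) (f₂ e) a (site-jM a) (ℕ.≤-trans (f₂≤ e e≤ a) (ℕ.*-mono-≤ (ℕ.m≤m+n 15 105) m₂≤m₃)))
              (β′ e) s before (trans (cong ι (sym (⊕-identityˡ (π s)))) h) }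

        boxβ : ∀ e → e ≤ e₂ → ∀ b → ∣ β e ! b ∣ ≤ G
        boxβ e e≤ b = shifted-box (siteᵢ j) (f₂ e) b (site-jM b) (f₂≤ e e≤ b)

        boxp₁ : ∀ b → ∣ p₁ ! b ∣ ≤ G
        boxp₁ b = ℕ.≤-trans (p₁≤ b) (ℕ.*-monoˡ-≤ m₃ (ℕ.m≤m+n 125 5))

        apart : 2 < ∣ β 0 ! a ℤ.- β e₂ ! a ∣
        apart = subst (λ z → 2 < ∣ z ∣) (sym gap) (subst (2 <_) (sym (trans (ℤ.∣-i∣≡∣i∣ (+ e₂ ℤ.* v ! a)) (ℤ.abs-* (+ e₂) (v ! a))))
          (ℕ.*-mono-≤ (ℕ.*-monoʳ-≤ 3 (∣∣-positive wa≢0)) (∣∣-positive va≢0)))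
          where
          scalar : ∀ u b k e v → u ℤ.+ (b ℤ.+ (k ℤ.+ 0ℤ) ℤ.* v) ℤ.- (u ℤ.+ (b ℤ.+ (k ℤ.+ e) ℤ.* v)) ≡ ℤ.- (e ℤ.* v)
          scalar = solve-∀
          β! : ∀ e → β e ! a ≡ siteᵢ j ! a ℤ.+ (path x d r₂ ! a ℤ.+ + (10 * M + e) ℤ.* v ! a)
          β! e = trans (!-⊕ (siteᵢ j) (f₂ e) a) (cong (λ z → siteᵢ j ! a ℤ.+ z) (f₂! e a))
          gap : β 0 ! a ℤ.- β e₂ ! a ≡ ℤ.- (+ e₂ ℤ.* v ! a)
          gap = trans (cong₂ ℤ._-_ (β! 0) (β! e₂)) (scalar (siteᵢ j ! a) (path x d r₂ ! a) (+ (10 * M)) (+ e₂) (v ! a))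

        contradiction : ⊥
        contradiction = Ambiguity.ambiguity C G K large wideK (R + suc (at-time j)) TJ.bandsω TJ.bandsπ p₁ p₂ (siteᵢ i) (siteᵢ j)
          (at-time i) E₁ (at-time j) E₂ (ℕ.≤-trans E₁≤moment (ℕ.≤-trans (ℕ.n≤1+n _) (ℕ.m≤n+m _ R)))
          (ℕ.+-monoˡ-≤ (suc (at-time j)) TJ.R′≤R) boxp₁ box𝟎
          (λ b → ℕ.≤-trans (site-iM b) M≤G) (λ b → ℕ.≤-trans (site-jM b) M≤G) (TI.lost R ℕ.≤-refl) (TJ.lost R′ TJ.R′≤R)
          -- Agent 2 dies after agent 1, so agent 1 cannot meet an abandoned token.
          sync₁₂ (λ s late s≤ → ⊥-elim (ℕ.<⇒≱ late (ℕ.≤-trans s≤ E₁≤moment)))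
          (λ s _ s≤ → sync₂₁ s s≤) token-clear
          (β 0) (β e₂) (boxβ 0 z≤n) (boxβ e₂ ℕ.≤-refl) (falls₁ ε (β 0) ε≤ target) (falls₂ 0 z≤n)
          (falls₁ ε′ (β e₂) ε′≤ target′) (falls₂ e₂ ℕ.≤-refl) (a , apart)

      contradiction : ⊥
      contradiction = let ε , ε′ , ε≤ , ε′≤ , key = shifts in Shifted.contradiction ε ε′ ε≤ ε′≤ key

    -- One row and one column for all long tours

    same-tour : ∀ {k x d x′ d′} → Tour oracle k x d → Tour oracle k x′ d′ → x ≡ x′ × d ≡ d′
    same-tour T T′ = go (trans (sym T) T′)
      where
      go : {x x′ : Mind} {d d′ : Direction} → inj₂ {A = Meeting × ℤ²} (x , d) ≡ inj₂ (x′ , d′) → x ≡ x′ × d ≡ d′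
      go refl = refl , refl

    run? : ∀ a k → Dec (Run a k)
    run? a k = decide (depart (meeting oracle k)) refl
      where
      decide : ∀ w → depart (meeting oracle k) ≡ w → Dec (Run a k)
      decide (inj₁ y) e = no λ { (_ , _ , T , _) → clash (trans (sym e) T) }
        where
        clash : ∀ {y : Meeting × ℤ²} {z : Mind × Direction} → inj₁ y ≢ inj₂ z
        clash ()
      decide (inj₂ (x , d)) T = check (Walk.long? (walk x d)) (Walk.v (walk x d) ! other a ℤ.≟ 0ℤ)
        where
        check : Dec (Walk.Long (walk x d)) → Dec (Walk.v (walk x d) ! other a ≡ 0ℤ) → Dec (Run a k)
        check (yes l) (yes e) = yes (x , d , T , l , e)
        check (no ¬l) _ = no λ { (x′ , d′ , T′ , l , _) → let e , e′ = same-tour {k} T T′ in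
          ¬l (subst₂ (λ x d → Walk.Long (walk x d)) (sym e) (sym e′) l) }
        check _ (no ¬e) = no λ { (x′ , d′ , T′ , _ , v≡0) → let e , e′ = same-tour {k} T T′ in
          ¬e (subst₂ (λ x d → Walk.v (walk x d) ! other a ≡ 0ℤ) (sym e) (sym e′) v≡0) }

    -- In the second case the tour is known to follow the line of the first tour along its axis, but
    -- its token may still lie beside this line; `settled` excludes that once the tour returns.
    data Line (j : ℕ) (x : Mind) (d : Direction) : Set where
      opening : ∀ a → Straight a x d → (∀ k → k < j → ¬ Run a k) → Line j x d
      again   : ∀ a i → i < j → Run a i → Walk.v (walk x d) ! other a ≡ 0ℤ →
                (∀ r → Walk.h (walk x d) ≤ r → (siteᵢ j ⊕ path x d r) ! other a ≡ siteᵢ i ! other a) → Line j x d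

    module _ {j : ℕ} (H : History j) (x : Mind) (d : Direction) (T : Tour oracle j x d) (long : Walk.Long (walk x d)) where

      open Walk (walk x d)

      opening-line : (∀ a k → k < j → Run a k → v ! other a ≢ 0ℤ) → ∃[ a ] Straight a x d
      opening-line fresh = axis-parallel (proj₁ long) (flat j H x d T long fresh)

      along-axis : ∀ a → v ! other a ≡ 0ℤ → Line j x d
      along-axis a va′≡0 = go (search< (run? a) j)
        where
        va≢0 : v ! a ≢ 0ℤ
        va≢0 = nonzero-along a (proj₁ long) va′≡0
        go : (∃[ i ] (i < j × Run a i × (∀ k → k < i → ¬ Run a k))) ⊎ (∀ k → k < j → ¬ Run a k) → Line j x d
        go (inj₂ none) = opening a (straight-along {a} {x} {d} (proj₁ long) va′≡0 (opening-line fresh)) none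
          where
          fresh : ∀ b k → k < j → Run b k → v ! other b ≢ 0ℤ
          fresh b k k<j run = case (same-or-other a b)
            where
            case : b ≡ a ⊎ b ≡ other a → v ! other b ≢ 0ℤ
            case (inj₁ b≡) = ⊥-elim (none k k<j (subst (λ b → Run b k) b≡ run))
            case (inj₂ b≡) e = va≢0 (subst (λ c → v ! c ≡ 0ℤ) (trans (cong other b≡) (other-other a)) e)
        go (inj₁ (i , i<j , run@(xᵢ , dᵢ , Tᵢ , longᵢ , alongᵢ) , first)) = again a i i<j run va′≡0 on-line
          where
          on-line : ∀ r → h ≤ r → (siteᵢ j ⊕ path x d r) ! other a ≡ siteᵢ i ! other a
          on-line r h≤r = decide ((siteᵢ j ⊕ path x d r) ! other a ℤ.≟ siteᵢ i ! other a)
            where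
            decide : Dec ((siteᵢ j ⊕ path x d r) ! other a ≡ siteᵢ i ! other a) → (siteᵢ j ⊕ path x d r) ! other a ≡ siteᵢ i ! other a
            decide (yes e) = e
            decide (no ne) = let k , q , h≤q , q< , r≡ = phase r h≤r in
              ⊥-elim (ParallelKill.contradiction j H x d T long a va′≡0 i i<j xᵢ dᵢ Tᵢ longᵢ alongᵢ first q h≤q q<
                (λ e → ne (trans (same-phase k q h≤q r≡) e)))
              where
              same-phase : ∀ k q → h ≤ q → r ≡ k * p + q → (siteᵢ j ⊕ path x d r) ! other a ≡ (siteᵢ j ⊕ path x d q) ! other a
              same-phase k q h≤q r≡ = trans (!-⊕ (siteᵢ j) (path x d r) (other a)) (trans (cong (λ z → siteᵢ j ! other a ℤ.+ z)
                (trans (cong (λ r → path x d r ! other a) r≡) (trans (cong (_! other a) (laps k q h≤q))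
                  (trans (!-⊕ (path x d q) (+ k ⊛ v) (other a)) (trans (cong (λ z → path x d q ! other a ℤ.+ z)
                    (trans (!-⊛ (+ k) v (other a)) (trans (cong (λ z → + k ℤ.* z) va′≡0) (ℤ.*-zeroʳ (+ k))))) (ℤ.+-identityʳ _))))))
                (sym (!-⊕ (siteᵢ j) (path x d q) (other a))))

      line : Line j x d
      line = go (v ! Y ℤ.≟ 0ℤ) (v ! X ℤ.≟ 0ℤ)
        where
        go : Dec (v ! Y ≡ 0ℤ) → Dec (v ! X ≡ 0ℤ) → Line j x d
        go (yes e) _ = along-axis X e
        go _ (yes e) = along-axis Y e
        -- A drift with two nonzero coordinates is parallel to no earlier line. So the tour counts
        -- as fresh and would have to follow an axis.
        go (no y≢0) (no x≢0) = neither (opening-line (λ { X _ _ _ → y≢0 ; Y _ _ _ → x≢0 }))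
          where
          neither : ∃[ a ] Straight a x d → Line j x d
          neither (X , e , _) = ⊥-elim (y≢0 e)
          neither (Y , e , _) = ⊥-elim (x≢0 e)

      returns-late : ∀ r → path x d r ≈ 𝟎 → h ≤ r
      returns-late r back = decide (h ℕ.≤? r)
        where
        decide : Dec (h ≤ r) → h ≤ r
        decide (yes late) = late
        decide (no early) = ⊥-elim (long-gone {x} {d} long r (ℕ.≤-<-trans (ℕ.≤-trans (ℕ.≰⇒> early)
            (h≤M x d))
          (linear 4 (λ m m₂ m₃ n → m :≤ m₂ ∷ m₂ :≤ m₃ ∷ 10000 :* m₃ :< n ∷ con 2 :≤ m ∷ [] ⊢ m :< n) refl M m₂ m₃ N M≤m₂ m₂≤m₃ wide 2≤M)) back)

      -- On the common line the offset across the axis is constant and small. At the return it is a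
      -- multiple of N, hence zero: the token lies on the line as well.
      settled : ∀ r → path x d r ≈ 𝟎 → ∃[ a ] (Straight a x d × ∀ k → k < j → Run a k → siteᵢ k ! other a ≡ siteᵢ j ! other a)
      settled r back = go line
        where
        go : Line j x d → ∃[ a ] (Straight a x d × ∀ k → k < j → Run a k → siteᵢ k ! other a ≡ siteᵢ j ! other a)
        go (opening a straight none) = a , straight , λ k k<j run → ⊥-elim (none k k<j run)
        go (again a i i<j run va′≡0 on-line) = a , (va′≡0 , pure)
          , λ k k<j runₖ → trans (History.aligned H a k i k<j i<j runₖ run) (sym same)
          where
          a′ = other a
          sums : ∀ r → h ≤ r → siteᵢ j ! a′ ℤ.+ path x d r ! a′ ≡ siteᵢ i ! a′
          sums r late = trans (sym (!-⊕ (siteᵢ j) (path x d r) a′)) (on-line r late)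
          small : ∣ path x d r ! a′ ∣ ≤ 2 * M
          small = linear 4 (λ m x y z → x :≤ m ∷ y :≤ m ∷ z :≤ y :+ x ∷ [] ⊢ z :≤ 2 :* m) refl M (∣ siteᵢ j ! a′ ∣) (∣ siteᵢ i ! a′ ∣) (∣ path x d r ! a′ ∣)
            (small-site (History.i≤M H) a′) (small-site (ℕ.≤-trans (ℕ.<⇒≤ i<j) (History.i≤M H)) a′)
            (proj₂ (proj₂ (sum-size (siteᵢ j ! a′) (path x d r ! a′) (siteᵢ i ! a′) (sums r (returns-late r back)))))
          zero-return : path x d r ! a′ ≡ 0ℤ
          zero-return = trans (≈-small a′ back (subst (λ z → ∣ path x d r ! a′ ∣ + ∣ z ∣ < N) (sym (𝟎! a′))
            (linear 5 (λ m m₂ m₃ n z → z :≤ 2 :* m ∷ m :≤ m₂ ∷ m₂ :≤ m₃ ∷ 10000 :* m₃ :< n ∷ [] ⊢ z :+ con 0 :< n) refl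
              M m₂ m₃ N (∣ path x d r ! a′ ∣) small M≤m₂ m₂≤m₃ wide))) (𝟎! a′)
          same : siteᵢ j ! a′ ≡ siteᵢ i ! a′
          same = trans (sym (trans (cong (λ z → siteᵢ j ! a′ ℤ.+ z) zero-return) (ℤ.+-identityʳ _))) (sums r (returns-late r back))
          pure : ∀ r → h ≤ r → path x d r ! a′ ≡ 0ℤ
          pure r late = +-zero {siteᵢ j ! a′} (trans (sums r late) (sym same))

    along-unique : ∀ {x d} a b → Walk.Long (walk x d) → Walk.v (walk x d) ! other a ≡ 0ℤ → Walk.v (walk x d) ! other b ≡ 0ℤ → b ≡ a
    along-unique {x} {d} a b long e e′ = go (same-or-other a b)
      where
      go : b ≡ a ⊎ b ≡ other a → b ≡ a
      go (inj₁ b≡) = b≡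
      go (inj₂ b≡) = ⊥-elim (nonzero-along a (proj₁ long) e
        (subst (λ c → Walk.v (walk x d) ! c ≡ 0ℤ) (trans (cong other b≡) (other-other a)) e′))

    initially : History 0
    initially = record { i≤M = z≤n ; reached = λ _ () ; tame = λ _ _ _ () ; aligned = λ _ _ _ () }

    extend : ∀ {j} → History j → suc j ≤ M → ¬ Lost oracle j → History (suc j)
    extend {j} H sj≤M found = record
      { i≤M = sj≤M
      ; reached = λ k k< → earlier-or-last k k< (λ k<j → reached k k<j) (λ e → subst (λ k → ¬ Lost oracle k) (sym e) found)
      ; tame = λ k x d k< T long → earlier-or-last k k< (λ k<j → tame k x d k<j T long)
          (λ e → let T′ = subst (λ k → Tour oracle k x d) e T ; a , s , _ = settled H x d T′ long (proj₁ (ret x d T′)) (proj₂ (ret x d T′)) in a , s)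
      ; aligned = λ a k l k< l< runₖ runₗ → earlier-or-last k k<
          (λ k<j → earlier-or-last l l< (λ l<j → aligned a k l k<j l<j runₖ runₗ)
             (λ e → trans (meet a k k<j runₖ (subst (Run a) e runₗ)) (cong (λ l → siteᵢ l ! other a) (sym e))))
          (λ e → earlier-or-last l l< (λ l<j → trans (cong (λ k → siteᵢ k ! other a) e) (sym (meet a l l<j runₗ (subst (Run a) e runₖ))))
             (λ e′ → cong (λ k → siteᵢ k ! other a) (trans e (sym e′)))) }
      where
      open History H
      earlier-or-last : ∀ {P : Set} k → k < suc j → (k < j → P) → (k ≡ j → P) → P
      earlier-or-last k k< f g = go (ℕ.m≤n⇒m<n∨m≡n (ℕ.≤-pred k<))
        where
        go : k < j ⊎ k ≡ j → _
        go (inj₁ k<j) = f k<j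
        go (inj₂ e)   = g e
      ret : ∀ x d → Tour oracle j x d → ∃[ r ] path x d r ≈ 𝟎
      ret x d T = go (oracle x d)
        where
        go : Dec (∃[ r ] path x d r ≈ 𝟎) → ∃[ r ] path x d r ≈ 𝟎
        go (yes w)    = w
        go (no never) = ⊥-elim (found (x , d , T , λ r e → never (r , e)))
      meet : ∀ a k → k < j → Run a k → Run a j → siteᵢ k ! other a ≡ siteᵢ j ! other a
      meet a k k<j runₖ (x , d , T , long , v≡0) = go (settled H x d T long (proj₁ (ret x d T)) (proj₂ (ret x d T)))
        where
        go : ∃[ b ] (Straight b x d × ∀ k → k < j → Run b k → siteᵢ k ! other b ≡ siteᵢ j ! other b) → siteᵢ k ! other a ≡ siteᵢ j ! other a
        go (b , (v≡0′ , _) , all) = subst (λ b → Run b k → siteᵢ k ! other b ≡ siteᵢ j ! other b)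
          (along-unique {x} {d} a b long v≡0 v≡0′) (all k k<j) runₖ

    -- An agent that never meets its token again stays in bands forever.
    not-lost : ∀ {j} → History j → ¬ Lost oracle j
    not-lost {j} H (x , d , T , never) = Corner.stay-forever (4 * M) (8 * M)
      (linear 1 (λ m → con 2 :≤ m ∷ [] ⊢ 4 :* m :+ con 3 :≤ 8 :* m) refl M 2≤M)
      (linear 4 (λ m m₂ m₃ n → m :≤ m₂ ∷ m₂ :≤ m₃ ∷ 10000 :* m₃ :< n ∷ [] ⊢ 10 :* (8 :* m) :< n) refl M m₂ m₃ N M≤m₂ m₂≤m₃ wide)
      (λ s → proj₁ (bands s)) (λ s → proj₂ (bands s))
      where
      open Walk (walk x d)
      Bands : ℕ → Set
      Bands s = (∃[ a ] ∣ ω s ! a ∣ ≤ 4 * M) × (∃[ a ] ∣ π s ! a ∣ ≤ 4 * M)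
      raise : ∀ {n} k → k ≤ 4 → n ≤ k * M → n ≤ 4 * M
      raise k h h′ = ℕ.≤-trans h′ (ℕ.*-monoˡ-≤ M h)
      once : ∀ {n} → n ≤ M → n ≤ 1 * M
      once h = ℕ.≤-trans h (ℕ.≤-reflexive (sym (ℕ.*-identityˡ M)))
      banded : ∀ s → Spot j s → Bands s
      banded s (inj₁ (boxω , boxπ)) = (X , raise 1 (s≤s z≤n) (once (boxω X))) , (X , raise 2 (s≤s (s≤s z≤n)) (boxπ X))
      banded s (inj₂ (a , k , k<j , _ , e , e′)) = (other a , subst (λ z → ∣ z ∣ ≤ 4 * M) (sym e) z≤n)
        , (other a , subst (λ z → ∣ z ∣ ≤ 4 * M) (sym e′)
             (raise 1 (s≤s z≤n) (once (small-site (ℕ.≤-trans (ℕ.<⇒≤ k<j) (History.i≤M H)) (other a)))))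
      sum≤ : ∀ a y → ∣ y ! a ∣ ≤ 2 * M → ∣ (siteᵢ j ⊕ y) ! a ∣ ≤ 4 * M
      sum≤ a y h = linear 4 (λ m u y z → u :≤ m ∷ y :≤ 2 :* m ∷ z :≤ u :+ y ∷ [] ⊢ z :≤ 4 :* m) refl M (∣ siteᵢ j ! a ∣) (∣ y ! a ∣) (∣ (siteᵢ j ⊕ y) ! a ∣)
        (small-site (History.i≤M H) a) h (proj₁ (⊕-size (siteᵢ j) y a))
      band-path : ∀ q → ∃[ a ] ∣ path x d q ! a ∣ ≤ 2 * M
      band-path q = go long?
        where
        go : Dec Long → ∃[ a ] ∣ path x d q ! a ∣ ≤ 2 * M
        go (no short) = X , ≤2M (ℕ.≤-trans (short-bound short q (λ r _ e → never r (cong ι e)) X) horizon≤M)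
        go (yes long) = side (h ℕ.≤? q) (line H x d T long)
          where
          side : Dec (h ≤ q) → Line j x d → ∃[ a ] ∣ path x d q ! a ∣ ≤ 2 * M
          side (no early) _ = X , ≤2M (ℕ.≤-trans (bound q X) (ℕ.≤-trans (ℕ.≰⇒> early) (h≤M x d)))
          side (yes late) (opening a (_ , pure) _) = other a , subst (λ z → ∣ z ∣ ≤ 2 * M) (sym (pure q late)) z≤n
          side (yes late) (again a i i<j _ _ on-line) = other a ,
            linear 4 (λ m x y z → x :≤ m ∷ y :≤ m ∷ z :≤ y :+ x ∷ [] ⊢ z :≤ 2 :* m) refl M (∣ siteᵢ j ! other a ∣) (∣ siteᵢ i ! other a ∣) (∣ path x d q ! other a ∣)
              (small-site (History.i≤M H) (other a)) (small-site (ℕ.≤-trans (ℕ.<⇒≤ i<j) (History.i≤M H)) (other a))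
              (proj₂ (proj₂ (sum-size (siteᵢ j ! other a) (path x d q ! other a) (siteᵢ i ! other a)
                (trans (sym (!-⊕ (siteᵢ j) (path x d q) (other a))) (on-line q late)))))
      bands : ∀ s → Bands s
      bands s = go (s ℕ.≤? at-time j)
        where
        go : Dec (s ≤ at-time j) → Bands s
        go (yes before) = banded s (spot H s before)
        go (no after) = (a , subst (λ z → ∣ z ! a ∣ ≤ 4 * M) (sym (cong offset now)) (raise 2 (s≤s (s≤s z≤n)) small))
                      , (a , subst (λ z → ∣ z ! a ∣ ≤ 4 * M) (sym (cong place now)) (sum≤ a (path x d q) small))
          where
          q : ℕ
          q = s ℕ.∸ suc (at-time j)
          now : cfg s ≡ away (freely x q) (siteᵢ j) (path x d q)
          now = trans (cong cfg (sym (ℕ.m∸n+n≡m (ℕ.≰⇒> after)))) (touring oracle j x d T (visited oracle j (History.reached H)) q (λ r _ → never r))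
          a = proj₁ (band-path q)
          small = proj₂ (band-path q)

    history : ∀ j → j ≤ M → History j
    history zero    _    = initially
    history (suc j) sj≤M = let H = history j (ℕ.<⇒≤ sj≤M) in extend H sj≤M (not-lost H)

    -- Recurrence of meetings and a black hole that nobody finds

    bit : Bool → Fin 2
    bit false = zero
    bit true  = suc zero

    bit-injective : ∀ {b c} → bit b ≡ bit c → b ≡ c
    bit-injective {false} {false} _ = refl
    bit-injective {true}  {true}  _ = refl
    bit-injective {false} {true}  ()
    bit-injective {true}  {false} ()

    encode : Meeting → Fin (minds * 2)
    encode (x , c) = combine (number x) (bit c)

    encode-injective : ∀ {y y′} → encode y ≡ encode y′ → y ≡ y′
    encode-injective {x , c} {x′ , c′} e with Fin.combine-injective (number x) (bit c) (number x′) (bit c′) e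
    ... | e₁ , e₂ = cong₂ _,_ (number-injective e₁) (bit-injective e₂)

    abstract
      recurrence : ∃[ a ] ∃[ b ] (a < b × b ≤ minds * 2 × meeting oracle a ≡ meeting oracle b)
      recurrence with Fin.pigeonhole {m = minds * 2} ℕ.≤-refl (λ i → encode (meeting oracle (toℕ i)))
      ... | i , j , i<j , e = toℕ i , toℕ j , i<j , ℕ.≤-pred (Fin.toℕ<n j) , encode-injective e

    a b : ℕ
    a = proj₁ recurrence
    b = proj₁ (proj₂ recurrence)

    a<b : a < b
    a<b = proj₁ (proj₂ (proj₂ recurrence))

    b+b≤M : b + b ≤ M
    b+b≤M = linear 4 (λ c b d m → b :≤ d ∷ d :≡ 2 :* c ∷ 4 :* c :≤ m ∷ [] ⊢ b :+ b :≤ m) refl minds b (minds * 2) M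
      (proj₁ (proj₂ (proj₂ (proj₂ recurrence)))) (ℕ.*-comm minds 2) turns≤M

    b≤M : b ≤ M
    b≤M = ℕ.≤-trans (ℕ.m≤m+n b b) b+b≤M

    V : ℤ²
    V = siteᵢ b ⊖ siteᵢ a

    repeats : ∀ e → meeting oracle (e + b) ≡ meeting oracle (e + a) × siteᵢ (e + b) ≡ siteᵢ (e + a) ⊕ V
    repeats zero    = sym (proj₂ (proj₂ (proj₂ (proj₂ recurrence)))) , sym (⊕-inverse (siteᵢ b) (siteᵢ a))
    repeats (suc e) = let m , s = repeats e in
      meeting-step oracle (e + b) (e + a) m , site-step oracle (e + b) (e + a) V m s

    -- The last component says that a positive number k of periods occurs only for `n′` in the
    -- periodic part, so that the tour can be compared with its copy one period later.
    Reduced : ℕ → Set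
    Reduced n = ∃[ n′ ] ∃[ k ] (n′ < b × meeting oracle n ≡ meeting oracle n′ × siteᵢ n ≡ siteᵢ n′ ⊕ + k ⊛ V × (k ≡ 0 ⊎ a ≤ n′))

    reduced : ∀ n → Reduced n
    reduced zero = 0 , 0 , ℕ.≤-<-trans z≤n a<b , refl , sym (trans (cong (𝟎 ⊕_) (zero-times V)) (⊕-identityʳ 𝟎)) , inj₁ refl
      where
      zero-times : ∀ V → 0ℤ ⊛ V ≡ 𝟎
      zero-times (x , y) = refl
    reduced (suc n) = advance (reduced n)
      where
      advance : Reduced n → Reduced (suc n)
      advance (n′ , k , n′<b , m , s , late) = go (ℕ.m≤n⇒m<n∨m≡n n′<b)
        where
        m′ : meeting oracle (suc n) ≡ meeting oracle (suc n′)
        m′ = meeting-step oracle n n′ m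
        s′ : siteᵢ (suc n) ≡ siteᵢ (suc n′) ⊕ + k ⊛ V
        s′ = site-step oracle n n′ (+ k ⊛ V) m s
        later : k ≡ 0 ⊎ a ≤ n′ → k ≡ 0 ⊎ a ≤ suc n′
        later (inj₁ e) = inj₁ e
        later (inj₂ h) = inj₂ (ℕ.m≤n⇒m≤1+n h)
        wrap : ∀ z V k → z ⊕ V ⊕ k ⊛ V ≡ z ⊕ (1ℤ ℤ.+ k) ⊛ V
        wrap (x , y) (v , w) k = cong₂ _,_ (lemma x v k) (lemma y w k)
          where
          lemma : ∀ x v k → x ℤ.+ v ℤ.+ k ℤ.* v ≡ x ℤ.+ (1ℤ ℤ.+ k) ℤ.* v
          lemma = solve-∀
        go : suc n′ < b ⊎ suc n′ ≡ b → Reduced (suc n)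
        go (inj₁ h) = suc n′ , k , h , m′ , s′ , later late
        go (inj₂ e) = a , suc k , a<b , trans (trans m′ (cong (meeting oracle) e)) (proj₁ (repeats 0))
          , trans (trans s′ (cong (λ i → siteᵢ i ⊕ + k ⊛ V) e)) (trans (cong (_⊕ + k ⊛ V) (proj₂ (repeats 0))) (wrap (siteᵢ a) V (+ k)))
          , inj₂ ℕ.≤-refl

    same-tours : ∀ {n n′ x d} → meeting oracle n ≡ meeting oracle n′ → Tour oracle n x d → Tour oracle n′ x d
    same-tours e T = trans (cong depart (sym e)) T

    -- Being lost depends on the meeting alone, and every meeting already occurs before index b,
    -- where `not-lost` applies.
    found : ∀ n → ¬ Lost oracle n
    found n (x , d , T , never) = let n′ , k , n′<b , m , _ = reduced n in
      not-lost (history n′ (ℕ.≤-trans (ℕ.<⇒≤ n′<b) b≤M)) (x , d , same-tours {n} {n′} m T , never)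

    late-moment : ∀ n → n ≤ at-time n
    late-moment zero    = z≤n
    late-moment (suc n) = ℕ.≤-<-trans (late-moment n) (moment-suc n (found n))

    V≤ : ∀ c → ∣ V ! c ∣ ≤ 2 * M
    V≤ c = subst (λ z → ∣ z ∣ ≤ 2 * M) (sym (!-⊖ (siteᵢ b) (siteᵢ a) c))
      (linear 4 (λ m x y z → x :≤ m ∷ y :≤ m ∷ z :≤ x :+ y ∷ [] ⊢ z :≤ 2 :* m) refl M (∣ siteᵢ b ! c ∣) (∣ siteᵢ a ! c ∣) (∣ siteᵢ b ! c ℤ.- siteᵢ a ! c ∣)
        (small-site b≤M c) (small-site (ℕ.≤-trans (ℕ.<⇒≤ a<b) b≤M) c) (ℤ.∣i-j∣≤∣i∣+∣j∣ (siteᵢ b ! c) (siteᵢ a ! c)))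

    -- The direction of the strip swept by the token: its drift V, or an arbitrary direction when
    -- the token does not drift.
    Guide : ℤ² → Set
    Guide W = W ≢ 𝟎 × (∀ c → ∣ W ! c ∣ ≤ 2 * M) × (∀ k → level W (k ⊛ V) ≡ 0ℤ)

    guide : ∃[ W ] Guide W
    guide = go (≡-dec ℤ._≟_ ℤ._≟_ V 𝟎)
      where
      one : ∣ 1ℤ ∣ ≤ 2 * M
      one = ℕ.≤-trans (s≤s z≤n) (ℕ.≤-trans 2≤M (ℕ.m≤m+n M (M + 0)))
      go : Dec (V ≡ 𝟎) → ∃[ W ] Guide W
      go (no V≢𝟎)  = V , V≢𝟎 , V≤ , λ k → level-self k V
      go (yes V≡𝟎) = (1ℤ , 0ℤ) , (λ ()) , (λ { X → one ; Y → z≤n })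
        , λ k → trans (cong (λ v → level (1ℤ , 0ℤ) (k ⊛ v)) V≡𝟎) (level-zero k (1ℤ , 0ℤ))

    W : ℤ²
    W = proj₁ guide

    Seen : ℕ → Set
    Seen s = (∃[ c ] ∣ ω s ! c ∣ ≤ M) × (∣ level W (π s) ∣ ≤ 8 * m₂ ⊎ ∃[ c ] ∣ π s ! c ∣ ≤ M)

    near-track : ∀ s k ω₀ → ω s ≡ ω₀ → π s ≡ siteᵢ k ⊕ ω₀ → (∀ c → ∣ ω₀ ! c ∣ ≤ M) → Seen s
    near-track s k ω₀ ω≡ π≡ box = (X , subst (λ z → ∣ z ! X ∣ ≤ M) (sym ω≡) (box X)) , inj₁ (close (reduced k))
      where
      close : Reduced k → ∣ level W (π s) ∣ ≤ 8 * m₂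
      close (n′ , k′ , n′<b , _ , site≡ , _) = subst (λ z → ∣ z ∣ ≤ 8 * m₂) (sym eq)
        (ℕ.≤-trans (∣level∣ W (siteᵢ n′ ⊕ ω₀) (2 * M) (2 * M) (2 * M) (proj₁ (proj₂ (proj₂ guide))) (small X) (small Y))
          (ℕ.≤-reflexive (trans (cong₂ _+_ square square) refl′)))
        where
        small : ∀ c → ∣ (siteᵢ n′ ⊕ ω₀) ! c ∣ ≤ 2 * M
        small c = linear 4 (λ m x y z → x :≤ m ∷ y :≤ m ∷ z :≤ x :+ y ∷ [] ⊢ z :≤ 2 :* m) refl M (∣ siteᵢ n′ ! c ∣) (∣ ω₀ ! c ∣) (∣ (siteᵢ n′ ⊕ ω₀) ! c ∣)
          (small-site (ℕ.≤-trans (ℕ.<⇒≤ n′<b) b≤M) c) (box c) (proj₁ (⊕-size (siteᵢ n′) ω₀ c))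
        square : 2 * M * (2 * M) ≡ 4 * m₂
        square = trans (ℕ.*-assoc 2 M (2 * M)) (trans (cong (2 *_) (trans (ℕ.*-comm M (2 * M)) (ℕ.*-assoc 2 M M))) (sym (ℕ.*-assoc 2 2 m₂)))
        refl′ : 4 * m₂ + 4 * m₂ ≡ 8 * m₂
        refl′ = sym (ℕ.*-distribʳ-+ m₂ 4 4)
        eq : level W (π s) ≡ level W (siteᵢ n′ ⊕ ω₀)
        eq = trans (cong (level W) (trans π≡ (trans (cong (_⊕ ω₀) site≡) (swap (siteᵢ n′) (+ k′ ⊛ V) ω₀))))
          (trans (level-⊕ W (siteᵢ n′ ⊕ ω₀) (+ k′ ⊛ V)) (trans (cong (λ z → level W (siteᵢ n′ ⊕ ω₀) ℤ.+ z) (proj₂ (proj₂ (proj₂ guide)) (+ k′)))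
            (ℤ.+-identityʳ _)))

    on-tour : ∀ s k x d q → Tour oracle k x d → Gone oracle x d q → ω s ≡ path x d q → π s ≡ siteᵢ k ⊕ path x d q → Seen s
    on-tour s k x d q T absent ω≡ π≡ = go long? (h ℕ.≤? q)
      where
      open Walk (walk x d)
      go : Dec Long → Dec (h ≤ q) → Seen s
      go (no short) _ = near-track s k (path x d q) ω≡ π≡ (λ c → ℕ.≤-trans (short-bound short q (λ r r≤q e → absent r r≤q (cong ι e)) c) horizon≤M)
      go (yes _) (no early) = near-track s k (path x d q) ω≡ π≡ (λ c → ℕ.≤-trans (bound q c) (ℕ.≤-trans (ℕ.≰⇒> early)
        (h≤M x d)))
      go (yes long) (yes late) = far (reduced k)
        where
        far : Reduced k → Seen s
        far (n′ , k′ , n′<b , m , site≡ , late-or-first) = in-band (History.tame (history b b≤M) n′ x d n′<b T′ long)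
          where
          T′ : Tour oracle n′ x d
          T′ = same-tours {k} {n′} m T
          in-band : ∃[ c ] Straight c x d → Seen s
          in-band (c , v≡0 , pure) = (other c , subst (λ z → ∣ z ∣ ≤ M) (sym (trans (cong (_! other c) ω≡) (pure q late))) z≤n)
            , inj₂ (other c , subst (λ z → ∣ z ∣ ≤ M) (sym column) (small-site (ℕ.≤-trans (ℕ.<⇒≤ n′<b) b≤M) (other c)))
            where
            -- The same long tour is made again one period later, at an index below b + b, which is
            -- still covered by a history. `aligned` for these two tours leaves V no component
            -- across their axis.
            no-drift : k′ ≡ 0 ⊎ a ≤ n′ → + k′ ℤ.* V ! other c ≡ 0ℤ
            no-drift (inj₁ refl) = ℤ.*-zeroˡ (V ! other c)
            no-drift (inj₂ a≤n′) = trans (cong (λ z → + k′ ℤ.* z) V≡0) (ℤ.*-zeroʳ (+ k′))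
              where
              e : ℕ
              e = n′ ℕ.∸ a
              n′≡ : e + a ≡ n′
              n′≡ = ℕ.m∸n+n≡m a≤n′
              e+b< : e + b < b + b
              e+b< = ℕ.+-monoˡ-< b (ℕ.≤-<-trans (ℕ.m∸n≤m n′ a) n′<b)
              same : siteᵢ (e + b) ! other c ≡ siteᵢ n′ ! other c
              same = History.aligned (history (b + b) b+b≤M) c (e + b) n′ e+b< (ℕ.<-≤-trans n′<b (ℕ.m≤m+n b b))
                (x , d , same-tours {n′} {e + b} (trans (cong (meeting oracle) (sym n′≡)) (sym (proj₁ (repeats e)))) T′ , long , v≡0)
                (x , d , T′ , long , v≡0)
              V≡0 : V ! other c ≡ 0ℤ
              V≡0 = +-zero {siteᵢ n′ ! other c} (trans (sym (trans (cong (_! other c)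
                (trans (proj₂ (repeats e)) (cong (λ i → siteᵢ i ⊕ V) n′≡))) (!-⊕ (siteᵢ n′) V (other c)))) same)
            column : π s ! other c ≡ siteᵢ n′ ! other c
            column = trans (cong (_! other c) (trans π≡ (cong (_⊕ path x d q) site≡)))
              (trans (!-⊕ (siteᵢ n′ ⊕ + k′ ⊛ V) (path x d q) (other c)) (trans (cong₂ ℤ._+_
                (trans (!-⊕ (siteᵢ n′) (+ k′ ⊛ V) (other c)) (trans (cong (λ z → siteᵢ n′ ! other c ℤ.+ z)
                  (trans (!-⊛ (+ k′) V (other c)) (no-drift late-or-first))) (ℤ.+-identityʳ (siteᵢ n′ ! other c))))
                (pure q late)) (ℤ.+-identityʳ (siteᵢ n′ ! other c))))

    seen : ∀ s → Seen s
    seen s = go (phases oracle (suc s) (λ k _ → found k) s (late-moment (suc s)))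
      where
      go : ∃[ k ] (k < suc s × Phase oracle s k) → Seen s
      go (k , _ , meets e) = near-track s k 𝟎 (cong offset e) (cong place e) (λ c → subst (λ z → ∣ z ∣ ≤ M) (sym (𝟎! c)) z≤n)
      go (k , _ , tours x d q T absent _ e) = on-tour s k x d q T absent (cong offset e) (cong place e)

    open Diagonal (2 * M) (linear 1 (λ m → con 2 :≤ m ∷ [] ⊢ con 3 :≤ 2 :* m) refl M 2≤M) M
      (linear 1 (λ m → con 2 :≤ m ∷ [] ⊢ m :< 2 :* m) refl M 2≤M)
      (linear 4 (λ m m₂ m₃ n → m :≤ m₂ ∷ m₂ :≤ m₃ ∷ 10000 :* m₃ :< n ∷ con 2 :≤ m ∷ [] ⊢ 10 :* (2 :* m) :< n) refl M m₂ m₃ N M≤m₂ m₂≤m₃ wide 2≤M)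

    Z L : ℕ
    Z = 100 * m₂
    L = 4 * M

    -- The vector (1, L) is parallel to no possible guide, because L = 4M exceeds the coordinates of
    -- W. So the level of `b₀` is a nonzero multiple of Z, outside the strip, and both coordinates
    -- are too large for the row and the column.
    b₀ : ℤ²
    b₀ = + Z , + (Z * L)

    Z*L≡ : Z * L ≡ 400 * m₃
    Z*L≡ = trans (ℕ.*-assoc 100 m₂ (4 * M)) (trans (cong (100 *_) (trans (ℕ.*-comm m₂ (4 * M)) (ℕ.*-assoc 4 M m₂))) (sym (ℕ.*-assoc 100 4 m₃)))

    diagonal≤ : ∀ i c → ∣ diagonal i ! c ∣ ≤ 4 * M
    diagonal≤ i c = subst (_≤ 4 * M) (sym (∣diagonal∣ i c)) (ℕ.≤-trans (at-most i) (ℕ.≤-reflexive (sym (ℕ.*-assoc 2 2 M))))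

    b₀-size : ∀ c → 100 * m₂ ≤ ∣ b₀ ! c ∣ × ∣ b₀ ! c ∣ ≤ 400 * m₃
    b₀-size X = ℕ.≤-refl , linear 2 (λ m₂ m₃ → m₂ :≤ m₃ ∷ [] ⊢ 100 :* m₂ :≤ 400 :* m₃) refl m₂ m₃ m₂≤m₃
    b₀-size Y = subst (100 * m₂ ≤_) (sym Z*L≡) (linear 2 (λ m₂ m₃ → m₂ :≤ m₃ ∷ [] ⊢ 100 :* m₂ :≤ 400 :* m₃) refl m₂ m₃ m₂≤m₃)
              , ℕ.≤-reflexive Z*L≡

    level-b₀≥ : 100 * m₂ ≤ ∣ level W b₀ ∣
    level-b₀≥ = subst (λ z → Z ≤ ∣ z ∣) (sym factored) (subst (Z ≤_) (sym (ℤ.abs-* (+ Z) slope))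
      (ℕ.≤-trans (ℕ.≤-reflexive (sym (ℕ.*-identityʳ Z))) (ℕ.*-monoʳ-≤ Z (∣∣-positive slope≢0))))
      where
      slope : ℤ
      slope = W ! X ℤ.* + L ℤ.- W ! Y
      factored : level W b₀ ≡ + Z ℤ.* slope
      factored = trans (cong (λ z → W ! X ℤ.* z ℤ.- W ! Y ℤ.* + Z) (ℤ.pos-* Z L)) (lemma (W ! X) (W ! Y) (+ Z) (+ L))
        where
        lemma : ∀ x y z l → x ℤ.* (z ℤ.* l) ℤ.- y ℤ.* z ≡ z ℤ.* (x ℤ.* l ℤ.- y)
        lemma = solve-∀
      slope≢0 : slope ≢ 0ℤ
      slope≢0 e = steep (W ! X ℤ.≟ 0ℤ)
        where
        equal : W ! X ℤ.* + L ≡ W ! Y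
        equal = ℤ.i-j≡0⇒i≡j _ _ e
        steep : Dec (W ! X ≡ 0ℤ) → ⊥
        steep (yes x≡0) = proj₁ (proj₂ guide) (cong₂ _,_ x≡0 (trans (sym equal) (trans (cong (ℤ._* + L) x≡0) (ℤ.*-zeroˡ (+ L)))))
        steep (no x≢0) = ℕ.<⇒≱ (linear 1 (λ m → con 2 :≤ m ∷ [] ⊢ 2 :* m :< 4 :* m) refl M 2≤M)
          (ℕ.≤-trans (subst (L ≤_) (trans (sym (ℤ.abs-* (W ! X) (+ L))) (cong ∣_∣ equal))
            (ℕ.≤-trans (ℕ.≤-reflexive (sym (ℕ.*-identityˡ L))) (ℕ.*-monoˡ-≤ L (∣∣-positive x≢0)))) (proj₁ (proj₂ (proj₂ guide)) Y))

    level-b₀≤ : ∣ level W b₀ ∣ ≤ 1000 * m₄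
    level-b₀≤ = ℕ.≤-trans (∣level∣ W b₀ (2 * M) (100 * m₂) (400 * m₃) (proj₁ (proj₂ (proj₂ guide))) ℕ.≤-refl (ℕ.≤-reflexive Z*L≡))
      (linear 4 (λ m₃ m₄ x y → x :≡ 800 :* m₄ ∷ y :≡ 200 :* m₃ ∷ m₃ :≤ m₄ ∷ [] ⊢ x :+ y :≤ 1000 :* m₄) refl m₃ m₄ (2 * M * (400 * m₃)) (2 * M * (100 * m₂))
        (times 2 400 M m₃) (times 2 100 M m₂) m₃≤m₄)
      where
      times : ∀ p q x y → p * x * (q * y) ≡ p * q * (x * y)
      times p q x y = begin
        p * x * (q * y)   ≡⟨ ℕ.*-assoc p x (q * y) ⟩
        p * (x * (q * y)) ≡⟨ cong (p *_) (trans (sym (ℕ.*-assoc x q y)) (trans (cong (_* y) (ℕ.*-comm x q)) (ℕ.*-assoc q x y))) ⟩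
        p * (q * (x * y)) ≡⟨ ℕ.*-assoc p q (x * y) ⟨
        p * q * (x * y)   ∎
        where open ≡-Reasoning

    level-diagonal : ∀ i → ∣ level W (diagonal i) ∣ ≤ 16 * m₂
    level-diagonal i = ℕ.≤-trans (∣level∣ W (diagonal i) (2 * M) (4 * M) (4 * M) (proj₁ (proj₂ (proj₂ guide))) (diagonal≤ i X) (diagonal≤ i Y))
      (ℕ.≤-reflexive (trans (cong₂ _+_ eight eight) (sym (ℕ.*-distribʳ-+ m₂ 8 8))))
      where
      eight : 2 * M * (4 * M) ≡ 8 * m₂
      eight = trans (ℕ.*-assoc 2 M (4 * M)) (trans (cong (2 *_) (trans (ℕ.*-comm M (4 * M)) (ℕ.*-assoc 4 M M))) (sym (ℕ.*-assoc 2 4 m₂)))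

    missed : ∀ s i → diagonal i ⊕ π s ≉ b₀
    missed s i e = go (proj₂ (seen s))
      where
      go : ∣ level W (π s) ∣ ≤ 8 * m₂ ⊎ ∃[ c ] ∣ π s ! c ∣ ≤ M → ⊥
      go (inj₂ (c , h)) = ℕ.<-irrefl (cong ∣_∣ (≈-small c e
          (linear 8 (λ m m₂ m₃ n d x z b → d :≤ 4 :* m ∷ x :≤ m ∷ z :≤ d :+ x ∷ b :≤ 400 :* m₃ ∷ m :≤ m₂ ∷ m₂ :≤ m₃ ∷ 10000 :* m₃ :< n ∷ [] ⊢ z :+ b :< n) refl
            M m₂ m₃ N (∣ diagonal i ! c ∣) (∣ π s ! c ∣) (∣ (diagonal i ⊕ π s) ! c ∣) (∣ b₀ ! c ∣) (diagonal≤ i c) h (proj₁ (⊕-size (diagonal i) (π s) c)) (proj₂ (b₀-size c)) M≤m₂ m₂≤m₃ wide)))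
        (linear 6 (λ m m₂ d x z b → d :≤ 4 :* m ∷ x :≤ m ∷ z :≤ d :+ x ∷ 100 :* m₂ :≤ b ∷ m :≤ m₂ ∷ con 2 :≤ m ∷ [] ⊢ z :< b) refl
          M m₂ (∣ diagonal i ! c ∣) (∣ π s ! c ∣) (∣ (diagonal i ⊕ π s) ! c ∣) (∣ b₀ ! c ∣) (diagonal≤ i c) h (proj₁ (⊕-size (diagonal i) (π s) c)) (proj₁ (b₀-size c)) M≤m₂ 2≤M)
      go (inj₁ h) = ℕ.<⇒≱
        (linear 4 (λ m m₂ x b → x :≤ 24 :* m₂ ∷ 100 :* m₂ :≤ b ∷ m :≤ m₂ ∷ con 2 :≤ m ∷ [] ⊢ x :< b) refl M m₂ (∣ level W (diagonal i ⊕ π s) ∣) (∣ level W b₀ ∣) small level-b₀≥ M≤m₂ 2≤M)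
        (ℕ.≤-reflexive (cong ∣_∣ (sym equal)))
        where
        small : ∣ level W (diagonal i ⊕ π s) ∣ ≤ 24 * m₂
        small = subst (λ z → ∣ z ∣ ≤ 24 * m₂) (sym (level-⊕ W (diagonal i) (π s)))
          (linear 4 (λ m₂ x y z → x :≤ 16 :* m₂ ∷ y :≤ 8 :* m₂ ∷ z :≤ x :+ y ∷ [] ⊢ z :≤ 24 :* m₂) refl m₂ (∣ level W (diagonal i) ∣) (∣ level W (π s) ∣)
            (∣ level W (diagonal i) ℤ.+ level W (π s) ∣) (level-diagonal i) h (ℤ.∣i+j∣≤∣i∣+∣j∣ (level W (diagonal i)) (level W (π s))))
        -- The level is an integral linear form and so respects congruence. Its values at `b₀`, of
        -- order M^4, determine how large N must be.
        congruent : level W (diagonal i ⊕ π s) ≋ level W b₀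
        congruent = ≋-+ (≋-* (W ! X) (ι⇒≋ e Y)) (≋-neg (≋-* (W ! Y) (ι⇒≋ e X)))
        equal : level W (diagonal i ⊕ π s) ≡ level W b₀
        equal = ≋-near congruent (ℕ.≤-<-trans (ℤ.∣i-j∣≤∣i∣+∣j∣ (level W (diagonal i ⊕ π s)) (level W b₀))
          (linear 6 (λ m₂ m₃ m₄ n x y → x :≤ 24 :* m₂ ∷ y :≤ 1000 :* m₄ ∷ m₂ :≤ m₃ ∷ m₃ :≤ m₄ ∷ 10000 :* m₄ :< n ∷ [] ⊢ x :+ y :< n) refl
            m₂ m₃ m₄ N (∣ level W (diagonal i ⊕ π s) ∣) (∣ level W b₀ ∣) small level-b₀≤ m₂≤m₃ m₃≤m₄ wide₄))

    open Idle b₀ (λ i e → missed 0 i (trans (cong ι (⊕𝟎𝟎 (diagonal i))) e))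

    impossible : ⊥
    impossible = forever (λ s → proj₁ (seen s)) missed

-- Excluded middle for finitely many tours, and the constants

-- Double negation commutes with finite products. This collects one instance of excluded middle for
-- each state, arrival and direction into a single oracle.
¬¬-Fin : ∀ {n} {P : Fin n → Set} → (∀ i → ¬ ¬ P i) → ¬ ¬ (∀ i → P i)
¬¬-Fin {zero}  h k = k λ ()
¬¬-Fin {suc n} h k = h zero λ p → ¬¬-Fin (h ∘ suc) λ ps → k λ { zero → p ; (suc i) → ps i }

¬¬-Direction : ∀ {P : Direction → Set} → (∀ d → ¬ ¬ P d) → ¬ ¬ (∀ d → P d)
¬¬-Direction h k = h north λ n → h east λ e → h south λ s → h west λ w →
  k λ { north → n ; east → e ; south → s ; west → w }

¬¬-Maybe : ∀ {P : Maybe Direction → Set} → (∀ m → ¬ ¬ P m) → ¬ ¬ (∀ m → P m)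
¬¬-Maybe h k = h nothing λ p → ¬¬-Direction (h ∘ just) λ ps → k λ { nothing → p ; (just d) → ps d }

module Constants (A : Automaton) where

  -- The number c of minds gives three requirements: the horizon c * c + c of walks, the drift bound
  -- 2 * c + 2, and room 4 * c for two periods of the 2 * c possible meetings. Their bounds are
  -- combined into one M.
  c M : ℕ
  c = Automaton.size A * 5
  M = c * c + c + (4 * c + 2)

  2≤M : 2 ≤ M
  2≤M = ℕ.≤-trans (ℕ.m≤n+m 2 (4 * c)) (ℕ.m≤n+m (4 * c + 2) (c * c + c))

  drift≤M : 2 * c + 2 ≤ M
  drift≤M = linear 2 (λ c s → [] ⊢ 2 :* c :+ con 2 :≤ s :+ c :+ (4 :* c :+ con 2)) refl c (c * c)

  turns≤M : 4 * c ≤ M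
  turns≤M = linear 2 (λ c s → [] ⊢ 4 :* c :≤ s :+ c :+ (4 :* c :+ con 2)) refl c (c * c)

  m₄ : ℕ
  m₄ = M * (M * (M * M))

  1≤M : 1 ≤ M
  1≤M = ℕ.≤-trans (s≤s z≤n) 2≤M

  1≤m₄ : 1 ≤ m₄
  1≤m₄ = ℕ.*-mono-≤ 1≤M (ℕ.*-mono-≤ 1≤M (ℕ.*-mono-≤ 1≤M 1≤M))

  abstract
    N′ : ℕ
    N′ = 10000 * m₄

    2≤N′ : 2 ≤ N′
    2≤N′ = linear 1 (λ m → con 1 :≤ m ∷ [] ⊢ con 2 :≤ 10000 :* m) refl m₄ 1≤m₄

    wide₄ : 10000 * m₄ < suc N′
    wide₄ = ℕ.≤-refl

three-agents-one-token : ∀ t → t ≤ 1 → (arb : Arbiter 3) (A : Automaton) → SolvesBHS arb t A → ⊥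
three-agents-one-token t t≤1 arb A solves = oracle (λ o → Three.Scale.impossible arb A t t≤1 N′ 2≤N′ solves
    (λ { (s , m) d → o s m d }) M (ℕ.m≤m+n (c * c + c) (4 * c + 2)) drift≤M turns≤M wide₄)
  where
  open Constants A
  open Three arb A t t≤1 N′ 2≤N′ solves using (1≤N′)
  open MacroRun A t t≤1 N′ 1≤N′
  oracle : ¬ ¬ (∀ s m d → Dec (∃[ r ] path (s , m) d r ≈ 𝟎))
  oracle = ¬¬-Fin λ s → ¬¬-Maybe λ m → ¬¬-Direction λ d → ¬¬-excluded-middle

theorem3p2 : (∀ k t → 2 ≤ k → (arb : Arbiter k) (A : Automaton) →
    SolvesBHS arb t A → 3 ≤ k)
    × (∀ t → (arb : Arbiter 3) (A : Automaton) →
    SolvesBHS arb t A → 2 ≤ t)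
theorem3p2 = agents , tokens
  where
  agents : ∀ k t → 2 ≤ k → (arb : Arbiter k) (A : Automaton) → SolvesBHS arb t A → 3 ≤ k
  agents 0 t ()
  agents 1 t (s≤s ())
  agents 2 t 2≤k arb A solves = ⊥-elim (TwoAgents.impossible t arb A solves)
  agents (suc (suc (suc k))) t 2≤k arb A solves = s≤s (s≤s (s≤s z≤n))

  tokens : ∀ t → (arb : Arbiter 3) (A : Automaton) → SolvesBHS arb t A → 2 ≤ t
  tokens 0 arb A solves = ⊥-elim (three-agents-one-token 0 z≤n arb A solves)
  tokens 1 arb A solves = ⊥-elim (three-agents-one-token 1 ℕ.≤-refl arb A solves)
  tokens (suc (suc t)) arb A solves = s≤s (s≤s z≤n)
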